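{- Let $\hat g(n;d)$ be the number of $r$-regular bipartite multigraphs on $(U,V)$ whose largest planar subgraph has at most $d$ edges. Then: (i) $\hat g(n;d)$ equals the number of ordered pairs $(P,Q)$ of standard Young tableaux of the same shape, both in $T([rn];d)$ and both satisfying Condition $(\hat T)$: for each $i\in[n]$ and $1\le s<r$, the row containing $r(i-1)+s+1$ is weakly above the row containing $r(i-1)+s$. (ii) $\hat g(n;d)=\sum_{\pi\in S_d}\operatorname{sgn}(\pi)\,|\widehat W'(d,2rn;T(\pi))|$, where $\widehat W'(d,2rn;T(\pi))$ is the set of walks in $W^*(d,2rn;T(\pi))$ with $a_{u^s}<a_{u^{s+1}}$ and $b_{v^s}<b_{v^{s+1}}$ for all $u\in U$, $v\in V$, $1\le s<r$.
   Context: Fix integers $n,r\ge 1$. Let $U=\{u_1,\dots,u_n\}$, $V=\{v_1,\dots,v_n\}$ be disjoint sets ordered by $u_1\prec\cdots\prec u_n$, $v_1\prec\cdots\prec v_n$. An $r$-regular bipartite multigraph on $(U,V)$ is a multiset of edges $uv$ ($u\in U,v\in V$) in which every vertex has degree $r$ (equivalently an $n\times n$ nonnegative integer matrix with all row and column sums $r$). A planar subgraph of such a multigraph $G$ is a sub-multiset of its edges (parallel copies counted separately) any two of which, $uv$ and $u'v'$, satisfy ($u\preceq u'$ and $v\preceq v'$) or ($u'\preceq u$ and $v'\preceq v$); i.e., a set of non-crossing edges which may share endpoints. $T([m];d)$ denotes the set of standard Young tableaux whose entries are exactly $1,\dots,m$ and which have at most $d$ columns (rows are numbered from top to bottom, row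 $i$ above row $i+1$). Walks: a walk of length $2m$ in $\mathbb Z^d$ from the origin whose first $m$ steps are positive and last $m$ steps negative is written $a_1\cdots a_m|b_1\cdots b_m$, $a_i,b_i\in[d]$, with steps $e_{a_1},\dots,e_{a_m},-e_{b_1},\dots,-e_{b_m}$; $W^*(d,2m;P)$ is the set of such walks ending in $P$. With $m=rn$, write $a_{u_i^s}=a_{r(i-1)+s}$ and $b_{v_i^s}=b_{r(i-1)+s}$. For a permutation $\pi$ of $[d]$, $T(\pi)=(1-\pi(1),\dots,d-\pi(d))$. -}

module Defs where

open import Data.Fin as Fin using (Fin; toℕ; combine)
open import Data.Fin.Permutation as Perm using (Permutation′; _⟨$⟩ʳ_; insert; remove; _≈_)
open import Data.Fin.Properties as Fin using (punchIn-injective)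
open import Data.Integer as ℤ using (ℤ; +_; 0ℤ; 1ℤ; -1ℤ)
open import Data.List as List using (List; []; _∷_; length; concat; allFin; upTo; filter; cartesianProduct; cartesianProductWith)
open import Data.List.Membership.Propositional using (_∈_)
open import Data.List.Membership.Propositional.Properties using (∈-allFin)
open import Data.List.Relation.Binary.Permutation.Propositional using (_↭_)
open import Data.List.Relation.Binary.Permutation.Propositional.Properties using (↭-length)
open import Data.List.Relation.Binary.BagAndSetEquality using (∼bag⇒↭)
open import Data.List.Membership.Propositional.Properties.WithK using (unique∧set⇒bag)
open import Data.List.Relation.Binary.Prefix.Heterogeneous using (Prefix)
open import Data.List.Relation.Unary.All using (All)
open import Data.List.Relation.Unary.AllPairs using (AllPairs; []; _∷_)
open import Data.List.Relation.Unary.Any as Any using (Any; here)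
open import Data.List.Relation.Unary.Linked using (Linked)
open import Data.List.Relation.Unary.Unique.Propositional using (Unique)
open import Data.Nat using (ℕ; zero; suc; _+_; _*_; _≤_; _<_; _>_)
open import Data.Product using (_×_; _,_; ∃-syntax)
open import Data.Sum using (_⊎_)
open import Data.Vec as Vec using (Vec; lookup)
open import Function using (_∘_)
open import Function.Bundles using (_⇔_)
open import Function.Properties.Equivalence using (⇔-isEquivalence)
open import Relation.Binary.Structures using (IsEquivalence)
open import Relation.Nullary using (¬_)
open import Relation.Nullary.Decidable using (_×-dec_)
open import Relation.Binary.PropositionalEquality using (_≡_; refl; sym; trans; cong)
import Data.List.Relation.Unary.Any.Properties as Any
import Relation.Binary.PropositionalEquality as ≡
import Data.List.Relation.Unary.All as All
import Data.List.Relation.Unary.All.Properties as All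
import Data.List.Relation.Unary.AllPairs as AllPairs
import Data.List.Relation.Unary.AllPairs.Properties as AllPairs
import Data.List.Relation.Unary.Unique.Propositional.Properties as Unique

-- "The set { x | P x } is finite and has exactly N elements."
HasCard : {A : Set} → (A → Set) → ℕ → Set
HasCard {A} P N =
  ∃[ xs ] Unique xs × ((x : A) → x ∈ xs ⇔ P x) × length xs ≡ N

HasCard-unique : {A : Set} {P : A → Set} {M N : ℕ} →
                 HasCard P M → HasCard P N → M ≡ N
HasCard-unique (xs , u , f , refl) (ys , v , g , refl) =
  ↭-length (∼bag⇒↭ (unique∧set⇒bag u v λ {x} →
    IsEquivalence.trans ⇔-isEquivalence (f x)
      (IsEquivalence.sym ⇔-isEquivalence (g x))))

------------------------------------------------------------------------
-- Bipartite multigraphs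

-- Entry (i , j) is the multiplicity of the edge u_i v_j.
Multigraph : ℕ → Set
Multigraph n = Vec (Vec ℕ n) n

module _ {n : ℕ} where

  mult : Multigraph n → Fin n → Fin n → ℕ
  mult G i j = lookup (lookup G i) j

  degU degV : Multigraph n → Fin n → ℕ
  degU G i = Vec.sum (Vec.tabulate λ j → mult G i j)
  degV G j = Vec.sum (Vec.tabulate λ i → mult G i j)

  Regular : ℕ → Multigraph n → Set
  Regular r G = (∀ i → degU G i ≡ r) × (∀ j → degV G j ≡ r)

  edges : Multigraph n → ℕ
  edges G = Vec.sum (Vec.map Vec.sum G)

  _⊆_ : Multigraph n → Multigraph n → Set
  H ⊆ G = ∀ i j → mult H i j ≤ mult G i j

  -- Parallel copies of an edge never cross, so only the support matters.
  Planar : Multigraph n → Set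
  Planar H = ∀ i j i′ j′ → mult H i j > 0 → mult H i′ j′ > 0 →
    (i Fin.≤ i′ × j Fin.≤ j′) ⊎ (i′ Fin.≤ i × j′ Fin.≤ j)

  PlanarSubgraph : Multigraph n → Multigraph n → Set
  PlanarSubgraph G H = H ⊆ G × Planar H

  LargestPlanar≤ : ℕ → Multigraph n → Set
  LargestPlanar≤ d G = ∀ H → PlanarSubgraph G H → edges H ≤ d

-- The set counted by ĝ(n; d).
Ĝ : (n r d : ℕ) → Multigraph n → Set
Ĝ n r d G = Regular r G × LargestPlanar≤ d G

------------------------------------------------------------------------
-- Standard Young tableaux

-- Rows from top to bottom (English notation).
Tableau : Set
Tableau = List (List ℕ)

shape : Tableau → List ℕ
shape = List.map length

-- The lower row is no longer than the upper one, and each of its entries is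
-- larger than the entry directly above it.
_Above_ : List ℕ → List ℕ → Set
above Above below = Prefix _>_ below above

record IsSYT (m : ℕ) (T : Tableau) : Set where
  field
    nonEmptyRows      : All (λ row → length row > 0) T
    rowsIncreasing    : All (Linked _<_) T
    columnsIncreasing : Linked _Above_ T
    entries           : concat T ↭ List.map suc (upTo m)

-- The set T([m]; d); the length of a row is the number of columns it meets.
SYT≤ : (m d : ℕ) → Tableau → Set
SYT≤ m d T = IsSYT m T × All (λ row → length row ≤ d) T

-- Rows are indexed from the top, so `q Fin.≤ p` reads "q is weakly above p";
-- `toℕ i` is the i - 1 of a one-based index i.
ConditionT̂ : (n r : ℕ) → Tableau → Set
ConditionT̂ n r T = (i : Fin n) (s : ℕ) → 1 ≤ s → s < r →
  (p q : Fin (length T)) →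
  r * toℕ i + s       ∈ List.lookup T p →
  r * toℕ i + (s + 1) ∈ List.lookup T q →
  q Fin.≤ p

TableauPair : (n r d : ℕ) → Tableau × Tableau → Set
TableauPair n r d (P , Q) =
  shape P ≡ shape Q ×
  (SYT≤ (n * r) d P × ConditionT̂ n r P) ×
  (SYT≤ (n * r) d Q × ConditionT̂ n r Q)

------------------------------------------------------------------------
-- Walks

Point : ℕ → Set
Point d = Vec ℤ d

module _ {d : ℕ} where

  origin : Point d
  origin = Vec.replicate d 0ℤ

  _⊕_ : Point d → Point d → Point d
  _⊕_ = Vec.zipWith ℤ._+_

  ⊖_ : Point d → Point d
  ⊖_ = Vec.map (λ x → ℤ.- x)

  e : Fin d → Point d
  e k = origin Vec.[ k ]≔ 1ℤ

-- (a , b) encodes a₁⋯aₘ|b₁⋯bₘ, a walk of length 2m.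
Walk : (d m : ℕ) → Set
Walk d m = Vec (Fin d) m × Vec (Fin d) m

module _ {d m : ℕ} where

  steps : Walk d m → Vec (Point d) (m + m)
  steps (a , b) = Vec.map e a Vec.++ Vec.map (⊖_ ∘ e) b

  endpoint : Walk d m → Point d
  endpoint w = Vec.foldl′ _⊕_ origin (steps w)

  -- W*(d, 2m; P)
  W* : Point d → Walk d m → Set
  W* P w = endpoint w ≡ P

-- `combine i s : Fin (n * r)` has value r * toℕ i + toℕ s, so
-- `lookup a (combine i s)` is the letter of a at u_i^s.
BlockAscending : (n r : ℕ) {d : ℕ} → Vec (Fin d) (n * r) → Set
BlockAscending n r a = (i : Fin n) (s t : Fin r) → toℕ t ≡ suc (toℕ s) →
  lookup a (combine i s) Fin.< lookup a (combine i t)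

-- Ŵ'(d, 2rn; P)
Ŵ′ : (n r : ℕ) {d : ℕ} → Point d → Walk d (n * r) → Set
Ŵ′ n r P w@(a , b) = W* P w × BlockAscending n r a × BlockAscending n r b

-- T(π) = (1 - π(1), …, d - π(d)); the shift to zero-based indices cancels.
T⟨_⟩ : {d : ℕ} → Permutation′ d → Point d
T⟨ π ⟩ = Vec.tabulate λ i → + toℕ i ℤ.- + toℕ (π ⟨$⟩ʳ i)

------------------------------------------------------------------------
-- The symmetric group

inversions : {d : ℕ} → Permutation′ d → List (Fin d × Fin d)
inversions {d} π =
  filter (λ (i , j) → (i Fin.<? j) ×-dec ((π ⟨$⟩ʳ j) Fin.<? (π ⟨$⟩ʳ i)))
         (cartesianProduct (allFin d) (allFin d))

sgn : {d : ℕ} → Permutation′ d → ℤ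
sgn π = -1ℤ ℤ.^ length (inversions π)

perms : (d : ℕ) → List (Permutation′ d)
perms zero    = Perm.id ∷ []
perms (suc d) = cartesianProductWith (insert Fin.zero) (allFin (suc d)) (perms d)

-- Permutations are compared pointwise by _≈_; up to _≈_, `perms d` contains
-- every permutation exactly once.

private
  insert-cong : ∀ {d} j {π ρ : Permutation′ d} → π ≈ ρ →
                insert Fin.zero j π ≈ insert Fin.zero j ρ
  insert-cong j π≈ρ Fin.zero    = refl
  insert-cong j π≈ρ (Fin.suc k) = cong (Fin.punchIn j) (π≈ρ k)

  insert-injectiveʳ : ∀ {d} j {π ρ : Permutation′ d} →
                      insert Fin.zero j π ≈ insert Fin.zero j ρ → π ≈ ρ
  insert-injectiveʳ j eq k = punchIn-injective j _ _ (eq (Fin.suc k))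

perms-complete : ∀ {d} (π : Permutation′ d) → Any (π ≈_) (perms d)
perms-complete {zero}  π = here λ ()
perms-complete {suc d} π =
  Any.cartesianProductWith⁺ (insert Fin.zero)
    (λ { refl eq k → trans (sym (Perm.insert-remove Fin.zero π k)) (insert-cong _ eq k) })
    (∈-allFin (π ⟨$⟩ʳ Fin.zero)) (perms-complete (remove Fin.zero π))

perms-distinct : ∀ d → AllPairs (λ π ρ → ¬ π ≈ ρ) (perms d)
perms-distinct zero    = All.[] ∷ []
perms-distinct (suc d) = go (Unique.allFin⁺ (suc d))
  where
  go : ∀ {js} → Unique js →
       AllPairs (λ π ρ → ¬ π ≈ ρ) (cartesianProductWith (insert Fin.zero) js (perms d))
  go [] = []
  go {j ∷ js} (j∉js ∷ u) = AllPairs.++⁺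
    (AllPairs.map⁺ (AllPairs.map (λ π≉ρ eq → π≉ρ (insert-injectiveʳ j eq)) (perms-distinct d)))
    (go u)
    (All.map⁺ (All.universal (λ π →
      All.cartesianProductWith⁺ (≡.setoid _) (≡.setoid _) (insert Fin.zero) js (perms d)
        λ k∈js _ eq → All.lookup j∉js k∈js (eq Fin.zero)) (perms d)))

∑Sym : (d : ℕ) → (Permutation′ d → ℤ) → ℤ
∑Sym d f = List.foldr ℤ._+_ 0ℤ (List.map f (perms d))

{-# OPTIONS --safe #-}

-- All three counts equal the number of pairs of chains of n horizontal strips of
-- size r from ∅ to a common shape with at most d columns.
--
-- A multiplicity matrix determines, through Fomin's growth diagram with the
-- piecewise linear local rule of RSK, a shape at each corner (i , j); the rule is
-- invertible, so the matrix amounts to the two chains on the right and bottom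
-- boundary. The first row of the shape at (i , j) satisfies the recursion of last
-- passage percolation, so it is the size of a largest planar subgraph of the
-- rectangle and Greene's theorem is not needed.
--
-- A tableau satisfying (T̂) is the standardisation of a chain: block i fills the
-- i-th strip from its bottom row upwards.
--
-- On column heights a strip is a 0/1 vector of weight r. The set of these vectors
-- is symmetric, so summing over them preserves antisymmetry of a function on ℤ^d.
-- An antisymmetric function vanishes on the walls of the Weyl chamber, and a step
-- cannot jump over a wall, so the signed sum over all walks equals the sum over
-- those staying in the chamber; no involution on walks is needed.

module Submission where

open import Defs
open import Algebra.Properties.CommutativeSemigroup using (interchange)
open import Data.Empty using (⊥)
open import Data.Fin as Fin using (Fin; toℕ; fromℕ<)
open import Data.Fin.Permutation as Perm using (Permutation′; _⟨$⟩ʳ_; _⟨$⟩ˡ_; _≈_; _∘ₚ_)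
open import Data.Fin.Properties using (toℕ<n; toℕ-fromℕ<; toℕ-injective; toℕ-cast; toℕ-inject₁)
open import Data.Integer as ℤ using (ℤ; 0ℤ; 1ℤ; -1ℤ)
import Data.Integer.Properties as ℤ
open import Data.Integer.Tactic.RingSolver using () renaming (solve-∀ to solve-∀ℤ)
open import Data.List as List
  using (List; []; _∷_; _++_; length; filter; concat; applyUpTo; upTo; allFin; cartesianProduct; cartesianProductWith)
open import Data.List.Membership.Propositional using (_∈_)
open import Data.List.Membership.Propositional.Properties
open import Data.List.Membership.Propositional.Properties.WithK using (unique∧set⇒bag)
import Data.List.Properties as List
open import Data.List.Relation.Binary.BagAndSetEquality using (∼bag⇒↭)
open import Data.List.Relation.Binary.Permutation.Propositional using (↭-sym; ↭⇒↭ₛ)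
open import Data.List.Relation.Binary.Permutation.Propositional.Properties using (∈-resp-↭)
import Data.List.Relation.Binary.Permutation.Setoid.Properties as Permutation
open import Data.List.Relation.Binary.Prefix.Heterogeneous using (Prefix; []; _∷_; _++ᵖ_)
open import Data.List.Relation.Unary.All as All using (All; []; _∷_)
import Data.List.Relation.Unary.All.Properties as All
open import Data.List.Relation.Unary.AllPairs as AllPairs using (AllPairs; []; _∷_)
import Data.List.Relation.Unary.AllPairs.Properties as AllPairs
open import Data.List.Relation.Unary.Any as Any using (Any; here; there)
open import Data.List.Relation.Unary.Linked using (Linked; _∷_)
open import Data.List.Relation.Unary.Linked.Properties as Linked using (Linked⇒AllPairs; AllPairs⇒Linked)
open import Data.List.Relation.Unary.Unique.Propositional using (Unique)
import Data.List.Relation.Unary.Unique.Propositional.Properties as Unique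
open import Data.Nat hiding (parity)
open import Data.Nat.Divisibility using (divides-refl)
open import Data.Nat.DivMod
open import Data.Nat.Properties
open import Data.Nat.Tactic.RingSolver using (solve-∀)
open import Data.Product hiding (swap)
open import Data.Sum using (_⊎_; inj₁; inj₂)
open import Data.Unit using (⊤; tt)
open import Data.Vec as Vec using (Vec; []; _∷_; lookup)
import Data.Vec.Properties as Vec
open import Function using (_∘_; id)
open import Function.Bundles using (Injection; Equivalence; mk⇔)
open import Function.Properties.Inverse using (↔⇒↣)
open import Relation.Binary.Definitions using (tri<; tri≈; tri>)
open import Relation.Binary.PropositionalEquality
open import Relation.Nullary
open import Relation.Nullary.Decidable using (_×-dec_; _→-dec_; map′)
open import Relation.Unary using (Decidable)
open import Data.List.Membership.DecPropositional _≟_ using (_∈?_)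

-- Finite sums, conjugate partitions and chains of horizontal strips

-- A chain is naturally a function on ℕ, but such functions cannot be listed up to propositional
-- equality, as `HasCard` demands. Pairs of chains are therefore counted as vectors of steps
-- (`ValidPair`), and functions are only intermediaries, compared on their meaningful range by
-- `_≗⟨_⟩_`. The passage to columns is forced: on row lengths a strip may lengthen one row by any
-- amount and so could jump over a wall. A block of `r` ascending letters names the columns that
-- receive a cell, so a whole block, not a letter, is the unit step. The negative half of a walk is
-- treated as a second chain `B` that is subtracted from the first chain `A`. With
-- `ρ = (0, -1, ..., 1 - d)`, a walk ends in `T(π)` exactly when adding its endpoint to `ρ` gives
-- the rearrangement of `ρ` by `π`. The reflection argument is used twice: the sum over `B` is an
-- antisymmetric function of the end of `A`, so the same argument applies to `A`. What survives are
-- the pairs of chains with a common end.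

χ : {P : Set} → Dec P → ℕ
χ (yes _) = 1
χ (no _)  = 0

χ-yes : {P : Set} (P? : Dec P) → P → χ P? ≡ 1
χ-yes (yes _) _ = refl
χ-yes (no ¬p) p = contradiction p ¬p

χ-no : {P : Set} (P? : Dec P) → ¬ P → χ P? ≡ 0
χ-no (yes p) ¬p = contradiction p ¬p
χ-no (no _)  _  = refl

χ≤1 : {P : Set} (P? : Dec P) → χ P? ≤ 1
χ≤1 (yes _) = ≤-refl
χ≤1 (no _)  = z≤n

χ-mono : {P Q : Set} (P? : Dec P) (Q? : Dec Q) → (P → Q) → χ P? ≤ χ Q?
χ-mono (yes p) Q? f = ≤-reflexive (sym (χ-yes Q? (f p)))
χ-mono (no _)  Q? f = z≤n

χ-cong : {P Q : Set} (P? : Dec P) (Q? : Dec Q) → (P → Q) → (Q → P) → χ P? ≡ χ Q?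
χ-cong P? Q? f g = ≤-antisym (χ-mono P? Q? f) (χ-mono Q? P? g)

χ-pos : {P : Set} (P? : Dec P) → 0 < χ P? → P
χ-pos (yes p) _ = p

∑ : ℕ → (ℕ → ℕ) → ℕ
∑ zero    f = 0
∑ (suc n) f = ∑ n f + f n

∑-cong : ∀ n {f g : ℕ → ℕ} → (∀ i → i < n → f i ≡ g i) → ∑ n f ≡ ∑ n g
∑-cong zero    h = refl
∑-cong (suc n) h = cong₂ _+_ (∑-cong n λ i i<n → h i (m<n⇒m<1+n i<n)) (h n (n<1+n n))

∑-mono : ∀ n {f g : ℕ → ℕ} → (∀ i → i < n → f i ≤ g i) → ∑ n f ≤ ∑ n g
∑-mono zero    h = z≤n
∑-mono (suc n) h = +-mono-≤ (∑-mono n λ i i<n → h i (m<n⇒m<1+n i<n)) (h n (n<1+n n))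

∑-zero : ∀ n {f : ℕ → ℕ} → (∀ i → i < n → f i ≡ 0) → ∑ n f ≡ 0
∑-zero zero    h = refl
∑-zero (suc n) h = cong₂ _+_ (∑-zero n λ i i<n → h i (m<n⇒m<1+n i<n)) (h n (n<1+n n))

∑-const : ∀ n k → ∑ n (λ _ → k) ≡ n * k
∑-const zero    k = refl
∑-const (suc n) k = trans (cong (_+ k) (∑-const n k)) (+-comm (n * k) k)

∑-+ : ∀ n (f g : ℕ → ℕ) → ∑ n (λ i → f i + g i) ≡ ∑ n f + ∑ n g
∑-+ zero    f g = refl
∑-+ (suc n) f g = trans (cong (_+ (f n + g n)) (∑-+ n f g))
                        (interchange +-commutativeSemigroup (∑ n f) (∑ n g) (f n) (g n))

∑-swap : ∀ m n (f : ℕ → ℕ → ℕ) → ∑ m (λ i → ∑ n (f i)) ≡ ∑ n (λ j → ∑ m (λ i → f i j))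
∑-swap zero    n f = sym (∑-zero n λ _ _ → refl)
∑-swap (suc m) n f = trans (cong (_+ ∑ n (f m)) (∑-swap m n f))
                           (sym (∑-+ n (λ j → ∑ m (λ i → f i j)) (f m)))

∑-head : ∀ n (f : ℕ → ℕ) → ∑ (suc n) f ≡ f 0 + ∑ n (f ∘ suc)
∑-head zero    f = +-comm 0 (f 0)
∑-head (suc n) f = trans (cong (_+ f (suc n)) (∑-head n f)) (+-assoc (f 0) _ _)

∑-split : ∀ m n (f : ℕ → ℕ) → ∑ (m + n) f ≡ ∑ m f + ∑ n (λ i → f (m + i))
∑-split m zero    f = trans (cong (λ k → ∑ k f) (+-identityʳ m)) (sym (+-identityʳ _))
∑-split m (suc n) f = trans (cong (λ k → ∑ k f) (+-suc m n))
  (trans (cong (_+ f (m + n)) (∑-split m n f)) (+-assoc (∑ m f) _ _))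

∑-≤ : ∀ {m n} (f : ℕ → ℕ) → m ≤ n → ∑ m f ≤ ∑ n f
∑-≤ {m} f m≤n with k , refl ← m≤n⇒∃[o]m+o≡n m≤n =
  ≤-trans (m≤m+n _ _) (≤-reflexive (sym (∑-split m k f)))

∑-term : ∀ {i n} (f : ℕ → ℕ) → i < n → f i ≤ ∑ n f
∑-term {i} f i<n = ≤-trans (m≤n+m (f i) (∑ i f)) (∑-≤ f i<n)

∑-positive : ∀ n {f : ℕ → ℕ} → 0 < ∑ n f → ∃[ i ] i < n × 0 < f i
∑-positive (suc n) {f} 0<∑ with f n in eq
... | suc _ = n , n<1+n n , subst (0 <_) (sym eq) z<s
... | zero  with i , i<n , 0<f ← ∑-positive n (subst (0 <_) (+-identityʳ _) 0<∑) = i , m<n⇒m<1+n i<n , 0<f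

∑-extend : ∀ {m n} (f : ℕ → ℕ) → m ≤ n → (∀ i → m ≤ i → f i ≡ 0) → ∑ n f ≡ ∑ m f
∑-extend {m} f m≤n h with k , refl ← m≤n⇒∃[o]m+o≡n m≤n =
  trans (∑-split m k f) (trans (cong (∑ m f +_) (∑-zero k λ i _ → h (m + i) (m≤m+n m i)))
                               (+-identityʳ _))

module _ {P : ℕ → Set} (P? : Decidable P) where

  ∑χ≤ : ∀ n → ∑ n (χ ∘ P?) ≤ n
  ∑χ≤ n = ≤-trans (∑-mono n λ i _ → χ≤1 (P? i))
                  (≤-reflexive (trans (∑-const n 1) (*-identityʳ n)))

  ∑χ-all : ∀ n → (∀ i → i < n → P i) → ∑ n (χ ∘ P?) ≡ n
  ∑χ-all n h = trans (∑-cong n λ i i<n → χ-yes (P? i) (h i i<n))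
                     (trans (∑-const n 1) (*-identityʳ n))

  ∑χ-none : ∀ n → (∀ i → i < n → ¬ P i) → ∑ n (χ ∘ P?) ≡ 0
  ∑χ-none n h = ∑-zero n λ i i<n → χ-no (P? i) (h i i<n)

  module _ (down : ∀ i j → i ≤ j → P j → P i) where

    -- A downward closed predicate holds on an initial segment, so its count is the point where it
    -- stops holding. Conjugate partitions and the word of a chain are both read off through this
    -- equivalence.
    <∑χ⁺ : ∀ {k n} → k < n → P k → k < ∑ n (χ ∘ P?)
    <∑χ⁺ {k} k<n p = ≤-trans (≤-reflexive (sym (∑χ-all (suc k) λ i i<1+k → down i k (s≤s⁻¹ i<1+k) p)))
                              (∑-≤ (χ ∘ P?) k<n)

    <∑χ⁻ : ∀ {k n} → k < ∑ n (χ ∘ P?) → P k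
    <∑χ⁻ {k} {n} k<∑ with P? k
    ... | yes p = p
    ... | no ¬p = contradiction k<∑ (≤⇒≯ (bound (≤-total n k)))
      where
      bound : n ≤ k ⊎ k ≤ n → ∑ n (χ ∘ P?) ≤ k
      bound (inj₁ n≤k) = ≤-trans (∑χ≤ n) n≤k
      bound (inj₂ k≤n) = ≤-trans (≤-reflexive (∑-extend (χ ∘ P?) k≤n λ i k≤i →
        χ-no (P? i) (λ pi → ¬p (down k i k≤i pi)))) (∑χ≤ k)

∑χ-cong : ∀ n {P Q : ℕ → Set} (P? : Decidable P) (Q? : Decidable Q) →
          (∀ i → i < n → P i → Q i) → (∀ i → i < n → Q i → P i) → ∑ n (χ ∘ P?) ≡ ∑ n (χ ∘ Q?)
∑χ-cong n P? Q? f g = ∑-cong n λ i i<n → χ-cong (P? i) (Q? i) (f i i<n) (g i i<n)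

∑χ-mono : ∀ n {P Q : ℕ → Set} (P? : Decidable P) (Q? : Decidable Q) →
          (∀ i → i < n → P i → Q i) → ∑ n (χ ∘ P?) ≤ ∑ n (χ ∘ Q?)
∑χ-mono n P? Q? f = ∑-mono n λ i i<n → χ-mono (P? i) (Q? i) (f i i<n)

∑χ-< : ∀ n {m} → m ≤ n → ∑ n (λ i → χ (i <? m)) ≡ m
∑χ-< n {m} m≤n = trans
  (∑-extend (λ i → χ (i <? m)) m≤n (λ i m≤i → χ-no (i <? m) (≤⇒≯ m≤i)))
  (∑χ-all (_<? m) m λ i i<m → i<m)

Decreasing : (ℕ → ℕ) → Set
Decreasing f = ∀ k → f (suc k) ≤ f k

decreasing-≤ : ∀ {f} → Decreasing f → ∀ {i j} → i ≤ j → f j ≤ f i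
decreasing-≤ {f} dec {i} i≤j with k , refl ← m≤n⇒∃[o]m+o≡n i≤j = go k
  where
  go : ∀ k → f (i + k) ≤ f i
  go zero    = ≤-reflexive (cong f (+-identityʳ i))
  go (suc k) = ≤-trans (≤-reflexive (cong f (+-suc i k))) (≤-trans (dec (i + k)) (go k))

conj : ℕ → (ℕ → ℕ) → ℕ → ℕ
conj n f c = ∑ n (λ k → χ (c <? f k))

module _ (n : ℕ) where

  conj-cong : ∀ {f g} → (∀ k → k < n → f k ≡ g k) → ∀ c → conj n f c ≡ conj n g c
  conj-cong h c = ∑-cong n λ k k<n → cong (λ x → χ (c <? x)) (h k k<n)

  conj-mono : ∀ {f g} → (∀ k → k < n → f k ≤ g k) → ∀ c → conj n f c ≤ conj n g c
  conj-mono {f} {g} h c = ∑χ-mono n (λ k → c <? f k) (λ k → c <? g k) λ k k<n c<f → <-≤-trans c<f (h k k<n)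

  conj≤ : ∀ f c → conj n f c ≤ n
  conj≤ f c = ∑χ≤ (λ k → c <? f k) n

  conj-decreasing : ∀ f → Decreasing (conj n f)
  conj-decreasing f c = ∑χ-mono n (λ k → suc c <? f k) (λ k → c <? f k) λ k _ → <-trans (n<1+n c)

  conj-zero : ∀ f c → (∀ k → k < n → f k ≤ c) → conj n f c ≡ 0
  conj-zero f c h = ∑χ-none (λ k → c <? f k) n λ k k<n → ≤⇒≯ (h k k<n)

  module _ {f : ℕ → ℕ} (dec : Decreasing f) where

    <conj⁺ : ∀ {k c} → k < n → c < f k → k < conj n f c
    <conj⁺ {c = c} = <∑χ⁺ (λ k → c <? f k) λ i j i≤j c<fj → <-≤-trans c<fj (decreasing-≤ dec i≤j)

    <conj⁻ : ∀ {k c} → k < conj n f c → c < f k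
    <conj⁻ {c = c} = <∑χ⁻ (λ k → c <? f k) (λ i j i≤j c<fj → <-≤-trans c<fj (decreasing-≤ dec i≤j)) {n = n}

    -- By `<conj⁺` and `<conj⁻` the conditions `k < conj n f c` and `c < f k` describe the same
    -- cells of the diagram. The bounds `d` and `n` must enclose all of it, or the truncated sums
    -- would cut off cells.
    conj-involutive : ∀ d → f 0 ≤ d → (∀ k → n ≤ k → f k ≡ 0) → ∀ k → conj d (conj n f) k ≡ f k
    conj-involutive d f0≤d f≡0 k with k <? n
    ... | yes k<n = trans (∑χ-cong d (λ c → k <? conj n f c) (_<? f k) (λ _ _ → <conj⁻) (λ _ _ → <conj⁺ k<n))
                          (∑χ-< d (≤-trans (decreasing-≤ dec z≤n) f0≤d))
    ... | no k≮n  = trans (∑χ-none (λ c → k <? conj n f c) d λ c _ k<c → k≮n (<-≤-trans k<c (conj≤ f c)))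
                          (sym (f≡0 k (≮⇒≥ k≮n)))

  ∑-conj : ∀ d f → (∀ k → k < n → f k ≤ d) → ∑ d (conj n f) ≡ ∑ n f
  ∑-conj d f f≤d = trans (∑-swap d n (λ c k → χ (c <? f k))) (∑-cong n λ k k<n → ∑χ-< d (f≤d k k<n))

-- The default `z` turns a vector into a function on ℕ, so neighbours `suc i` can be mentioned and
-- sums extended without carrying bounds.
at : {A : Set} {n : ℕ} → A → Vec A n → ℕ → A
at z []       _       = z
at z (x ∷ xs) zero    = x
at z (x ∷ xs) (suc i) = at z xs i

tab : {A : Set} (n : ℕ) → (ℕ → A) → Vec A n
tab n f = Vec.tabulate (f ∘ toℕ)

module _ {A : Set} where

  at-tab : ∀ {n} (z : A) (f : ℕ → A) {i} → i < n → at z (tab n f) i ≡ f i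
  at-tab {suc n} z f {zero}  _   = refl
  at-tab {suc n} z f {suc i} i<n = at-tab z (f ∘ suc) (s≤s⁻¹ i<n)

  at-≥ : ∀ {n} (z : A) (xs : Vec A n) {i} → n ≤ i → at z xs i ≡ z
  at-≥ z []       _           = refl
  at-≥ z (x ∷ xs) {suc i} n≤i = at-≥ z xs (s≤s⁻¹ n≤i)

  at-toℕ : ∀ {n} (z : A) (xs : Vec A n) i → at z xs (toℕ i) ≡ lookup xs i
  at-toℕ z (x ∷ xs) Fin.zero    = refl
  at-toℕ z (x ∷ xs) (Fin.suc i) = at-toℕ z xs i

  at-ext : ∀ {n} (z : A) (xs ys : Vec A n) → (∀ i → i < n → at z xs i ≡ at z ys i) → xs ≡ ys
  at-ext z []       []       h = refl
  at-ext z (x ∷ xs) (y ∷ ys) h =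
    cong₂ _∷_ (h 0 z<s) (at-ext z xs ys λ i i<n → h (suc i) (s≤s i<n))

  tab-cong : ∀ n {f g : ℕ → A} → (∀ i → i < n → f i ≡ g i) → tab n f ≡ tab n g
  tab-cong zero    h = refl
  tab-cong (suc n) h = cong₂ _∷_ (h 0 z<s) (tab-cong n λ i i<n → h (suc i) (s≤s i<n))

sum-at : ∀ {n} (xs : Vec ℕ n) → Vec.sum xs ≡ ∑ n (at 0 xs)
sum-at []               = refl
sum-at {suc n} (x ∷ xs) = trans (cong (x +_) (sum-at xs)) (sym (∑-head n (at 0 (x ∷ xs))))

-- l i k is the length of row k of the i-th shape in a chain of n horizontal
-- strips of size r, all shapes having at most d columns.
record RowChain (n r d : ℕ) (l : ℕ → ℕ → ℕ) : Set where
  field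
    start : ∀ k → l 0 k ≡ 0
    grows : ∀ i k → i < n → l i k ≤ l (suc i) k
    strip : ∀ i k → i < n → l (suc i) (suc k) ≤ l i k
    size  : ∀ i → i ≤ n → ∑ n (l i) ≡ r * i
    width : l n 0 ≤ d

  decreasing : ∀ i → i ≤ n → Decreasing (l i)
  decreasing zero    _   k = ≤-reflexive (trans (start (suc k)) (sym (start k)))
  decreasing (suc i) i<n k = ≤-trans (strip i k i<n) (grows i k i<n)

  -- A horizontal strip adds at most one row. This is why summing only `n` rows in `size` misses no
  -- cell.
  height : ∀ i → i ≤ n → ∀ k → i ≤ k → l i k ≡ 0
  height zero    _   k       _   = start k
  height (suc i) i<n (suc k) i≤k = n≤0⇒n≡0 (≤-trans (strip i k i<n)
    (≤-reflexive (height i (<⇒≤ i<n) k (s≤s⁻¹ i≤k))))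

  monotone : ∀ {i j} → i ≤ j → j ≤ n → ∀ k → l i k ≤ l j k
  monotone {i} {j} i≤j j≤n k with m≤n⇒m<n∨m≡n i≤j
  ... | inj₂ refl = ≤-refl
  monotone {i} {suc j} i≤j j≤n k | inj₁ i<j = ≤-trans (monotone (s≤s⁻¹ i<j) (<⇒≤ j≤n) k) (grows j k j≤n)

  bounded : ∀ i → i ≤ n → ∀ k → l i k ≤ d
  bounded i i≤n k = ≤-trans (decreasing-≤ (decreasing i i≤n) z≤n) (≤-trans (monotone i≤n ≤-refl 0) width)

RowChainPair : (n r d : ℕ) → (l m : ℕ → ℕ → ℕ) → Set
RowChainPair n r d l m = RowChain n r d l × RowChain n r d m × (∀ k → l n k ≡ m n k)

-- Only the shapes with index up to `n` carry meaning; the values of a chain beyond them are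
-- arbitrary.
_≗⟨_⟩_ : (ℕ → ℕ → ℕ) → ℕ → (ℕ → ℕ → ℕ) → Set
l ≗⟨ n ⟩ m = ∀ i → i ≤ n → ∀ k → l i k ≡ m i k

-- Chains of column heights

total : ∀ {n d} → Vec (Vec ℕ d) n → ℕ → ℕ
total []      c = 0
total (ε ∷ A) c = total A c + at 0 ε c

-- The last step comes first; entry c of a step says whether column c grows.
ValidSteps : ∀ {n d} → ℕ → Vec (Vec ℕ d) n → Set
ValidSteps r []      = ⊤
ValidSteps r (ε ∷ A) =
  ValidSteps r A × (∀ c → at 0 ε c ≤ 1) × Vec.sum ε ≡ r × Decreasing (total (ε ∷ A))

ValidPair : (n r d : ℕ) → Vec (Vec ℕ d) n × Vec (Vec ℕ d) n → Set
ValidPair n r d (A , B) = ValidSteps r A × ValidSteps r B × (∀ c → total A c ≡ total B c)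

-- A `RowChain` after conjugation: a horizontal strip has at most one cell in each column, which
-- becomes `slow`, and the bound on the width becomes `support`.
record ColumnChain (n r d : ℕ) (x : ℕ → ℕ → ℕ) : Set where
  field
    start      : ∀ c → x 0 c ≡ 0
    grows      : ∀ i c → i < n → x i c ≤ x (suc i) c
    slow       : ∀ i c → i < n → x (suc i) c ≤ suc (x i c)
    size       : ∀ i → i ≤ n → ∑ d (x i) ≡ r * i
    decreasing : ∀ i → i ≤ n → Decreasing (x i)
    support    : ∀ i c → i ≤ n → d ≤ c → x i c ≡ 0

  bounded : ∀ i c → i ≤ n → x i c ≤ i
  bounded zero    c _   = ≤-reflexive (start c)
  bounded (suc i) c i<n = ≤-trans (slow i c i<n) (s≤s (bounded i c (<⇒≤ i<n)))

open ColumnChain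

restrict : ∀ {n r d x} → ColumnChain (suc n) r d x → ColumnChain n r d x
restrict X = record
  { start      = start X
  ; grows      = λ i c i<n → grows X i c (m<n⇒m<1+n i<n)
  ; slow       = λ i c i<n → slow X i c (m<n⇒m<1+n i<n)
  ; size       = λ i i≤n → size X i (m≤n⇒m≤1+n i≤n)
  ; decreasing = λ i i≤n → decreasing X i (m≤n⇒m≤1+n i≤n)
  ; support    = λ i c i≤n → support X i c (m≤n⇒m≤1+n i≤n) }

columns⇒rows : ∀ {n r d x} → ColumnChain n r d x → RowChain n r d (λ i → conj d (x i))
columns⇒rows {n} {r} {d} {x} X = record
  { start = λ k → conj-zero d (x 0) k λ c _ → ≤-trans (≤-reflexive (start X c)) z≤n
  ; grows = λ i k i<n → conj-mono d (λ c _ → grows X i c i<n) k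
  ; strip = λ i k i<n → ∑χ-mono d (λ c → suc k <? x (suc i) c) (λ c → k <? x i c)
      λ c _ k<x → s<s⁻¹ (<-≤-trans k<x (slow X i c i<n))
  ; size  = λ i i≤n → trans (∑-conj d n (x i) λ c _ → ≤-trans (bounded X i c i≤n) i≤n) (size X i i≤n)
  ; width = conj≤ d (x n) 0 }

rows⇒columns : ∀ {n r d l} → RowChain n r d l → ColumnChain n r d (λ i → conj n (l i))
rows⇒columns {n} {r} {d} {l} L = record
  { start      = λ c → conj-zero n (l 0) c λ k _ → ≤-trans (≤-reflexive (L.start k)) z≤n
  ; grows      = λ i c i<n → conj-mono n (λ k _ → L.grows i k i<n) c
  ; slow       = slow′
  ; size       = λ i i≤n → trans (∑-conj n d (l i) λ k _ → L.bounded i i≤n k) (L.size i i≤n)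
  ; decreasing = λ i _ → conj-decreasing n (l i)
  ; support    = λ i c i≤n d≤c → conj-zero n (l i) c λ k _ → ≤-trans (L.bounded i i≤n k) d≤c }
  where
  module L = RowChain L
  -- Row `k + 1` of the larger shape is no longer than row `k` of the smaller one. Shifting the sum
  -- by one row thus leaves only the top row unmatched, which accounts for the one extra cell.
  slow′ : ∀ i c → i < n → conj n (l (suc i)) c ≤ suc (conj n (l i) c)
  slow′ i c i<n@(s≤s {n = n′} _) = begin
    conj (suc n′) (l (suc i)) c
      ≡⟨ ∑-head n′ (λ k → χ (c <? l (suc i) k)) ⟩
    χ (c <? l (suc i) 0) + ∑ n′ (λ k → χ (c <? l (suc i) (suc k)))
      ≤⟨ +-mono-≤ (χ≤1 (c <? l (suc i) 0)) (∑χ-mono n′ (λ k → c <? l (suc i) (suc k)) (λ k → c <? l i k)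
           λ k _ c<l → <-≤-trans c<l (L.strip i k i<n)) ⟩
    suc (∑ n′ (λ k → χ (c <? l i k)))
      ≤⟨ s≤s (m≤m+n _ _) ⟩
    suc (conj (suc n′) (l i) c) ∎
    where open ≤-Reasoning

-- Steps are stored last first: the head of `ε ∷ A` leads from shape `n` to shape `n + 1`, so it
-- counts only for `i > n`.
columns : ∀ {n d} → Vec (Vec ℕ d) n → ℕ → ℕ → ℕ
columns         []      i c = 0
columns {suc n} (ε ∷ A) i c = columns A i c + χ (n <? i) * at 0 ε c

columns-tail : ∀ {n d} (ε : Vec ℕ d) (A : Vec (Vec ℕ d) n) {i} → i ≤ n → ∀ c → columns (ε ∷ A) i c ≡ columns A i c
columns-tail {n} ε A {i} i≤n c rewrite χ-no (n <? i) (≤⇒≯ i≤n) = +-identityʳ _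

columns-total : ∀ {n d} (A : Vec (Vec ℕ d) n) {i} → n ≤ i → ∀ c → columns A i c ≡ total A c
columns-total []      _ c = refl
columns-total {suc n} (ε ∷ A) {i} n<i c rewrite χ-yes (n <? i) n<i =
  cong₂ _+_ (columns-total A (<⇒≤ n<i) c) (+-identityʳ _)

columns-last : ∀ {n d} (ε : Vec ℕ d) (A : Vec (Vec ℕ d) n) c → columns (ε ∷ A) (suc n) c ≡ columns A n c + at 0 ε c
columns-last ε A c = trans (columns-total (ε ∷ A) ≤-refl c) (cong (_+ at 0 ε c) (sym (columns-total A ≤-refl c)))

fromColumns : ∀ n d → (ℕ → ℕ → ℕ) → Vec (Vec ℕ d) n
fromColumns zero    d x = []
fromColumns (suc n) d x = tab d (λ c → x (suc n) c ∸ x n c) ∷ fromColumns n d x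

fromColumns-cong : ∀ n {d x y} → x ≗⟨ n ⟩ y → fromColumns n d x ≡ fromColumns n d y
fromColumns-cong zero    h = refl
fromColumns-cong (suc n) {d} h = cong₂ _∷_
  (tab-cong d λ c _ → cong₂ _∸_ (h (suc n) ≤-refl c) (h n (n≤1+n n) c))
  (fromColumns-cong n λ i i≤n → h i (m≤n⇒m≤1+n i≤n))

fromColumns-columns : ∀ {n d} (A : Vec (Vec ℕ d) n) → fromColumns n d (columns A) ≡ A
fromColumns-columns [] = refl
fromColumns-columns {suc n} {d} (ε ∷ A) = cong₂ _∷_
  (at-ext 0 _ ε λ c c<d → trans (at-tab 0 _ c<d)
    (trans (cong₂ _∸_ (columns-last ε A c) (columns-tail ε A ≤-refl c)) (m+n∸m≡n (columns A n c) _)))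
  (trans (fromColumns-cong n λ i i≤n → columns-tail ε A i≤n) (fromColumns-columns A))

module _ {r d : ℕ} where

  step-at : ∀ {n x} → ColumnChain (suc n) r d x → ∀ c →
    x n c + at 0 (tab d (λ c → x (suc n) c ∸ x n c)) c ≡ x (suc n) c
  step-at {n} {x} X c with c <? d
  ... | yes c<d = trans (cong (x n c +_) (at-tab 0 _ c<d)) (m+[n∸m]≡n (grows X n c ≤-refl))
  ... | no c≮d  = trans (cong₂ _+_ (support X n c (n≤1+n n) d≤c) (at-≥ 0 (tab d λ c → x (suc n) c ∸ x n c) d≤c))
                        (sym (support X (suc n) c ≤-refl d≤c))
    where d≤c = ≮⇒≥ c≮d

  columns-fromColumns : ∀ n {x} → ColumnChain n r d x → columns (fromColumns n d x) ≗⟨ n ⟩ x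
  columns-fromColumns zero    X zero i≤n c = sym (start X c)
  columns-fromColumns (suc n) {x} X i i≤n c with m≤n⇒m<n∨m≡n i≤n
  ... | inj₁ i<n  = trans (columns-tail (tab d (λ c → x (suc n) c ∸ x n c)) (fromColumns n d x) (s≤s⁻¹ i<n) c)
                          (columns-fromColumns n (restrict X) i (s≤s⁻¹ i<n) c)
  ... | inj₂ refl = trans (columns-last ε (fromColumns n d x) c)
    (trans (cong (_+ at 0 ε c) (columns-fromColumns n (restrict X) n ≤-refl c)) (step-at X c))
    where ε = tab d (λ c → x (suc n) c ∸ x n c)

  fromColumns-valid : ∀ n {x} → ColumnChain n r d x → ValidSteps r (fromColumns n d x)
  fromColumns-valid zero    X = tt
  fromColumns-valid (suc n) {x} X = fromColumns-valid n (restrict X) , bit , weight , decr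
    where
    ε = tab d (λ c → x (suc n) c ∸ x n c)
    bit : ∀ c → at 0 ε c ≤ 1
    bit c = +-cancelˡ-≤ (x n c) _ _ (≤-trans (≤-reflexive (step-at X c))
      (≤-trans (slow X n c ≤-refl) (≤-reflexive (+-comm 1 (x n c)))))
    weight : Vec.sum ε ≡ r
    weight = +-cancelˡ-≡ (∑ d (x n)) _ _ (begin
      ∑ d (x n) + Vec.sum ε          ≡⟨ cong (∑ d (x n) +_) (sum-at ε) ⟩
      ∑ d (x n) + ∑ d (at 0 ε)       ≡⟨ ∑-+ d (x n) (at 0 ε) ⟨
      ∑ d (λ c → x n c + at 0 ε c)   ≡⟨ ∑-cong d (λ c _ → step-at X c) ⟩
      ∑ d (x (suc n))                ≡⟨ trans (size X (suc n) ≤-refl) (trans (*-suc r n) (+-comm r _)) ⟩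
      r * n + r                      ≡⟨ cong (_+ r) (size X n (n≤1+n n)) ⟨
      ∑ d (x n) + r                  ∎)
      where open ≡-Reasoning
    total≡x : ∀ c → total (fromColumns (suc n) d x) c ≡ x (suc n) c
    total≡x c = trans (sym (columns-total (fromColumns (suc n) d x) ≤-refl c))
                      (columns-fromColumns (suc n) X (suc n) ≤-refl c)
    decr : Decreasing (total (fromColumns (suc n) d x))
    decr c = subst₂ _≤_ (sym (total≡x (suc c))) (sym (total≡x c)) (decreasing X (suc n) ≤-refl c)

  columns-chain : ∀ {n} (A : Vec (Vec ℕ d) n) → ValidSteps r A → ColumnChain n r d (columns A)
  columns-chain [] _ = record
    { start = λ _ → refl ; grows = λ _ _ () ; slow = λ _ _ ()
    ; size = λ { zero _ → trans (∑-zero d λ _ _ → refl) (sym (*-zeroʳ r)) }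
    ; decreasing = λ _ _ _ → z≤n ; support = λ _ _ _ _ → refl }
  columns-chain {suc n} (ε ∷ A) (valid , bit , weight , decr) = record
    { start = λ c → trans (tail z≤n c) (start X c)
    ; grows = λ i c i<n → grows′ i c (m≤n⇒m<n∨m≡n i<n)
    ; slow  = λ i c i<n → slow′ i c (m≤n⇒m<n∨m≡n i<n)
    ; size  = λ i i≤n → size′ i (m≤n⇒m<n∨m≡n i≤n)
    ; decreasing = λ i i≤n → decreasing′ i (m≤n⇒m<n∨m≡n i≤n)
    ; support = λ i c i≤n → support′ i c (m≤n⇒m<n∨m≡n i≤n) }
    where
    X = columns-chain A valid
    tail : ∀ {i} → i ≤ n → ∀ c → columns (ε ∷ A) i c ≡ columns A i c
    tail = columns-tail ε A
    last : ∀ c → columns (ε ∷ A) (suc n) c ≡ columns A n c + at 0 ε c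
    last = columns-last ε A
    grows′ : ∀ i c → suc i < suc n ⊎ suc i ≡ suc n → columns (ε ∷ A) i c ≤ columns (ε ∷ A) (suc i) c
    grows′ i c (inj₁ (s≤s i<n)) = subst₂ _≤_ (sym (tail (<⇒≤ i<n) c)) (sym (tail i<n c)) (grows X i c i<n)
    grows′ i c (inj₂ refl)      = subst₂ _≤_ (sym (tail ≤-refl c)) (sym (last c)) (m≤m+n _ _)
    slow′ : ∀ i c → suc i < suc n ⊎ suc i ≡ suc n → columns (ε ∷ A) (suc i) c ≤ suc (columns (ε ∷ A) i c)
    slow′ i c (inj₁ (s≤s i<n)) = subst₂ _≤_ (sym (tail i<n c)) (sym (cong suc (tail (<⇒≤ i<n) c))) (slow X i c i<n)
    slow′ i c (inj₂ refl)      = subst₂ _≤_ (sym (last c)) (trans (+-comm _ 1) (sym (cong suc (tail ≤-refl c))))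
                                   (+-monoʳ-≤ (columns A n c) (bit c))
    size′ : ∀ i → i < suc n ⊎ i ≡ suc n → ∑ d (columns (ε ∷ A) i) ≡ r * i
    size′ i (inj₁ (s≤s i≤n)) = trans (∑-cong d λ c _ → tail i≤n c) (size X i i≤n)
    size′ i (inj₂ refl)      = trans (∑-cong d λ c _ → last c) (trans (∑-+ d (columns A n) (at 0 ε))
      (trans (cong₂ _+_ (size X n ≤-refl) (trans (sym (sum-at ε)) weight))
        (trans (+-comm (r * n) r) (sym (*-suc r n)))))
    decreasing′ : ∀ i → i < suc n ⊎ i ≡ suc n → Decreasing (columns (ε ∷ A) i)
    decreasing′ i (inj₁ (s≤s i≤n)) c = subst₂ _≤_ (sym (tail i≤n (suc c))) (sym (tail i≤n c)) (decreasing X i i≤n c)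
    decreasing′ i (inj₂ refl)      c = subst₂ _≤_ (sym (columns-total (ε ∷ A) ≤-refl (suc c)))
                                         (sym (columns-total (ε ∷ A) ≤-refl c)) (decr c)
    support′ : ∀ i c → i < suc n ⊎ i ≡ suc n → d ≤ c → columns (ε ∷ A) i c ≡ 0
    support′ i c (inj₁ (s≤s i≤n)) d≤c = trans (tail i≤n c) (support X i c i≤n d≤c)
    support′ i c (inj₂ refl)      d≤c = trans (last c) (cong₂ _+_ (support X n c ≤-refl d≤c) (at-≥ 0 ε d≤c))

rowsOf : ∀ {n d} → Vec (Vec ℕ d) n → ℕ → ℕ → ℕ
rowsOf {d = d} A i = conj d (columns A i)

stepsOf : ∀ n d → (ℕ → ℕ → ℕ) → Vec (Vec ℕ d) n
stepsOf n d l = fromColumns n d (λ i → conj n (l i))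

stepsOf-cong : ∀ n d {l l′} → l ≗⟨ n ⟩ l′ → stepsOf n d l ≡ stepsOf n d l′
stepsOf-cong n d h = fromColumns-cong n λ i i≤n c → conj-cong n (λ k _ → h i i≤n k) c

stepsOf-rowsOf : ∀ {n r d} (A : Vec (Vec ℕ d) n) → ValidSteps r A → stepsOf n d (rowsOf A) ≡ A
stepsOf-rowsOf {n} {r} {d} A valid = trans
  (fromColumns-cong n λ i i≤n c → conj-involutive d (decreasing X i i≤n) n (≤-trans (bounded X i 0 i≤n) i≤n)
    (λ c d≤c → support X i c i≤n d≤c) c)
  (fromColumns-columns A)
  where X = columns-chain A valid

rowsOf-stepsOf : ∀ {n r d l} → RowChain n r d l → rowsOf (stepsOf n d l) ≗⟨ n ⟩ l
rowsOf-stepsOf {n} {r} {d} {l} L i i≤n k = trans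
  (conj-cong d (λ c _ → columns-fromColumns n (rows⇒columns L) i i≤n c) k)
  (conj-involutive n (L.decreasing i i≤n) d (L.bounded i i≤n 0) (λ k n≤k → L.height i i≤n k (≤-trans i≤n n≤k)) k)
  where module L = RowChain L

validPair⇒chains : ∀ {n r d} {A B : Vec (Vec ℕ d) n} → ValidPair n r d (A , B) → RowChainPair n r d (rowsOf A) (rowsOf B)
validPair⇒chains {d = d} {A} {B} (validA , validB , same) =
  columns⇒rows (columns-chain A validA) , columns⇒rows (columns-chain B validB) ,
  conj-cong d λ c _ → trans (columns-total A ≤-refl c) (trans (same c) (sym (columns-total B ≤-refl c)))

chains⇒validPair : ∀ {n r d l m} → RowChainPair n r d l m → ValidPair n r d (stepsOf n d l , stepsOf n d m)
chains⇒validPair {n} {r} {d} {l} {m} (L , M , same) =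
  fromColumns-valid n (rows⇒columns L) , fromColumns-valid n (rows⇒columns M) , λ c →
    trans (total≡ L c) (trans (conj-cong n (λ k _ → same k) c) (sym (total≡ M c)))
  where
  total≡ : ∀ {l} → RowChain n r d l → ∀ c → total (stepsOf n d l) c ≡ conj n (l n) c
  total≡ {l} L c = trans (sym (columns-total (stepsOf n d l) ≤-refl c))
                         (columns-fromColumns n (rows⇒columns L) n ≤-refl c)

-- Growth diagrams and last passage percolation

infix 4 _≺_

-- Interlacing of row lengths: the skew shape `g / f` is a horizontal strip.
_≺_ : (ℕ → ℕ) → (ℕ → ℕ) → Set
f ≺ g = (∀ k → f k ≤ g k) × (∀ k → g (suc k) ≤ f k)

-- One cell of the growth diagram, with `ρ` nearest the origin and `l` opposite. The usual rule has
-- `ρ k` subtracted on the right; moving it to the left avoids truncated subtraction and lets the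
-- rule be solved for `l` as well as for `ρ`.
record LocalRule (m : ℕ) (ρ μ ν l : ℕ → ℕ) : Set where
  field
    first : l 0 ≡ m + (μ 0 ⊔ ν 0)
    later : ∀ k → l (suc k) + ρ k ≡ (μ (suc k) ⊔ ν (suc k)) + (μ k ⊓ ν k)

  flip : LocalRule m ρ ν μ l
  flip = record
    { first = trans first (cong (m +_) (⊔-comm (μ 0) (ν 0)))
    ; later = λ k → trans (later k) (cong₂ _+_ (⊔-comm (μ (suc k)) (ν (suc k))) (⊓-comm (μ k) (ν k))) }

  -- By interlacing the minimum in `later` is at least `ρ k` and the maximum at most `ρ k`;
  -- cancelling `ρ k` gives both inequalities. In `lower` the value `l (k + 1)` takes over this
  -- role.
  upper : ρ ≺ μ → ρ ≺ ν → μ ≺ l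
  upper (ρ≤μ , μ≤ρ) (ρ≤ν , ν≤ρ) = μ≤l , l≤μ
    where
    open ≤-Reasoning
    μ≤l : ∀ k → μ k ≤ l k
    μ≤l zero    = begin
      μ 0               ≤⟨ m≤m⊔n (μ 0) (ν 0) ⟩
      μ 0 ⊔ ν 0         ≤⟨ m≤n+m _ m ⟩
      m + (μ 0 ⊔ ν 0)   ≡⟨ first ⟨
      l 0               ∎
    μ≤l (suc k) = +-cancelʳ-≤ (ρ k) _ _ (begin
      μ (suc k) + ρ k                           ≤⟨ +-mono-≤ (m≤m⊔n _ (ν (suc k))) (⊓-glb (ρ≤μ k) (ρ≤ν k)) ⟩
      (μ (suc k) ⊔ ν (suc k)) + (μ k ⊓ ν k)     ≡⟨ later k ⟨
      l (suc k) + ρ k                           ∎)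
    l≤μ : ∀ k → l (suc k) ≤ μ k
    l≤μ k = +-cancelʳ-≤ (ρ k) _ _ (begin
      l (suc k) + ρ k                           ≡⟨ later k ⟩
      (μ (suc k) ⊔ ν (suc k)) + (μ k ⊓ ν k)     ≤⟨ +-mono-≤ (⊔-lub (μ≤ρ k) (ν≤ρ k)) (m⊓n≤m (μ k) (ν k)) ⟩
      ρ k + μ k                                 ≡⟨ +-comm (ρ k) (μ k) ⟩
      μ k + ρ k                                 ∎)

  lower : μ ≺ l → ν ≺ l → ρ ≺ μ
  lower (μ≤l , l≤μ) (ν≤l , l≤ν) = ρ≤μ , μ≤ρ
    where
    open ≤-Reasoning
    ρ≤μ : ∀ k → ρ k ≤ μ k
    ρ≤μ k = +-cancelˡ-≤ (l (suc k)) _ _ (begin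
      l (suc k) + ρ k                           ≡⟨ later k ⟩
      (μ (suc k) ⊔ ν (suc k)) + (μ k ⊓ ν k)     ≤⟨ +-mono-≤ (⊔-lub (μ≤l (suc k)) (ν≤l (suc k))) (m⊓n≤m (μ k) (ν k)) ⟩
      l (suc k) + μ k                           ∎)
    μ≤ρ : ∀ k → μ (suc k) ≤ ρ k
    μ≤ρ k = +-cancelˡ-≤ (l (suc k)) _ _ (begin
      l (suc k) + μ (suc k)                     ≡⟨ +-comm (l (suc k)) _ ⟩
      μ (suc k) + l (suc k)                     ≤⟨ +-mono-≤ (m≤m⊔n _ (ν (suc k))) (⊓-glb (l≤μ k) (l≤ν k)) ⟩
      (μ (suc k) ⊔ ν (suc k)) + (μ k ⊓ ν k)     ≡⟨ later k ⟨
      l (suc k) + ρ k                           ∎)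

  -- The maximum and the minimum of two numbers add up to their sum, and `later` only pairs the
  -- maximum of row `k + 1` with the minimum of row `k`. The two hypotheses remove the terms of row
  -- `n` that are left without a partner.
  area : ∀ n → ρ n ≡ 0 → μ n ≡ 0 → ∑ (suc n) l + ∑ (suc n) ρ ≡ m + (∑ (suc n) μ + ∑ (suc n) ν)
  area n ρn≡0 μn≡0 = begin
    ∑ (suc n) l + ∑ (suc n) ρ
      ≡⟨ cong₂ _+_ (∑-head n l) (trans (cong (∑ n ρ +_) ρn≡0) (+-identityʳ _)) ⟩
    (l 0 + ∑ n (l ∘ suc)) + ∑ n ρ
      ≡⟨ trans (+-assoc (l 0) _ _) (cong₂ _+_ first (trans (sym (∑-+ n (l ∘ suc) ρ))
           (trans (∑-cong n λ k _ → later k) (∑-+ n _ (λ k → μ k ⊓ ν k))))) ⟩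
    (m + (μ 0 ⊔ ν 0)) + (∑ n (λ k → μ (suc k) ⊔ ν (suc k)) + ∑ n (λ k → μ k ⊓ ν k))
      ≡⟨ regroup m _ _ _ ⟩
    m + (((μ 0 ⊔ ν 0) + ∑ n (λ k → μ (suc k) ⊔ ν (suc k))) + ∑ n (λ k → μ k ⊓ ν k))
      ≡⟨ cong (m +_) (cong₂ _+_ (sym (∑-head n (λ k → μ k ⊔ ν k)))
           (sym (trans (cong (λ x → ∑ n (λ k → μ k ⊓ ν k) + (x ⊓ ν n)) μn≡0) (+-identityʳ _)))) ⟩
    m + (∑ (suc n) (λ k → μ k ⊔ ν k) + ∑ (suc n) (λ k → μ k ⊓ ν k))
      ≡⟨ cong (m +_) (trans (sym (∑-+ (suc n) (λ k → μ k ⊔ ν k) (λ k → μ k ⊓ ν k)))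
           (trans (∑-cong (suc n) λ k _ → ⊔+⊓ (μ k) (ν k)) (∑-+ (suc n) μ ν))) ⟩
    m + (∑ (suc n) μ + ∑ (suc n) ν) ∎
    where
    open ≡-Reasoning
    regroup : ∀ a b c d → (a + b) + (c + d) ≡ a + ((b + c) + d)
    regroup = solve-∀
    ⊔+⊓ : ∀ a b → (a ⊔ b) + (a ⊓ b) ≡ a + b
    ⊔+⊓ a b with ≤-total a b
    ... | inj₁ a≤b = trans (cong₂ _+_ (m≤n⇒m⊔n≡n a≤b) (m≤n⇒m⊓n≡m a≤b)) (+-comm b a)
    ... | inj₂ b≤a = cong₂ _+_ (m≥n⇒m⊔n≡m b≤a) (m≥n⇒m⊓n≡n b≤a)

open LocalRule

-- L i j k is the length of row k of the shape at corner (i , j).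
record Growth (n : ℕ) (M : ℕ → ℕ → ℕ) (L : ℕ → ℕ → ℕ → ℕ) : Set where
  field
    top   : ∀ j → j ≤ n → ∀ k → L 0 j k ≡ 0
    left  : ∀ i → i ≤ n → ∀ k → L i 0 k ≡ 0
    local : ∀ i j → i < n → j < n →
            LocalRule (M i j) (L i j) (L (suc i) j) (L i (suc j)) (L (suc i) (suc j))

  vertical   : ∀ i j → i < n → j ≤ n → L i j ≺ L (suc i) j
  horizontal : ∀ i j → i ≤ n → j < n → L i j ≺ L i (suc j)
  vertical i zero    i<n j≤n =
    (λ k → ≤-reflexive (trans (left i (<⇒≤ i<n) k) (sym (left (suc i) i<n k)))) ,
    (λ k → ≤-reflexive (trans (left (suc i) i<n (suc k)) (sym (left i (<⇒≤ i<n) k))))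
  vertical i (suc j) i<n j<n =
    upper (flip (local i j i<n j<n)) (horizontal i j (<⇒≤ i<n) j<n) (vertical i j i<n (<⇒≤ j<n))
  horizontal zero    j i≤n j<n =
    (λ k → ≤-reflexive (trans (top j (<⇒≤ j<n) k) (sym (top (suc j) j<n k)))) ,
    (λ k → ≤-reflexive (trans (top (suc j) j<n (suc k)) (sym (top j (<⇒≤ j<n) k))))
  horizontal (suc i) j i<n j<n =
    upper (local i j i<n j<n) (vertical i j i<n (<⇒≤ j<n)) (horizontal i j (<⇒≤ i<n) j<n)

  rows≤ : ∀ i j → i ≤ n → j ≤ n → ∀ k → j ≤ k → L i j k ≡ 0
  rows≤ i zero    i≤n _   k       _   = left i i≤n k
  rows≤ i (suc j) i≤n j<n (suc k) j≤k = n≤0⇒n≡0 (≤-trans (proj₂ (horizontal i j i≤n j<n) k)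
    (≤-reflexive (rows≤ i j i≤n (<⇒≤ j<n) k (s≤s⁻¹ j≤k))))

  rectangle : ∀ i j → i ≤ n → j ≤ n → ∑ n (L i j) ≡ ∑ i (λ i′ → ∑ j (M i′))
  rectangle zero    j       i≤n j≤n = ∑-zero n (λ k _ → top j j≤n k)
  rectangle (suc i) zero    i≤n j≤n = trans (∑-zero n (λ k _ → left (suc i) i≤n k)) (sym (∑-zero (suc i) λ _ _ → refl))
  -- Inclusion-exclusion at the corner cell. The size of the shape at `(i , j)` is added on both
  -- sides, so that a cancellation replaces the subtraction and `area` applies directly.
  rectangle (suc i) (suc j) (s≤s {n = n′} i≤n) (s≤s j≤n) = +-cancelʳ-≡ (∑ i (λ i′ → ∑ j (M i′))) _ _ (begin
    ∑ n (L (suc i) (suc j)) + ∑ i (λ i′ → ∑ j (M i′))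
      ≡⟨ cong (∑ n (L (suc i) (suc j)) +_) (rectangle i j i≤n′ j≤n′) ⟨
    ∑ n (L (suc i) (suc j)) + ∑ n (L i j)
      ≡⟨ area (local i j (s≤s i≤n) (s≤s j≤n)) n′ (rows≤ i j i≤n′ j≤n′ n′ j≤n) (rows≤ (suc i) j (s≤s i≤n) j≤n′ n′ j≤n) ⟩
    M i j + (∑ n (L (suc i) j) + ∑ n (L i (suc j)))
      ≡⟨ cong (M i j +_) (cong₂ _+_ (rectangle (suc i) j (s≤s i≤n) j≤n′) (rectangle i (suc j) i≤n′ (s≤s j≤n))) ⟩
    M i j + ((∑ i (λ i′ → ∑ j (M i′)) + ∑ j (M i)) + ∑ i (λ i′ → ∑ (suc j) (M i′)))
      ≡⟨ regroup (M i j) (∑ i (λ i′ → ∑ j (M i′))) (∑ j (M i)) _ ⟩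
    (∑ i (λ i′ → ∑ (suc j) (M i′)) + (∑ j (M i) + M i j)) + ∑ i (λ i′ → ∑ j (M i′)) ∎)
    where
    open ≡-Reasoning
    i≤n′ = m≤n⇒m≤1+n i≤n
    j≤n′ = m≤n⇒m≤1+n j≤n
    regroup : ∀ a b c d → a + ((b + c) + d) ≡ (d + (c + a)) + b
    regroup = solve-∀

open Growth

growth-determined-by-matrix : ∀ {n M L L′} → Growth n M L → Growth n M L′ →
  ∀ i j → i ≤ n → j ≤ n → ∀ k → L i j k ≡ L′ i j k
growth-determined-by-matrix {n} {M} {L} {L′} g g′ = go
  where
  go : ∀ i j → i ≤ n → j ≤ n → ∀ k → L i j k ≡ L′ i j k
  go zero    j       i≤n j≤n k = trans (top g j j≤n k) (sym (top g′ j j≤n k))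
  go (suc i) zero    i≤n j≤n k = trans (left g (suc i) i≤n k) (sym (left g′ (suc i) i≤n k))
  go (suc i) (suc j) i<n j<n zero =
    trans (first (local g i j i<n j<n))
      (trans (cong (M i j +_) (cong₂ _⊔_ (go (suc i) j i<n (<⇒≤ j<n) 0) (go i (suc j) (<⇒≤ i<n) j<n 0)))
        (sym (first (local g′ i j i<n j<n))))
  go (suc i) (suc j) i<n j<n (suc k) = +-cancelʳ-≡ (L i j k) _ _
    (trans (later (local g i j i<n j<n) k)
      (trans (cong₂ _+_ (cong₂ _⊔_ (μ (suc k)) (ν (suc k))) (cong₂ _⊓_ (μ k) (ν k)))
        (trans (sym (later (local g′ i j i<n j<n) k))
          (cong (L′ (suc i) (suc j) (suc k) +_) (sym (go i j (<⇒≤ i<n) (<⇒≤ j<n) k))))))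
    where
    μ = go (suc i) j i<n (<⇒≤ j<n)
    ν = go i (suc j) (<⇒≤ i<n) j<n

module _ {n M M′ L L′} (g : Growth n M L) (g′ : Growth n M′ L′)
         (right  : ∀ i → i ≤ n → ∀ k → L i n k ≡ L′ i n k)
         (bottom : ∀ j → j ≤ n → ∀ k → L n j k ≡ L′ n j k) where

  -- `later` can be solved for the shape at `(i , j)` from the other three corners of its cell, none
  -- of them farther from the bottom and right sides; `a` and `b` are the distances to these sides.
  -- `first` is kept for recovering the matrix once the shapes are known.
  growth-determined-by-boundary : ∀ i j → i ≤ n → j ≤ n → ∀ k → L i j k ≡ L′ i j k
  growth-determined-by-boundary i j i≤n j≤n k
    with a , i+a ← m≤n⇒∃[o]m+o≡n i≤n | b , j+b ← m≤n⇒∃[o]m+o≡n j≤n = go a b i j i+a j+b k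
    where
    bound : ∀ a {i} → i + a ≡ n → i ≤ n
    bound a refl = m≤m+n _ a
    go : ∀ a b i j → i + a ≡ n → j + b ≡ n → ∀ k → L i j k ≡ L′ i j k
    go zero    b    i j i+a j+b k with refl ← trans (sym (+-identityʳ i)) i+a = bottom j (bound b j+b) k
    go (suc a) zero i j i+a j+b k with refl ← trans (sym (+-identityʳ j)) j+b = right i (bound (suc a) i+a) k
    go (suc a) (suc b) i j i+a j+b k = +-cancelˡ-≡ (L (suc i) (suc j) (suc k)) _ _
      (trans (later (local g i j i<n j<n) k)
        (trans (cong₂ _+_ (cong₂ _⊔_ (μ (suc k)) (ν (suc k))) (cong₂ _⊓_ (μ k) (ν k)))
          (trans (sym (later (local g′ i j i<n j<n) k))
            (cong (_+ L′ i j k) (sym (go a b (suc i) (suc j) i+a′ j+b′ (suc k)))))))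
      where
      i+a′ = trans (sym (+-suc i a)) i+a
      j+b′ = trans (sym (+-suc j b)) j+b
      i<n = bound a i+a′
      j<n = bound b j+b′
      μ = go a (suc b) (suc i) j i+a′ j+b
      ν = go (suc a) b i (suc j) i+a j+b′

  matrix-determined-by-boundary : ∀ i j → i < n → j < n → M i j ≡ M′ i j
  matrix-determined-by-boundary i j i<n j<n = +-cancelʳ-≡ (L (suc i) j 0 ⊔ L i (suc j) 0) _ _
    (trans (sym (first (local g i j i<n j<n)))
      (trans (same (suc i) (suc j) i<n j<n 0)
        (trans (first (local g′ i j i<n j<n))
          (cong (M′ i j +_) (sym (cong₂ _⊔_ (same (suc i) j i<n (<⇒≤ j<n) 0) (same i (suc j) (<⇒≤ i<n) j<n 0)))))))
    where same = growth-determined-by-boundary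

-- The truncated subtraction is exact because both neighbours contain the shape at `(i , j)`;
-- `grow-local` is proved together with the interlacing that guarantees this.
grow : (ℕ → ℕ → ℕ) → ℕ → ℕ → ℕ → ℕ
grow M zero    j       k       = 0
grow M (suc i) zero    k       = 0
grow M (suc i) (suc j) zero    = M i j + (grow M (suc i) j 0 ⊔ grow M i (suc j) 0)
grow M (suc i) (suc j) (suc k) =
  (grow M (suc i) j (suc k) ⊔ grow M i (suc j) (suc k)) + ((grow M (suc i) j k ⊓ grow M i (suc j) k) ∸ grow M i j k)

module _ (M : ℕ → ℕ → ℕ) where

  grow-left : ∀ i k → grow M i 0 k ≡ 0
  grow-left zero    k = refl
  grow-left (suc i) k = refl

  mutual
    grow-local : ∀ i j → LocalRule (M i j) (grow M i j) (grow M (suc i) j) (grow M i (suc j)) (grow M (suc i) (suc j))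
    grow-local i j .first   = refl
    grow-local i j .later k = trans (+-assoc (grow M (suc i) j (suc k) ⊔ _) _ _)
      (cong (grow M (suc i) j (suc k) ⊔ grow M i (suc j) (suc k) +_) (m∸n+n≡m (⊓-glb (proj₁ (grow-vertical i j) k) (proj₁ (grow-horizontal i j) k))))

    grow-vertical : ∀ i j → grow M i j ≺ grow M (suc i) j
    grow-vertical i zero    = (λ k → ≤-reflexive (grow-left i k)) , (λ k → z≤n)
    grow-vertical i (suc j) = upper (flip (grow-local i j)) (grow-horizontal i j) (grow-vertical i j)

    grow-horizontal : ∀ i j → grow M i j ≺ grow M i (suc j)
    grow-horizontal zero    j = (λ k → z≤n) , (λ k → z≤n)
    grow-horizontal (suc i) j = upper (grow-local i j) (grow-vertical i j) (grow-horizontal i j)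

  grow-growth : ∀ n → Growth n M (grow M)
  grow-growth n .top   j _ k     = refl
  grow-growth n .left  i _ k     = grow-left i k
  grow-growth n .local i j _ _   = grow-local i j

-- Reconstruction of a growth diagram from its boundary

module Retract (n : ℕ) (l m : ℕ → ℕ → ℕ) where

  -- The corner (n - a , n - b) of the growth diagram with boundary l, m.
  retract : ℕ → ℕ → ℕ → ℕ
  retract zero    b       k = m (n ∸ b) k
  retract (suc a) zero    k = l (n ∸ suc a) k
  retract (suc a) (suc b) k =
    ((retract a (suc b) (suc k) ⊔ retract (suc a) b (suc k)) + (retract a (suc b) k ⊓ retract (suc a) b k))
      ∸ retract a b (suc k)

  -- `first` solved for the entry of the cell whose far corner is `(n - a , n - b)`. The cell has
  -- the index of its near corner, hence the `suc` in `matrix`.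
  entry : ℕ → ℕ → ℕ
  entry a b = retract a b 0 ∸ (retract a (suc b) 0 ⊔ retract (suc a) b 0)

  corner : ℕ → ℕ → ℕ → ℕ
  corner i j = retract (n ∸ i) (n ∸ j)

  matrix : ℕ → ℕ → ℕ
  matrix i j = entry (n ∸ suc i) (n ∸ suc j)

  module _ {r d : ℕ} (chains : RowChainPair n r d l m) where

    private
      module l = RowChain (proj₁ chains)
      module m = RowChain (proj₁ (proj₂ chains))
      l≡m = proj₂ (proj₂ chains)

      pred-∸ : ∀ {a} → a < n → n ∸ a ≡ suc (n ∸ suc a)
      pred-∸ {a} a<n = +-∸-assoc 1 {n} {suc a} a<n

      ∸-<n : ∀ {a} → a < n → n ∸ suc a < n
      ∸-<n {a} a<n = subst (_≤ n) (pred-∸ a<n) (m∸n≤m n a)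

      retract-right : ∀ a k → retract a 0 k ≡ l (n ∸ a) k
      retract-right zero    k = sym (l≡m k)
      retract-right (suc a) k = refl

      mutual
        -- The subtractions in `retract` and `entry` are exact if row `k + 1` of the far corner is
        -- at most row `k` of either neighbour and its top row at least theirs. Both are instances
        -- of interlacing, which `lower` carries inwards from the boundary chains.
        retract-local : ∀ a b → a < n → b < n →
          LocalRule (entry a b) (retract (suc a) (suc b)) (retract a (suc b)) (retract (suc a) b) (retract a b)
        retract-local a b a<n b<n .first =
          sym (m∸n+n≡m (⊔-lub (proj₁ (retract-horizontal a b (<⇒≤ a<n) b<n) 0) (proj₁ (retract-vertical a b a<n (<⇒≤ b<n)) 0)))
        retract-local a b a<n b<n .later k = m+[n∸m]≡n (≤-trans
          (⊓-glb (proj₂ (retract-horizontal a b (<⇒≤ a<n) b<n) k) (proj₂ (retract-vertical a b a<n (<⇒≤ b<n)) k))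
          (m≤n+m _ _))

        retract-vertical : ∀ a b → a < n → b ≤ n → retract (suc a) b ≺ retract a b
        retract-vertical a zero    a<n b≤n =
          (λ k → subst (l (n ∸ suc a) k ≤_) (sym (trans (retract-right a k) (cong (λ i → l i k) (pred-∸ a<n)))) (l.grows _ k (∸-<n a<n))) ,
          (λ k → subst (_≤ l (n ∸ suc a) k) (sym (trans (retract-right a (suc k)) (cong (λ i → l i (suc k)) (pred-∸ a<n)))) (l.strip _ k (∸-<n a<n)))
        retract-vertical a (suc b) a<n b<n =
          lower (retract-local a b a<n b<n) (retract-horizontal a b (<⇒≤ a<n) b<n) (retract-vertical a b a<n (<⇒≤ b<n))

        retract-horizontal : ∀ a b → a ≤ n → b < n → retract a (suc b) ≺ retract a b
        retract-horizontal zero    b a≤n b<n =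
          (λ k → subst (m (n ∸ suc b) k ≤_) (sym (cong (λ i → m i k) (pred-∸ b<n))) (m.grows _ k (∸-<n b<n))) ,
          (λ k → subst (_≤ m (n ∸ suc b) k) (sym (cong (λ i → m i (suc k)) (pred-∸ b<n))) (m.strip _ k (∸-<n b<n)))
        retract-horizontal (suc a) b a<n b<n =
          lower (flip (retract-local a b a<n b<n)) (retract-vertical a b a<n (<⇒≤ b<n)) (retract-horizontal a b (<⇒≤ a<n) b<n)

      -- The shapes on the top side shrink towards the left, starting from the top right corner,
      -- where `l` starts empty.
      retract-top : ∀ b → b ≤ n → ∀ k → retract n b k ≡ 0
      retract-top zero    _   k = trans (retract-right n k) (trans (cong (λ i → l i k) (n∸n≡0 n)) (l.start k))
      retract-top (suc b) b<n k = n≤0⇒n≡0 (≤-trans (proj₁ (retract-horizontal n b ≤-refl b<n) k)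
        (≤-reflexive (retract-top b (<⇒≤ b<n) k)))

      retract-left : ∀ a → a ≤ n → ∀ k → retract a n k ≡ 0
      retract-left zero    _   k = trans (cong (λ i → m i k) (n∸n≡0 n)) (m.start k)
      retract-left (suc a) a<n k = n≤0⇒n≡0 (≤-trans (proj₁ (retract-vertical a n a<n ≤-refl) k)
        (≤-reflexive (retract-left a (<⇒≤ a<n) k)))

    retract-growth : Growth n matrix corner
    retract-growth .top  j _ k = retract-top (n ∸ j) (m∸n≤m n j) k
    retract-growth .left i _ k = retract-left (n ∸ i) (m∸n≤m n i) k
    retract-growth .local i j i<n j<n rewrite pred-∸ i<n | pred-∸ j<n =
      retract-local (n ∸ suc i) (n ∸ suc j) (∸-<n i<n) (∸-<n j<n)

    corner-right : ∀ i → i ≤ n → ∀ k → corner i n k ≡ l i k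
    corner-right i i≤n k rewrite n∸n≡0 n = trans (retract-right (n ∸ i) k) (cong (λ i → l i k) (m∸[m∸n]≡n i≤n))

    corner-bottom : ∀ j → j ≤ n → ∀ k → corner n j k ≡ m j k
    corner-bottom j j≤n k rewrite n∸n≡0 n = cong (λ i → m i k) (m∸[m∸n]≡n j≤n)

growth-chains : ∀ {n r d M L} → Growth n M L →
  (∀ i → i < n → ∑ n (M i) ≡ r) → (∀ j → j < n → ∑ n (λ i → M i j) ≡ r) → L n n 0 ≤ d →
  RowChainPair n r d (λ i → L i n) (λ j → L n j)
growth-chains {n} {r} {d} {M} {L} g rows columns L≤d = l , m , λ _ → refl
  where
  l : RowChain n r d (λ i → L i n)
  l = record
    { start = top g n ≤-refl
    ; grows = λ i k i<n → proj₁ (vertical g i n i<n ≤-refl) k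
    ; strip = λ i k i<n → proj₂ (vertical g i n i<n ≤-refl) k
    ; size  = λ i i≤n → trans (rectangle g i n i≤n ≤-refl)
        (trans (∑-cong i λ i′ i′<i → rows i′ (<-≤-trans i′<i i≤n)) (trans (∑-const i r) (*-comm i r)))
    ; width = L≤d }
  m : RowChain n r d (λ j → L n j)
  m = record
    { start = left g n ≤-refl
    ; grows = λ j k j<n → proj₁ (horizontal g n j ≤-refl j<n) k
    ; strip = λ j k j<n → proj₂ (horizontal g n j ≤-refl j<n) k
    ; size  = λ j j≤n → trans (rectangle g n j ≤-refl j≤n) (trans (∑-swap n j M)
        (trans (∑-cong j λ j′ j′<j → columns j′ (<-≤-trans j′<j j≤n)) (trans (∑-const j r) (*-comm j r))))
    ; width = L≤d }

module _ {n r d M L l m} (g : Growth n M L) (chains : RowChainPair n r d l m)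
         (right  : ∀ i → i ≤ n → ∀ k → L i n k ≡ l i k)
         (bottom : ∀ j → j ≤ n → ∀ k → L n j k ≡ m j k) where

  private
    step : ∀ {c} {f : ℕ → ℕ} i → (∀ i → i ≤ n → ∑ i f ≡ c * i) → i < n → f i ≡ c
    step {c} {f} i sums i<n = +-cancelˡ-≡ (∑ i f) _ _ (trans (sums (suc i) i<n)
      (trans (*-suc c i) (trans (+-comm c _) (cong (_+ c) (sym (sums i (<⇒≤ i<n)))))))

  chains-row-sums : ∀ i → i < n → ∑ n (M i) ≡ r
  chains-row-sums i = step i λ i i≤n → trans (sym (rectangle g i n i≤n ≤-refl))
    (trans (∑-cong n λ k _ → right i i≤n k) (RowChain.size (proj₁ chains) i i≤n))

  chains-column-sums : ∀ j → j < n → ∑ n (λ i → M i j) ≡ r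
  chains-column-sums j = step j λ j j≤n → trans (sym (∑-swap n j M)) (trans (sym (rectangle g n j ≤-refl j≤n))
    (trans (∑-cong n λ k _ → bottom j j≤n k) (RowChain.size (proj₁ (proj₂ chains)) j j≤n)))

-- Planar subgraphs and the first row

PlanarBelow : ℕ → (ℕ → ℕ → ℕ) → Set
PlanarBelow n H = ∀ {i j i′ j′} → i < n → j < n → i′ < n → j′ < n → 0 < H i j → 0 < H i′ j′ →
  (i ≤ i′ × j ≤ j′) ⊎ (i′ ≤ i × j′ ≤ j)

-- An edge in row `i` left of column `j` would cross an edge in column `j` above row `i`, so one of
-- these two arms of the corner cell is empty. Deleting that row or column loses only the corner, at
-- most `M i j`, as the recursion for the first row allows.
planar≤growth : ∀ {n M L H} → Growth n M L → PlanarBelow n H → (∀ i j → i < n → j < n → H i j ≤ M i j) →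
  ∀ i j → i ≤ n → j ≤ n → ∑ i (λ i′ → ∑ j (H i′)) ≤ L i j 0
planar≤growth {n} {M} {L} {H} g planar H≤M = go
  where
  open ≤-Reasoning
  go : ∀ i j → i ≤ n → j ≤ n → ∑ i (λ i′ → ∑ j (H i′)) ≤ L i j 0
  go zero    j       i≤n j≤n = z≤n
  go (suc i) zero    i≤n j≤n = ≤-trans (≤-reflexive (∑-zero (suc i) λ _ _ → refl)) z≤n
  go (suc i) (suc j) i<n j<n with 0 <? ∑ j (H i)
  ... | no row≡0 = begin
    ∑ i (λ i′ → ∑ (suc j) (H i′)) + (∑ j (H i) + H i j)
      ≡⟨ cong (λ x → ∑ i (λ i′ → ∑ (suc j) (H i′)) + (x + H i j)) (n≤0⇒n≡0 (≮⇒≥ row≡0)) ⟩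
    ∑ i (λ i′ → ∑ (suc j) (H i′)) + H i j
      ≤⟨ +-mono-≤ (≤-trans (go i (suc j) (<⇒≤ i<n) j<n) (m≤n⊔m (L (suc i) j 0) _)) (H≤M i j i<n j<n) ⟩
    (L (suc i) j 0 ⊔ L i (suc j) 0) + M i j
      ≡⟨ trans (+-comm _ (M i j)) (sym (first (local g i j i<n j<n))) ⟩
    L (suc i) (suc j) 0 ∎
  ... | yes row>0 with j′ , j′<j , 0<H ← ∑-positive j row>0 = begin
    ∑ (suc i) (λ i′ → ∑ j (H i′) + H i′ j)
      ≡⟨ ∑-+ (suc i) (λ i′ → ∑ j (H i′)) (λ i′ → H i′ j) ⟩
    ∑ (suc i) (λ i′ → ∑ j (H i′)) + (∑ i (λ i′ → H i′ j) + H i j)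
      ≡⟨ cong (λ x → ∑ (suc i) (λ i′ → ∑ j (H i′)) + (x + H i j)) (∑-zero i column≡0) ⟩
    ∑ (suc i) (λ i′ → ∑ j (H i′)) + H i j
      ≤⟨ +-mono-≤ (≤-trans (go (suc i) j i<n (<⇒≤ j<n)) (m≤m⊔n _ (L i (suc j) 0))) (H≤M i j i<n j<n) ⟩
    (L (suc i) j 0 ⊔ L i (suc j) 0) + M i j
      ≡⟨ trans (+-comm _ (M i j)) (sym (first (local g i j i<n j<n))) ⟩
    L (suc i) (suc j) 0 ∎
    where
    column≡0 : ∀ i′ → i′ < i → H i′ j ≡ 0
    column≡0 i′ i′<i with 0 <? H i′ j
    ... | no H≯0 = n≤0⇒n≡0 (≮⇒≥ H≯0)
    ... | yes 0<H′ with planar (<-trans i′<i i<n) j<n i<n (<-trans j′<j j<n) 0<H′ 0<H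
    ...   | inj₁ (_ , j≤j′) = contradiction j≤j′ (<⇒≱ j′<j)
    ...   | inj₂ (i≤i′ , _) = contradiction i≤i′ (<⇒≱ i′<i)

-- A heaviest path is traced back through the larger neighbour of each corner, each visited cell
-- with its full multiplicity. The support bound travels along because it ensures that a new corner
-- dominates all earlier edges, hence crosses none, and that its cell is still empty.
growth≤planar : ∀ {n M L} → Growth n M L → ∀ i j → i ≤ n → j ≤ n →
  Σ[ H ∈ (ℕ → ℕ → ℕ) ] PlanarBelow n H × (∀ i j → H i j ≤ M i j) ×
    (∀ {a b} → 0 < H a b → a < i × b < j) × L i j 0 ≤ ∑ n (λ a → ∑ n (H a))
growth≤planar {n} {M} {L} g = go
  where
  open ≤-Reasoning
  Subgraph : ℕ → ℕ → ℕ → Set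
  Subgraph i j x = Σ[ H ∈ (ℕ → ℕ → ℕ) ] PlanarBelow n H × (∀ i j → H i j ≤ M i j) ×
    (∀ {a b} → 0 < H a b → a < i × b < j) × x ≤ ∑ n (λ a → ∑ n (H a))

  widen : ∀ {i j i′ j′ x} → i ≤ i′ → j ≤ j′ → Subgraph i j x → Subgraph i′ j′ x
  widen i≤i′ j≤j′ (H , planar , H≤M , support , x≤) =
    H , planar , H≤M , (λ 0<H → map (λ p → <-≤-trans p i≤i′) (λ p → <-≤-trans p j≤j′) (support 0<H)) , x≤

  δ : (i j a b : ℕ) → ℕ
  δ i j a b = χ (a ≟ i) * (χ (b ≟ j) * M i j)

  addCorner : ∀ {i j x} → i < n → j < n →
    (Σ[ s ∈ Subgraph (suc i) (suc j) x ] proj₁ s i j ≡ 0) → Subgraph (suc i) (suc j) (M i j + x)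
  addCorner {i} {j} {x} i<n j<n ((H , planar , H≤M , support , x≤) , Hij≡0) =
    H′ , planar′ , H′≤M , support′ , enough
    where
    H′ : ℕ → ℕ → ℕ
    H′ a b = δ i j a b + H a b
    cases : ∀ {a b} → 0 < H′ a b → (a ≡ i × b ≡ j) ⊎ 0 < H a b
    cases {a} {b} p with a ≟ i | b ≟ j
    ... | yes a≡i | yes b≡j = inj₁ (a≡i , b≡j)
    ... | yes _   | no _    = inj₂ p
    ... | no _    | _       = inj₂ p
    H′≤M : ∀ a b → H′ a b ≤ M a b
    H′≤M a b with a ≟ i | b ≟ j
    ... | yes refl | yes refl rewrite Hij≡0 | *-identityˡ (M i j) =
          ≤-reflexive (trans (+-identityʳ _) (+-identityʳ _))
    ... | yes _    | no _    = H≤M a b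
    ... | no _     | _       = H≤M a b
    support′ : ∀ {a b} → 0 < H′ a b → a < suc i × b < suc j
    support′ p with cases p
    ... | inj₁ (refl , refl) = n<1+n _ , n<1+n _
    ... | inj₂ 0<H           = support 0<H
    planar′ : PlanarBelow n H′
    planar′ a<n b<n a′<n b′<n p p′ with cases p | cases p′
    ... | inj₂ q             | inj₂ q′            = planar a<n b<n a′<n b′<n q q′
    ... | inj₁ (refl , refl) | _ with a′≤ , b′≤ ← support′ p′ = inj₂ (s≤s⁻¹ a′≤ , s≤s⁻¹ b′≤)
    planar′ a<n b<n a′<n b′<n p p′ | inj₂ _ | inj₁ (refl , refl)
      with a≤ , b≤ ← support′ p = inj₁ (s≤s⁻¹ a≤ , s≤s⁻¹ b≤)
    enough : M i j + x ≤ ∑ n (λ a → ∑ n (H′ a))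
    enough = begin
      M i j + x
        ≡⟨ cong (_+ x) (trans (cong₂ (λ p q → p * (q * M i j)) (χ-yes (i ≟ i) refl) (χ-yes (j ≟ j) refl))
             (trans (*-identityˡ _) (*-identityˡ _))) ⟨
      δ i j i j + x
        ≤⟨ +-mono-≤ (≤-trans (∑-term (δ i j i) j<n) (∑-term (λ a → ∑ n (δ i j a)) i<n)) x≤ ⟩
      ∑ n (λ a → ∑ n (δ i j a)) + ∑ n (λ a → ∑ n (H a))
        ≡⟨ ∑-+ n (λ a → ∑ n (δ i j a)) (λ a → ∑ n (H a)) ⟨
      ∑ n (λ a → ∑ n (δ i j a) + ∑ n (H a))
        ≡⟨ ∑-cong n (λ a _ → ∑-+ n (δ i j a) (H a)) ⟨
      ∑ n (λ a → ∑ n (H′ a)) ∎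

  go : ∀ i j → i ≤ n → j ≤ n → Subgraph i j (L i j 0)
  empty : ∀ {i j} → L i j 0 ≡ 0 → Subgraph i j (L i j 0)
  empty L≡0 = (λ _ _ → 0) , (λ _ _ _ _ ()) , (λ _ _ → z≤n) , (λ ()) , ≤-trans (≤-reflexive L≡0) z≤n
  go zero    j       i≤n j≤n = empty (top g j j≤n 0)
  go (suc i) zero    i≤n j≤n = empty (left g (suc i) i≤n 0)
  go (suc i) (suc j) i<n j<n with ≤-total (L (suc i) j 0) (L i (suc j) 0)
  ... | inj₁ μ≤ν with s@(H , _ , _ , support , _) ← go i (suc j) (<⇒≤ i<n) j<n =
    subst (Subgraph (suc i) (suc j))
      (trans (cong (M i j +_) (sym (m≤n⇒m⊔n≡n μ≤ν))) (sym (first (local g i j i<n j<n))))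
      (addCorner i<n j<n (widen (n≤1+n i) ≤-refl s , n≤0⇒n≡0 (≮⇒≥ λ p → n≮n i (proj₁ (support p)))))
  ... | inj₂ ν≤μ with s@(H , _ , _ , support , _) ← go (suc i) j i<n (<⇒≤ j<n) =
    subst (Subgraph (suc i) (suc j))
      (trans (cong (M i j +_) (sym (m≥n⇒m⊔n≡m ν≤μ))) (sym (first (local g i j i<n j<n))))
      (addCorner i<n j<n (widen ≤-refl (n≤1+n j) s , n≤0⇒n≡0 (≮⇒≥ λ p → n≮n j (proj₂ (support p)))))

-- Multigraphs and pairs of chains

open Growth
open Retract using (matrix; corner; retract-growth; corner-right; corner-bottom)

multiplicity : ∀ {n} → Multigraph n → ℕ → ℕ → ℕ
multiplicity {n} G i = at 0 (at (Vec.replicate n 0) G i)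

fromMultiplicity : ∀ n → (ℕ → ℕ → ℕ) → Multigraph n
fromMultiplicity n M = tab n λ i → tab n (M i)

multiplicity-fromMultiplicity : ∀ n M {i j} → i < n → j < n → multiplicity (fromMultiplicity n M) i j ≡ M i j
multiplicity-fromMultiplicity n M {i} {j} i<n j<n =
  trans (cong (λ v → at 0 v j) (at-tab _ (λ i → tab n (M i)) i<n)) (at-tab 0 (M i) j<n)

fromMultiplicity-multiplicity : ∀ {n} (G : Multigraph n) M → (∀ i j → i < n → j < n → M i j ≡ multiplicity G i j) →
  fromMultiplicity n M ≡ G
fromMultiplicity-multiplicity {n} G M h = at-ext (Vec.replicate n 0) _ G λ i i<n →
  at-ext 0 _ _ λ j j<n → trans (multiplicity-fromMultiplicity n M i<n j<n) (h i j i<n j<n)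

mult-multiplicity : ∀ {n} (G : Multigraph n) i j → mult G i j ≡ multiplicity G (toℕ i) (toℕ j)
mult-multiplicity {n} G i j = trans (sym (at-toℕ 0 (lookup G i) j))
  (cong (λ v → at 0 v (toℕ j)) (sym (at-toℕ (Vec.replicate n 0) G i)))

sum-tabulate : ∀ {n} {f : Fin n → ℕ} (F : ℕ → ℕ) → (∀ i → f i ≡ F (toℕ i)) → Vec.sum (Vec.tabulate f) ≡ ∑ n F
sum-tabulate {n} F h = trans (cong Vec.sum (Vec.tabulate-cong h))
  (trans (sum-at (tab n F)) (∑-cong n λ i i<n → at-tab 0 F i<n))

at-map : ∀ {A B : Set} {n} (z : A) (z′ : B) (f : A → B) (xs : Vec A n) {i} → i < n →
  at z′ (Vec.map f xs) i ≡ f (at z xs i)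
at-map z z′ f (x ∷ xs) {zero}  _   = refl
at-map z z′ f (x ∷ xs) {suc i} i<n = at-map z z′ f xs (s≤s⁻¹ i<n)

edges-multiplicity : ∀ {n} (G : Multigraph n) → edges G ≡ ∑ n (λ i → ∑ n (multiplicity G i))
edges-multiplicity {n} G = trans (sum-at (Vec.map Vec.sum G)) (∑-cong n λ i i<n →
  trans (at-map (Vec.replicate n 0) 0 Vec.sum G i<n) (sum-at (at (Vec.replicate n 0) G i)))

∀Fin : ∀ {n} {P : ℕ → Set} → (∀ (i : Fin n) → P (toℕ i)) → ∀ i → i < n → P i
∀Fin {P = P} h i i<n = subst P (toℕ-fromℕ< i<n) (h (fromℕ< i<n))

planarBelow : ∀ {n} (H : Multigraph n) → Planar H → PlanarBelow n (multiplicity H)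
planarBelow {n} H planar {i} {j} {i′} {j′} i<n j<n i′<n j′<n p p′ = fin (planar (fromℕ< i<n) (fromℕ< j<n) (fromℕ< i′<n) (fromℕ< j′<n)
  (subst (0 <_) (same i<n j<n) p) (subst (0 <_) (same i′<n j′<n) p′))
  where
  same : ∀ {i j} (i<n : i < n) (j<n : j < n) → multiplicity H i j ≡ mult H (fromℕ< i<n) (fromℕ< j<n)
  same i<n j<n = trans (sym (cong₂ (multiplicity H) (toℕ-fromℕ< i<n) (toℕ-fromℕ< j<n))) (sym (mult-multiplicity H _ _))
  fin : (fromℕ< i<n Fin.≤ fromℕ< i′<n × fromℕ< j<n Fin.≤ fromℕ< j′<n) ⊎
        (fromℕ< i′<n Fin.≤ fromℕ< i<n × fromℕ< j′<n Fin.≤ fromℕ< j<n) → (i ≤ i′ × j ≤ j′) ⊎ (i′ ≤ i × j′ ≤ j)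
  fin rewrite toℕ-fromℕ< i<n | toℕ-fromℕ< j<n | toℕ-fromℕ< i′<n | toℕ-fromℕ< j′<n = id

Ĝ⇒chains : ∀ {n r d} (G : Multigraph n) → Ĝ n r d G → let L = grow (multiplicity G) in
  RowChainPair n r d (λ i → L i n) (λ j → L n j)
Ĝ⇒chains {n} {r} {d} G ((rows , columns) , largest) =
  growth-chains g
    (∀Fin λ i → trans (sym (sum-tabulate (multiplicity G (toℕ i)) (mult-multiplicity G i))) (rows i))
    (∀Fin λ j → trans (sym (sum-tabulate (λ i → multiplicity G i (toℕ j)) (λ i → mult-multiplicity G i j))) (columns j))
    (bound (growth≤planar g n n ≤-refl ≤-refl))
  where
  open ≤-Reasoning
  g = grow-growth (multiplicity G) n
  bound : Σ[ H ∈ (ℕ → ℕ → ℕ) ] PlanarBelow n H × (∀ i j → H i j ≤ multiplicity G i j) ×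
    (∀ {a b} → 0 < H a b → a < n × b < n) × grow (multiplicity G) n n 0 ≤ ∑ n (λ a → ∑ n (H a)) →
    grow (multiplicity G) n n 0 ≤ d
  bound (H , planar , H≤G , _ , L≤H) = begin
    grow (multiplicity G) n n 0                      ≤⟨ L≤H ⟩
    ∑ n (λ i → ∑ n (H i))
      ≡⟨ ∑-cong n (λ i i<n → ∑-cong n λ j j<n → multiplicity-fromMultiplicity n H i<n j<n) ⟨
    ∑ n (λ i → ∑ n (multiplicity (fromMultiplicity n H) i)) ≡⟨ edges-multiplicity (fromMultiplicity n H) ⟨
    edges (fromMultiplicity n H)                     ≤⟨ largest (fromMultiplicity n H) (sub , planar′) ⟩
    d                                           ∎
    where
    same : ∀ i j → mult (fromMultiplicity n H) i j ≡ H (toℕ i) (toℕ j)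
    same i j = trans (mult-multiplicity (fromMultiplicity n H) i j) (multiplicity-fromMultiplicity n H (toℕ<n i) (toℕ<n j))
    sub : fromMultiplicity n H ⊆ G
    sub i j = subst₂ _≤_ (sym (same i j)) (sym (mult-multiplicity G i j)) (H≤G (toℕ i) (toℕ j))
    planar′ : Planar (fromMultiplicity n H)
    planar′ i j i′ j′ p p′ = planar (toℕ<n i) (toℕ<n j) (toℕ<n i′) (toℕ<n j′)
      (subst (0 <_) (same i j) p) (subst (0 <_) (same i′ j′) p′)

module _ {n r d l m} (chains : RowChainPair n r d l m) where

  private
    G = fromMultiplicity n (matrix n l m)

    L = corner n l m

    same : ∀ i j → i < n → j < n → matrix n l m i j ≡ multiplicity G i j
    same i j i<n j<n = sym (multiplicity-fromMultiplicity n (matrix n l m) i<n j<n)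

    g : Growth n (multiplicity G) (corner n l m)
    g .top   = top (retract-growth n l m chains)
    g .left  = left (retract-growth n l m chains)
    g .local i j i<n j<n = subst (λ x → LocalRule x (L i j) (L (suc i) j) (L i (suc j)) (L (suc i) (suc j))) (same i j i<n j<n)
      (local (retract-growth n l m chains) i j i<n j<n)

  chains⇒Ĝ : Ĝ n r d G
  chains⇒Ĝ = (degreeU , degreeV) , largest
    where
    degreeU : ∀ i → degU G i ≡ r
    degreeU i = trans (sum-tabulate (multiplicity G (toℕ i)) (mult-multiplicity G i))
      (chains-row-sums g chains (corner-right n l m chains) (corner-bottom n l m chains) (toℕ i) (toℕ<n i))
    degreeV : ∀ j → degV G j ≡ r
    degreeV j = trans (sum-tabulate (λ i → multiplicity G i (toℕ j)) (λ i → mult-multiplicity G i j))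
      (chains-column-sums g chains (corner-right n l m chains) (corner-bottom n l m chains) (toℕ j) (toℕ<n j))
    open ≤-Reasoning
    largest : LargestPlanar≤ d G
    largest H (H⊆G , planar) = begin
      edges H                            ≡⟨ edges-multiplicity H ⟩
      ∑ n (λ i → ∑ n (multiplicity H i))
        ≤⟨ planar≤growth g (planarBelow H planar)
             (λ i j i<n j<n → ∀Fin {P = λ i → multiplicity H i j ≤ multiplicity G i j} (λ i → ∀Fin {P = λ j → multiplicity H (toℕ i) j ≤ multiplicity G (toℕ i) j}
               (λ j → subst₂ _≤_ (mult-multiplicity H i j) (mult-multiplicity G i j) (H⊆G i j)) j j<n) i i<n)
             n n ≤-refl ≤-refl ⟩
      corner n l m n n 0                 ≡⟨ corner-right n l m chains n ≤-refl 0 ⟩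
      l n 0                              ≤⟨ RowChain.width (proj₁ chains) ⟩
      d                                  ∎

  private
    grow≡corner : ∀ i j → i ≤ n → j ≤ n → ∀ k → grow (multiplicity G) i j k ≡ corner n l m i j k
    grow≡corner = growth-determined-by-matrix (grow-growth (multiplicity G) n) g

  chains-graph-chains : (λ i → grow (multiplicity G) i n) ≗⟨ n ⟩ l × grow (multiplicity G) n ≗⟨ n ⟩ m
  chains-graph-chains =
    (λ i i≤n k → trans (grow≡corner i n i≤n ≤-refl k) (corner-right n l m chains i i≤n k)) ,
    (λ j j≤n k → trans (grow≡corner n j ≤-refl j≤n k) (corner-bottom n l m chains j j≤n k))

-- `l` and `m` are any chains agreeing with the boundary of `G`, since in the count they arrive
-- after a detour through vectors of steps.
graph-chains-graph : ∀ {n r d} (G : Multigraph n) → ∀ {l m} → RowChainPair n r d l m →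
  l ≗⟨ n ⟩ (λ i → grow (multiplicity G) i n) → m ≗⟨ n ⟩ grow (multiplicity G) n → fromMultiplicity n (matrix n l m) ≡ G
graph-chains-graph {n} G {l} {m} chains l≗ m≗ = fromMultiplicity-multiplicity G (matrix n l m)
  (matrix-determined-by-boundary (retract-growth n l m chains) (grow-growth (multiplicity G) n)
    (λ i i≤n k → trans (corner-right n l m chains i i≤n k) (l≗ i i≤n k))
    (λ j j≤n k → trans (corner-bottom n l m chains j j≤n k) (m≗ j j≤n k)))

-- Tableaux and words

occ : (ℕ → ℕ) → ℕ → ℕ → ℕ
occ w k t = ∑ t (λ t′ → χ (w t′ ≟ k))

cell : {P : Set} → Dec P → ℕ → List ℕ
cell (yes _) x = x ∷ []
cell (no _)  x = []

-- The word w places the entry t + 1 in row w t.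
row : (ℕ → ℕ) → ℕ → ℕ → List ℕ
row w k zero    = []
row w k (suc m) = row w k m ++ cell (w m ≟ k) (suc m)

tableau : (ℕ → ℕ) → ℕ → ℕ → Tableau
tableau w R m = applyUpTo (λ k → row w k m) R

length-row : ∀ w k m → length (row w k m) ≡ occ w k m
length-row w k zero    = refl
length-row w k (suc m) = trans (List.length-++ (row w k m)) (cong₂ _+_ (length-row w k m) (length-cell (w m ≟ k)))
  where
  length-cell : ∀ {P} (P? : Dec P) {x} → length (cell P? x) ≡ χ P?
  length-cell (yes _) = refl
  length-cell (no _)  = refl

row-cong : ∀ {w w′} k m → (∀ t → t < m → w t ≡ w′ t) → row w k m ≡ row w′ k m
row-cong k zero    h = refl
row-cong k (suc m) h = cong₂ _++_ (row-cong k m λ t t<m → h t (m<n⇒m<1+n t<m))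
                                  (cong (λ x → cell (x ≟ k) (suc m)) (h m ≤-refl))

occ-cong : ∀ {w w′} k m → (∀ t → t < m → w t ≡ w′ t) → occ w k m ≡ occ w′ k m
occ-cong k m h = ∑-cong m λ t t<m → cong (λ x → χ (x ≟ k)) (h t t<m)

∈-row⁺ : ∀ w {k m t} → t < m → w t ≡ k → suc t ∈ row w k m
∈-row⁺ w {k} {suc m} {t} t<m wt≡k with m≤n⇒m<n∨m≡n t<m
... | inj₁ t<m′ = ∈-++⁺ˡ (∈-row⁺ w (s≤s⁻¹ t<m′) wt≡k)
... | inj₂ refl = ∈-++⁺ʳ (row w k m) (new (w m ≟ k))
  where
  new : (P? : Dec (w m ≡ k)) → suc m ∈ cell P? (suc m)
  new (yes _) = here refl
  new (no ¬p) = contradiction wt≡k ¬p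

∈-row⁻ : ∀ w k m {x} → x ∈ row w k m → ∃[ t ] t < m × x ≡ suc t × w t ≡ k
∈-row⁻ w k (suc m) x∈ with ∈-++⁻ (row w k m) x∈
... | inj₁ x∈′ with t , t<m , eq ← ∈-row⁻ w k m x∈′ = t , m<n⇒m<1+n t<m , eq
... | inj₂ x∈′ with w m ≟ k
...   | yes wm≡k with here refl ← x∈′ = m , ≤-refl , refl , wm≡k

row-≤ : ∀ w k m → All (_≤ m) (row w k m)
row-≤ w k m = All.tabulate λ x∈ → let (t , t<m , x≡ , _) = ∈-row⁻ w k m x∈ in ≤-trans (≤-reflexive x≡) t<m

row-sorted : ∀ w k m → AllPairs _<_ (row w k m)
row-sorted w k zero    = []
row-sorted w k (suc m) = AllPairs.++⁺ (row-sorted w k m) (single (w m ≟ k))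
  (All.map (λ x≤m → below (w m ≟ k) x≤m) (row-≤ w k m))
  where
  single : ∀ {P} (P? : Dec P) → AllPairs _<_ (cell P? (suc m))
  single (yes _) = [] ∷ []
  single (no _)  = []
  below : ∀ {P x} (P? : Dec P) → x ≤ m → All (x <_) (cell P? (suc m))
  below (yes _) x≤m = s≤s x≤m ∷ []
  below (no _)  x≤m = []

prefix-∷ʳ : ∀ {as bs : List ℕ} {a} → Prefix _>_ as bs → length as < length bs → All (_< a) bs → Prefix _>_ (as ++ a ∷ []) bs
prefix-∷ʳ {bs = b ∷ bs} []       _        (b<a ∷ _)    = b<a ∷ []
prefix-∷ʳ               (r ∷ rs) (s≤s lt) (_   ∷ bs<a) = r ∷ prefix-∷ʳ rs lt bs<a

-- When entry `m + 1` joins row `k + 1`, the lattice condition just after it says that row `k` was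
-- already strictly longer, so the new cell lies below an existing and smaller entry.
row-above : ∀ w k m → (∀ t → t ≤ m → occ w (suc k) t ≤ occ w k t) → row w k m Above row w (suc k) m
row-above w k zero    lattice = []
row-above w k (suc m) lattice = go (w m ≟ suc k) (w m ≟ k) (lattice (suc m) ≤-refl)
  where
  ih = row-above w k m λ t t≤m → lattice t (m≤n⇒m≤1+n t≤m)
  go : (P? : Dec (w m ≡ suc k)) (Q? : Dec (w m ≡ k)) → occ w (suc k) m + χ P? ≤ occ w k m + χ Q? →
       Prefix _>_ (row w (suc k) m ++ cell P? (suc m)) (row w k m ++ cell Q? (suc m))
  go (yes p) (yes q) le = contradiction (trans (sym p) q) 1+n≢n
  go (yes p) (no _)  le = prefix-∷ʳ ih (subst₂ _<_ (sym (length-row w (suc k) m)) (sym (length-row w k m))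
      (subst₂ _≤_ (+-comm _ 1) (+-identityʳ _) le)) (All.map s≤s (row-≤ w k m)) ++ᵖ []
  go (no _)  Q?      le = subst (λ as → Prefix _>_ as (row w k m ++ cell Q? (suc m))) (sym (List.++-identityʳ _)) (ih ++ᵖ cell Q? (suc m))

-- The column condition compares complete rows, the lattice condition compares rows at every earlier
-- time. Counting the entries up to `t` in a complete row links them: above an entry at most `t`
-- stands a smaller one.
count≤ : ℕ → List ℕ → ℕ
count≤ t []       = 0
count≤ t (x ∷ xs) = χ (x ≤? t) + count≤ t xs

count≤-++ : ∀ t xs {ys} → count≤ t (xs ++ ys) ≡ count≤ t xs + count≤ t ys
count≤-++ t []       = refl
count≤-++ t (x ∷ xs) = trans (cong (χ (x ≤? t) +_) (count≤-++ t xs)) (sym (+-assoc (χ (x ≤? t)) _ _))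

count≤-row : ∀ w k m t → count≤ t (row w k m) ≡ ∑ m (λ t′ → χ (t′ <? t) * χ (w t′ ≟ k))
count≤-row w k zero    t = refl
count≤-row w k (suc m) t = trans (count≤-++ t (row w k m)) (cong₂ _+_ (count≤-row w k m t) (new (w m ≟ k)))
  where
  new : ∀ {P} (P? : Dec P) → count≤ t (cell P? (suc m)) ≡ χ (m <? t) * χ P?
  new (yes _) = trans (+-identityʳ _) (sym (*-identityʳ _))
  new (no _)  = sym (*-zeroʳ (χ (m <? t)))

occ-count≤ : ∀ w k {m t} → t ≤ m → count≤ t (row w k m) ≡ occ w k t
occ-count≤ w k {m} {t} t≤m = trans (count≤-row w k m t) (trans
  (∑-extend _ t≤m λ i t≤i → cong (_* χ (w i ≟ k)) (χ-no (i <? t) (≤⇒≯ t≤i)))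
  (∑-cong t λ i i<t → trans (cong (_* χ (w i ≟ k)) (χ-yes (i <? t) i<t)) (*-identityˡ _)))

count≤-prefix : ∀ {as bs} t → Prefix _>_ as bs → count≤ t as ≤ count≤ t bs
count≤-prefix t []                         = z≤n
count≤-prefix t (_∷_ {a = a} {b = b} r rs) =
  +-mono-≤ (χ-mono (a ≤? t) (b ≤? t) λ a≤t → ≤-trans (<⇒≤ r) a≤t) (count≤-prefix t rs)

sorted-ext : ∀ {xs ys : List ℕ} → AllPairs _<_ xs → AllPairs _<_ ys →
  (∀ {x} → x ∈ xs → x ∈ ys) → (∀ {x} → x ∈ ys → x ∈ xs) → xs ≡ ys
sorted-ext {[]}     {[]}     _ _ _ _ = refl
sorted-ext {[]}     {y ∷ ys} _ _ _ g with () ← g (here refl)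
sorted-ext {x ∷ xs} {[]}     _ _ f _ with () ← f (here refl)
sorted-ext {x ∷ xs} {y ∷ ys} (x< ∷ xs↗) (y< ∷ ys↗) f g = cong₂ _∷_ x≡y
  (sorted-ext xs↗ ys↗ (λ z∈ → drop (f (there z∈)) (λ z≡y → <⇒≢ (All.lookup x< z∈) (trans x≡y (sym z≡y))))
                      (λ z∈ → drop (g (there z∈)) (λ z≡x → <⇒≢ (All.lookup y< z∈) (trans (sym x≡y) (sym z≡x)))))
  where
  drop : ∀ {z u us} → z ∈ u ∷ us → ¬ z ≡ u → z ∈ us
  drop (here z≡u) z≢u = contradiction z≡u z≢u
  drop (there z∈) _   = z∈
  x≡y : x ≡ y
  x≡y with f (here refl) | g (here refl)
  ... | here eq | _       = eq
  ... | there _ | here eq = sym eq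
  ... | there x∈ | there y∈ = contradiction (All.lookup x< y∈) (<-asym (All.lookup y< x∈))

unique-disjoint : ∀ {x : ℕ} xs {ys} → Unique (xs ++ ys) → x ∈ xs → ¬ x ∈ ys
unique-disjoint (x ∷ xs) (x∉ ∷ _) (here refl) x∈ys = All.lookup x∉ (∈-++⁺ʳ xs x∈ys) refl
unique-disjoint (x ∷ xs) (_ ∷ u)  (there x∈)  x∈ys = unique-disjoint xs u x∈ x∈ys

unique-++ʳ : ∀ (xs : List ℕ) {ys} → Unique (xs ++ ys) → Unique ys
unique-++ʳ []       u       = u
unique-++ʳ (x ∷ xs) (_ ∷ u) = unique-++ʳ xs u

rowIndex : Tableau → ℕ → ℕ
rowIndex []      x = 0
rowIndex (ρ ∷ T) x with x ∈? ρ
... | yes _ = 0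
... | no _  = suc (rowIndex T x)

rowIndex-lookup : ∀ T {x} → Unique (concat T) → (p : Fin (length T)) → x ∈ List.lookup T p → rowIndex T x ≡ toℕ p
rowIndex-lookup (ρ ∷ T) {x} u p x∈ with x ∈? ρ | p
... | yes _  | Fin.zero  = refl
... | yes x∈ρ | Fin.suc q = contradiction (∈-concat⁺′ {xss = T} x∈ (∈-lookup q)) (unique-disjoint ρ u x∈ρ)
... | no x∉ρ | Fin.zero  = contradiction x∈ x∉ρ
... | no _   | Fin.suc q = cong suc (rowIndex-lookup T (unique-++ʳ ρ u) q x∈)

∈-concat⇒lookup : ∀ (T : Tableau) {x} → x ∈ concat T → ∃[ p ] x ∈ List.lookup T p
∈-concat⇒lookup (ρ ∷ T) x∈ with ∈-++⁻ ρ x∈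
... | inj₁ x∈ρ = Fin.zero , x∈ρ
... | inj₂ x∈T with p , x∈p ← ∈-concat⇒lookup T x∈T = Fin.suc p , x∈p

applyUpTo-lookup : ∀ {A : Set} (f : ℕ → A) xs → (∀ p → List.lookup xs p ≡ f (toℕ p)) → xs ≡ applyUpTo f (length xs)
applyUpTo-lookup f []       h = refl
applyUpTo-lookup f (x ∷ xs) h = cong₂ _∷_ (h Fin.zero) (applyUpTo-lookup (f ∘ suc) xs (h ∘ Fin.suc))

applyUpTo-cong : ∀ {A : Set} {f g : ℕ → A} n → (∀ k → k < n → f k ≡ g k) → applyUpTo f n ≡ applyUpTo g n
applyUpTo-cong zero    h = refl
applyUpTo-cong (suc n) h = cong₂ _∷_ (h 0 z<s) (applyUpTo-cong n λ k k<n → h (suc k) (s≤s k<n))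

linked-applyUpTo⁻ : ∀ {A : Set} {R : A → A → Set} (f : ℕ → A) n → Linked R (applyUpTo f n) → ∀ {i} → suc i < n → R (f i) (f (suc i))
linked-applyUpTo⁻ f (suc zero)    _       {i} (s≤s ())
linked-applyUpTo⁻ f (suc (suc n)) (r ∷ _) {zero}  _         = r
linked-applyUpTo⁻ f (suc (suc n)) (_ ∷ l) {suc i} (s≤s i<n) = linked-applyUpTo⁻ (f ∘ suc) (suc n) l i<n

index< : ∀ {n r i s} → i < n → s < r → r * i + s < n * r
index< {n} {r} {i} {s} i<n s<r = begin-strict
  r * i + s    <⟨ +-monoʳ-< (r * i) s<r ⟩
  r * i + r    ≡⟨ trans (+-comm (r * i) r) (sym (*-suc r i)) ⟩
  r * suc i    ≤⟨ *-monoʳ-≤ r i<n ⟩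
  r * n        ≡⟨ *-comm r n ⟩
  n * r        ∎
  where open ≤-Reasoning

-- A lattice word. `used` pins `R` to the number of nonempty rows, `blocks` is Condition (T̂) with
-- rows numbered downwards, and the bound on the top row extends to all others through `lattice`.
record TableauWord (n r d R : ℕ) (w : ℕ → ℕ) : Set where
  field
    range   : ∀ t → t < n * r → w t < R
    used    : ∀ k → k < R → 0 < occ w k (n * r)
    lattice : ∀ k t → t ≤ n * r → occ w (suc k) t ≤ occ w k t
    blocks  : ∀ i s → i < n → suc s < r → w (r * i + suc s) ≤ w (r * i + s)
    width   : occ w 0 (n * r) ≤ d

RestrictedSYT : (n r d : ℕ) → Tableau → Set
RestrictedSYT n r d T = SYT≤ (n * r) d T × ConditionT̂ n r T

word : Tableau → ℕ → ℕ
word T t = rowIndex T (suc t)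

module _ {n r d R : ℕ} {w : ℕ → ℕ} (W : TableauWord n r d R w) where

  open TableauWord W

  private
    m = n * r
    T = tableau w R m

    entries-unique : Unique (concat T)
    entries-unique = Unique.concat⁺
      (All.applyUpTo⁺₂ _ R λ k → AllPairs.map <⇒≢ (row-sorted w k m))
      (AllPairs.applyUpTo⁺₁ _ R λ {i} {j} i<j _ (x∈ , x∈′) →
        let (t , _ , x≡ , wt≡i) = ∈-row⁻ w i m x∈ ; (t′ , _ , x≡′ , wt′≡j) = ∈-row⁻ w j m x∈′ in
        <⇒≢ i<j (trans (sym wt≡i) (trans (cong w (suc-injective (trans (sym x≡) x≡′))) wt′≡j)))

    lookup-row : ∀ p → List.lookup T p ≡ row w (toℕ p) m
    lookup-row p = go R p
      where
      go : ∀ {f : ℕ → List ℕ} R (p : Fin (length (applyUpTo f R))) → List.lookup (applyUpTo f R) p ≡ f (toℕ p)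
      go (suc R) Fin.zero    = refl
      go {f} (suc R) (Fin.suc p) = go {f ∘ suc} R p

  tableau-restricted : RestrictedSYT n r d T
  tableau-restricted = (syt , All.applyUpTo⁺₂ _ R widths) , condition
    where
    widths : ∀ k → length (row w k m) ≤ d
    widths k = ≤-trans (≤-reflexive (length-row w k m)) (≤-trans (≤-topRow k) width)
      where
      ≤-topRow : ∀ k → occ w k m ≤ occ w 0 m
      ≤-topRow zero    = ≤-refl
      ≤-topRow (suc k) = ≤-trans (lattice k m ≤-refl) (≤-topRow k)
    syt : IsSYT m T
    syt = record
      { nonEmptyRows = All.applyUpTo⁺₁ _ R λ {k} k<R → subst (0 <_) (sym (length-row w k m)) (used k k<R)
      ; rowsIncreasing = All.applyUpTo⁺₂ _ R λ k → AllPairs⇒Linked (row-sorted w k m)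
      ; columnsIncreasing = Linked.applyUpTo⁺₂ _ R λ k → row-above w k m (lattice k)
      ; entries = ∼bag⇒↭ (unique∧set⇒bag entries-unique (Unique.map⁺ suc-injective (Unique.upTo⁺ m))
          (mk⇔ to from)) }
      where
      to : ∀ {x} → x ∈ concat T → x ∈ List.map suc (upTo m)
      to x∈ with ρ , x∈ρ , ρ∈T ← ∈-concat⁻′ T x∈ with k , _ , refl ← ∈-applyUpTo⁻ _ ρ∈T
        with t , t<m , refl , _ ← ∈-row⁻ w k m x∈ρ = ∈-map⁺ suc (∈-upTo⁺ t<m)
      from : ∀ {x} → x ∈ List.map suc (upTo m) → x ∈ concat T
      from x∈ with t , t∈ , refl ← ∈-map⁻ suc x∈ =
        ∈-concat⁺′ (∈-row⁺ w (∈-upTo⁻ t∈) refl) (∈-applyUpTo⁺ _ (range t (∈-upTo⁻ t∈)))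
    condition : ConditionT̂ n r T
    -- Entries count from one and letters from zero: entry `r i + s + 1` is the letter at `r i + s`.
    -- Since the condition starts at 1, its index is a successor and absorbs the shift.
    condition i (suc s) _ s<r p q x∈p x∈q
      with t , _ , x≡ , wt≡p ← ∈-row⁻ w (toℕ p) m (subst (_ ∈_) (lookup-row p) x∈p)
         | t′ , _ , x≡′ , wt′≡q ← ∈-row⁻ w (toℕ q) m (subst (_ ∈_) (lookup-row q) x∈q) =
      subst₂ _≤_ (trans (cong w (suc-injective (trans (trans (sym (+-suc (r * toℕ i) (suc s))) (cong (r * toℕ i +_) (+-comm 1 (suc s)))) x≡′))) wt′≡q)
                 (trans (cong w (suc-injective (trans (sym (+-suc (r * toℕ i) s)) x≡))) wt≡p)
                 (blocks (toℕ i) s (toℕ<n i) s<r)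

  word-tableau : ∀ t → t < m → word T t ≡ w t
  word-tableau t t<m = trans (rowIndex-lookup T entries-unique p (subst (suc t ∈_) (sym (lookup-row p))
      (∈-row⁺ w t<m (sym p≡)))) p≡
    where
    p : Fin (length T)
    p = Fin.cast (sym (List.length-applyUpTo _ R)) (fromℕ< (range t t<m))
    p≡ : toℕ p ≡ w t
    p≡ = trans (toℕ-cast (sym (List.length-applyUpTo _ R)) _) (toℕ-fromℕ< (range t t<m))

module _ {n r d : ℕ} {T : Tableau} (restricted : RestrictedSYT n r d T) where

  private
    m = n * r
    w = word T
    R = length T
    syt = proj₁ (proj₁ restricted)
    widths = proj₂ (proj₁ restricted)
    condition = proj₂ restricted
    open IsSYT syt

    unique : Unique (concat T)
    unique = Permutation.Unique-resp-↭ (setoid ℕ) (↭⇒↭ₛ (↭-sym entries)) (Unique.map⁺ suc-injective (Unique.upTo⁺ m))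

    find : ∀ t → t < m → ∃[ p ] suc t ∈ List.lookup T p
    find t t<m = ∈-concat⇒lookup T (∈-resp-↭ (↭-sym entries) (∈-map⁺ suc (∈-upTo⁺ t<m)))

    word-lookup : ∀ {t} p → suc t ∈ List.lookup T p → w t ≡ toℕ p
    word-lookup p = rowIndex-lookup T unique p

    lookup≡row : ∀ p → List.lookup T p ≡ row w (toℕ p) m
    lookup≡row p = sorted-ext
      (Linked⇒AllPairs <-trans (All.lookup rowsIncreasing (∈-lookup p))) (row-sorted w (toℕ p) m) to from
      where
      to : ∀ {x} → x ∈ List.lookup T p → x ∈ row w (toℕ p) m
      to x∈ with t , t∈ , refl ← ∈-map⁻ suc (∈-resp-↭ entries (∈-concat⁺′ {xss = T} x∈ (∈-lookup p))) =
        ∈-row⁺ w (∈-upTo⁻ t∈) (rowIndex-lookup T unique p x∈)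
      from : ∀ {x} → x ∈ row w (toℕ p) m → x ∈ List.lookup T p
      from x∈ with t , t<m , refl , wt≡p ← ∈-row⁻ w (toℕ p) m x∈ with q , x∈q ← find t t<m
        with refl ← toℕ-injective {i = p} {j = q} (trans (sym wt≡p) (word-lookup q x∈q)) = x∈q

  tableau-word : T ≡ tableau w R m
  tableau-word = applyUpTo-lookup (λ k → row w k m) T lookup≡row

  word-restricted : TableauWord n r d R w
  word-restricted = record
    { range = range ; used = used ; lattice = lattice ; blocks = blocks ; width = width }
    where
    range : ∀ t → t < m → w t < R
    range t t<m with p , x∈p ← find t t<m = subst (_< R) (sym (word-lookup p x∈p)) (toℕ<n p)
    used : ∀ k → k < R → 0 < occ w k m
    used k k<R = subst (0 <_) (length-row w k m)
      (All.applyUpTo⁻ (λ k → row w k m) R (subst (All _) tableau-word nonEmptyRows) k<R)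
    lattice : ∀ k t → t ≤ m → occ w (suc k) t ≤ occ w k t
    lattice k t t≤m with suc k <? R
    ... | yes k<R = subst₂ _≤_ (occ-count≤ w (suc k) t≤m) (occ-count≤ w k t≤m) (count≤-prefix t
          (linked-applyUpTo⁻ (λ k → row w k m) R (subst (Linked _Above_) tableau-word columnsIncreasing) k<R))
    ... | no k≮R  = ≤-trans (≤-reflexive (∑χ-none (λ t → w t ≟ suc k) t λ i i<t wi≡ →
          k≮R (subst (_< R) wi≡ (range i (<-≤-trans i<t t≤m))))) z≤n
    blocks : ∀ i s → i < n → suc s < r → w (r * i + suc s) ≤ w (r * i + s)
    blocks i s i<n s<r with p , x∈p ← find (r * i + s) (index< i<n (<-trans (n<1+n s) s<r))
                          | q , x∈q ← find (r * i + suc s) (index< i<n s<r) =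
      subst₂ _≤_ (sym (word-lookup q x∈q)) (sym (word-lookup p x∈p))
        (condition (fromℕ< i<n) (suc s) z<s s<r p q
          (subst (λ i → i ∈ List.lookup T p) (trans (sym (+-suc (r * i) s)) (cong (λ i → r * i + suc s) (sym (toℕ-fromℕ< i<n)))) x∈p)
          (subst (λ i → i ∈ List.lookup T q) (trans (sym (+-suc (r * i) (suc s)))
            (cong₂ (λ i s → r * i + s) (sym (toℕ-fromℕ< i<n)) (+-comm 1 (suc s)))) x∈q))
    width : occ w 0 m ≤ d
    width with 0 <? R
    ... | yes 0<R = subst (_≤ d) (length-row w 0 m)
          (All.applyUpTo⁻ (λ k → row w k m) R (subst (All _) tableau-word widths) 0<R)
    ... | no 0≮R  = ≤-trans (≤-reflexive (∑χ-none (λ t → w t ≟ 0) m λ i i<m wi≡ →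
          0≮R (subst (_< R) wi≡ (range i i<m)))) z≤n

-- Words and chains

∑χ-≟ : ∀ n v → ∑ n (λ k → χ (v ≟ k)) ≡ χ (v <? n)
∑χ-≟ zero    v = sym (χ-no (v <? 0) λ ())
∑χ-≟ (suc n) v = trans (cong (_+ χ (v ≟ n)) (∑χ-≟ n v)) (go (<-cmp v n))
  where
  go : _ → χ (v <? n) + χ (v ≟ n) ≡ χ (v <? suc n)
  go (tri< v<n v≢n _) = trans (cong₂ _+_ (χ-yes (v <? n) v<n) (χ-no (v ≟ n) v≢n)) (sym (χ-yes (v <? suc n) (m<n⇒m<1+n v<n)))
  go (tri≈ v≮n v≡n _) = trans (cong₂ _+_ (χ-no (v <? n) v≮n) (χ-yes (v ≟ n) v≡n)) (sym (χ-yes (v <? suc n) (s≤s (≤-reflexive v≡n))))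
  go (tri> v≮n v≢n n<v) = trans (cong₂ _+_ (χ-no (v <? n) v≮n) (χ-no (v ≟ n) v≢n)) (sym (χ-no (v <? suc n) (≤⇒≯ n<v)))

∑-occ : ∀ w k t → ∑ k (λ k′ → occ w k′ t) ≡ ∑ t (λ t′ → χ (w t′ <? k))
∑-occ w k t = trans (∑-swap k t (λ k′ t′ → χ (w t′ ≟ k′))) (∑-cong t λ t′ _ → ∑χ-≟ k (w t′))

occ-mono : ∀ w k {s t} → s ≤ t → occ w k s ≤ occ w k t
occ-mono w k = ∑-≤ (λ t → χ (w t ≟ k))

index≤ : ∀ {n r i s} → i < n → s ≤ r → r * i + s ≤ n * r
index≤ {n} {r} {i} {s} i<n s≤r = begin
  r * i + s    ≤⟨ +-monoʳ-≤ (r * i) s≤r ⟩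
  r * i + r    ≡⟨ trans (+-comm (r * i) r) (sym (*-suc r i)) ⟩
  r * suc i    ≤⟨ *-monoʳ-≤ r i<n ⟩
  r * n        ≡⟨ *-comm r n ⟩
  n * r        ∎
  where open ≤-Reasoning

*-suc′ : ∀ r i → r * suc i ≡ r * i + r
*-suc′ r i = trans (*-suc r i) (+-comm r (r * i))

-- Within block i the rows weakly decrease, so k < w (r i + s) iff fewer than
-- r - s letters of the block are at most k; both sides of that inequality are
-- shifted by the number of earlier letters at most k.
Beyond : (ℕ → ℕ → ℕ) → ℕ → ℕ → ℕ → ℕ → Set
Beyond l r i s k = s + ∑ (suc k) (l (suc i)) < r + ∑ (suc k) (l i)

beyond? : ∀ l r i s k → Dec (Beyond l r i s k)
beyond? l r i s k = s + ∑ (suc k) (l (suc i)) <? r + ∑ (suc k) (l i)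

-- A number is the count of the numbers below it, so the letter is found by counting the `k` smaller
-- than it; `n` candidates suffice because no shape has more than `n` rows.
wordOf : (n r : ℕ) .{{_ : NonZero r}} → (ℕ → ℕ → ℕ) → ℕ → ℕ
wordOf n r l t = ∑ n (λ k → χ (beyond? l r (t / r) (t % r) k))

module _ {r : ℕ} .{{_ : NonZero r}} where

  quotient : ∀ i {s} → s < r → (r * i + s) / r ≡ i
  quotient i {s} s<r = trans (cong (λ x → (x + s) / r) (*-comm r i))
    (trans (+-distrib-/-∣ˡ s (divides-refl i))
      (trans (cong₂ _+_ (m*n/n≡m i r) (m<n⇒m/n≡0 s<r)) (+-identityʳ i)))

  remainder : ∀ i {s} → s < r → (r * i + s) % r ≡ s
  remainder i {s} s<r = trans (cong (_% r) (trans (+-comm (r * i) s) (cong (s +_) (*-comm r i))))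
    (trans ([m+kn]%n≡m%n s i r) (m<n⇒m%n≡m s<r))

  wordOf-block : ∀ n l i {s} → s < r → wordOf n r l (r * i + s) ≡ ∑ n (λ k → χ (beyond? l r i s k))
  wordOf-block n l i s<r = cong₂ (λ i s → ∑ n (λ k → χ (beyond? l r i s k))) (quotient i s<r) (remainder i s<r)

  splitIndex : ∀ {n t} → t < n * r → ∃₂ λ i s → i < n × s < r × t ≡ r * i + s
  splitIndex {n} {t} t<m = t / r , t % r , m<n*o⇒m/o<n {t} {n} {r} t<m , m%n<n t r ,
    trans (m≡m%n+[m/n]*n t r) (trans (+-comm (t % r) _) (cong (_+ t % r) (*-comm (t / r) r)))

  wordOf-cong : ∀ {n l l′} → l ≗⟨ n ⟩ l′ → ∀ t → t < n * r → wordOf n r l t ≡ wordOf n r l′ t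
  wordOf-cong {n} {l} {l′} h t t<m = ∑-cong n λ k _ → χ-cong (beyond? l r i s k) (beyond? l′ r i s k)
      (subst₂ (λ p q → s + p < r + q) (after k) (before k))
      (subst₂ (λ p q → s + p < r + q) (sym (after k)) (sym (before k)))
    where
    i = t / r
    s = t % r
    i<n : i < n
    i<n = m<n*o⇒m/o<n {t} {n} {r} t<m
    after : ∀ k → ∑ (suc k) (l (suc i)) ≡ ∑ (suc k) (l′ (suc i))
    after k = ∑-cong (suc k) λ k′ _ → h (suc i) i<n k′
    before : ∀ k → ∑ (suc k) (l i) ≡ ∑ (suc k) (l′ i)
    before k = ∑-cong (suc k) λ k′ _ → h i (<⇒≤ i<n) k′

rowsOfWord : ℕ → (ℕ → ℕ) → ℕ → ℕ → ℕ
rowsOfWord r w i k = occ w k (r * i)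

module _ {n r d R : ℕ} {w : ℕ → ℕ} (W : TableauWord n r d R w) where

  open TableauWord W

  private
    l = rowsOfWord r w

    block-decreasing : ∀ {i s s′} → i < n → s ≤ s′ → s′ < r → w (r * i + s′) ≤ w (r * i + s)
    block-decreasing {i} {s} i<n s≤s′ s′<r with o , refl ← m≤n⇒∃[o]m+o≡n s≤s′ = go o s′<r
      where
      go : ∀ o → s + o < r → w (r * i + (s + o)) ≤ w (r * i + s)
      go zero    _ = ≤-reflexive (cong (λ x → w (r * i + x)) (+-identityʳ s))
      go (suc o) lt = ≤-trans (≤-reflexive (cong (λ x → w (r * i + x)) (+-suc s o)))
        (≤-trans (blocks i (s + o) i<n lt′) (go o (<-trans (n<1+n _) lt′)))
        where lt′ = subst (_< r) (+-suc s o) lt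

    -- Within a block the letters `k + 1` precede the letters `k`. At the last letter `k + 1` the
    -- lattice condition therefore compares with a row `k` that has not grown since the block began.
    strip : ∀ i k → i < n → l (suc i) (suc k) ≤ l i k
    strip i k i<n = subst (λ t → occ w (suc k) t ≤ l i k) (sym (*-suc′ r i)) (go r ≤-refl)
      where
      go : ∀ s → s ≤ r → occ w (suc k) (r * i + s) ≤ l i k
      go zero    _   = ≤-trans (≤-reflexive (cong (occ w (suc k)) (+-identityʳ (r * i))))
                               (lattice k (r * i) (≤-trans (m≤m+n (r * i) 0) (index≤ i<n z≤n)))
      go (suc s) s<r with w (r * i + s) ≟ suc k
      ... | yes eq = ≤-trans (lattice k (r * i + suc s) (index≤ i<n s<r)) (≤-reflexive
        (trans (∑-split (r * i) (suc s) (λ t → χ (w t ≟ k)))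
          (trans (cong (l i k +_) (∑χ-none (λ o → w (r * i + o) ≟ k) (suc s) λ o o≤s wo≡k →
            1+n≰n (subst₂ _≤_ eq wo≡k (block-decreasing i<n (s≤s⁻¹ o≤s) s<r)))) (+-identityʳ _))))
      ... | no neq = ≤-trans (≤-reflexive (trans (cong (occ w (suc k)) (+-suc (r * i) s))
        (trans (cong (occ w (suc k) (r * i + s) +_) (χ-no (w (r * i + s) ≟ suc k) neq)) (+-identityʳ _))))
        (go s (<⇒≤ s<r))

    few-rows : ∀ i k → i ≤ n → i ≤ k → l i k ≡ 0
    few-rows zero    k       _   _   = cong (occ w k) (*-zeroʳ r)
    few-rows (suc i) (suc k) i<n i≤k = n≤0⇒n≡0 (≤-trans (strip i k i<n)
      (≤-reflexive (few-rows i k (<⇒≤ i<n) (s≤s⁻¹ i≤k))))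

    occ-last : ∀ k → occ w k (n * r) ≡ l n k
    occ-last k = cong (occ w k) (*-comm n r)

    w<n : ∀ t → t < n * r → w t < n
    w<n t t<m with w t <? n
    ... | yes p = p
    ... | no ¬p = contradiction (≤-trans
      (≤-trans (≤-reflexive (sym (χ-yes (w t ≟ w t) refl))) (∑-term (λ t′ → χ (w t′ ≟ w t)) t<m))
      (≤-reflexive (trans (occ-last (w t)) (few-rows n (w t) ≤-refl (≮⇒≥ ¬p))))) λ ()

  word-rowChain : RowChain n r d l
  word-rowChain = record
    { start = λ k → few-rows 0 k z≤n z≤n
    ; grows = λ i k _ → occ-mono w k (*-monoʳ-≤ r (n≤1+n i))
    ; strip = strip
    ; size  = λ i i≤n → trans (∑-occ w n (r * i)) (∑χ-all (λ t → w t <? n) (r * i)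
        λ t t<ri → w<n t (<-≤-trans t<ri (≤-trans (*-monoʳ-≤ r i≤n) (≤-reflexive (*-comm r n)))))
    ; width = subst (_≤ d) (occ-last 0) width }

  word-length : conj n (l n) 0 ≡ R
  word-length = trans (∑χ-cong n (λ k → 0 <? l n k) (_<? R) to λ k _ k<R → subst (0 <_) (occ-last k) (used k k<R)) (∑χ-< n R≤n)
    where
    to : ∀ k → k < n → 0 < l n k → k < R
    to k _ 0<l with t , t<m , 0<χ ← ∑-positive (r * n) 0<l =
      subst (_< R) (χ-pos (w t ≟ k) 0<χ) (range t (<-≤-trans t<m (≤-reflexive (*-comm r n))))
    R≤n : R ≤ n
    R≤n with n <? R
    ... | yes n<R = contradiction (subst (0 <_) (trans (occ-last n) (few-rows n n ≤-refl ≤-refl)) (used n n<R)) λ ()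
    ... | no n≮R  = ≮⇒≥ n≮R

  module _ .{{_ : NonZero r}} where

    wordOf-rowsOfWord : ∀ t → t < n * r → wordOf n r l t ≡ w t
    wordOf-rowsOfWord t t<m with i , s , i<n , s<r , refl ← splitIndex {r} {n} t<m =
      trans (wordOf-block n l i s<r)
        (trans (∑χ-cong n (beyond? l r i s) (_<? w (r * i + s)) (λ k _ → to k) (λ k _ → from k))
          (∑χ-< n (<⇒≤ (w<n (r * i + s) t<m))))
      where
      -- The letters at most `k` form a suffix of block `i`, of length `small k`. Position `s`
      -- precedes it exactly when `s + small k < r`, which is `Beyond` with the letters of earlier
      -- blocks cancelled.
      small : ℕ → ℕ
      small k = ∑ r (λ o → χ (w (r * i + o) <? suc k))
      prefix : ∀ k → ∑ (suc k) (l (suc i)) ≡ ∑ (suc k) (l i) + small k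
      prefix k = trans (∑-occ w (suc k) (r * suc i)) (trans (cong (λ t → ∑ t (λ t′ → χ (w t′ <? suc k))) (*-suc′ r i))
        (trans (∑-split (r * i) r (λ t′ → χ (w t′ <? suc k))) (cong (_+ small k) (sym (∑-occ w (suc k) (r * i))))))
      regroup : ∀ s p b → s + (p + b) ≡ (s + b) + p
      regroup = solve-∀
      to : ∀ k → Beyond l r i s k → k < w (r * i + s)
      to k beyond with k <? w (r * i + s)
      ... | yes p = p
      ... | no ¬p with o , s+o≡r ← m≤n⇒∃[o]m+o≡n (<⇒≤ s<r) = contradiction
        (+-cancelʳ-< (∑ (suc k) (l i)) (s + small k) r
          (subst (_< r + ∑ (suc k) (l i)) (trans (cong (s +_) (prefix k)) (regroup s (∑ (suc k) (l i)) (small k))) beyond))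
        (≤⇒≯ (≤-trans (≤-reflexive (sym s+o≡r)) (+-monoʳ-≤ s (≤-trans (m≤n+m o (∑ s f)) (≤-reflexive (sym small≡))))))
        where
        f = λ j → χ (w (r * i + j) <? suc k)
        all-small : ∀ j → j < o → w (r * i + (s + j)) < suc k
        all-small j j<o = s≤s (≤-trans (block-decreasing i<n (m≤m+n s j)
          (<-≤-trans (+-monoʳ-< s j<o) (≤-reflexive s+o≡r))) (≮⇒≥ ¬p))
        small≡ : small k ≡ ∑ s f + o
        small≡ = trans (cong (λ x → ∑ x f) (sym s+o≡r)) (trans (∑-split s o f)
          (cong (∑ s f +_) (∑χ-all (λ j → w (r * i + (s + j)) <? suc k) o all-small)))
      from : ∀ k → k < w (r * i + s) → Beyond l r i s k
      from k k<w with o , s+o≡r ← m≤n⇒∃[o]m+o≡n s<r =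
        subst (_< r + ∑ (suc k) (l i)) (sym (trans (cong (s +_) (prefix k)) (regroup s (∑ (suc k) (l i)) (small k))))
          (+-monoˡ-< (∑ (suc k) (l i)) (≤-trans (+-monoʳ-≤ (suc s) small≤) (≤-reflexive s+o≡r)))
        where
        f = λ j → χ (w (r * i + j) <? suc k)
        none-small : ∀ j → j < suc s → ¬ w (r * i + j) < suc k
        none-small j j≤s w≤k = ≤⇒≯ (s≤s⁻¹ w≤k) (<-≤-trans k<w (block-decreasing i<n (s≤s⁻¹ j≤s) s<r))
        small≤ : small k ≤ o
        small≤ = ≤-trans (≤-reflexive (trans (cong (λ x → ∑ x f) (sym s+o≡r)) (trans (∑-split (suc s) o f)
            (cong (_+ ∑ o (λ j → f (suc s + j))) (∑χ-none (λ j → w (r * i + j) <? suc k) (suc s) none-small)))))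
          (∑χ≤ (λ j → w (r * i + (suc s + j)) <? suc k) o)

module _ {n r d : ℕ} .{{_ : NonZero r}} {l : ℕ → ℕ → ℕ} (L : RowChain n r d l) where

  private
    module L = RowChain L
    w = wordOf n r l

    -- Rearranged: strip `i` has no more cells in the first `a` rows than in the first `b`. Sums
    -- replace differences to stay in ℕ. This makes `Beyond` downward closed in `k`.
    exchange : ∀ i {a b} → i < n → a ≤ b → ∑ a (l (suc i)) + ∑ b (l i) ≤ ∑ a (l i) + ∑ b (l (suc i))
    exchange i {a} i<n a≤b with o , refl ← m≤n⇒∃[o]m+o≡n a≤b = begin
      ∑ a (l (suc i)) + ∑ (a + o) (l i)
        ≡⟨ cong (∑ a (l (suc i)) +_) (∑-split a o (l i)) ⟩
      ∑ a (l (suc i)) + (∑ a (l i) + ∑ o (λ k → l i (a + k)))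
        ≤⟨ +-monoʳ-≤ (∑ a (l (suc i))) (+-monoʳ-≤ (∑ a (l i)) (∑-mono o λ k _ → L.grows i (a + k) i<n)) ⟩
      ∑ a (l (suc i)) + (∑ a (l i) + ∑ o (λ k → l (suc i) (a + k)))
        ≡⟨ regroup (∑ a (l (suc i))) (∑ a (l i)) _ ⟩
      ∑ a (l i) + (∑ a (l (suc i)) + ∑ o (λ k → l (suc i) (a + k)))
        ≡⟨ cong (∑ a (l i) +_) (∑-split a o (l (suc i))) ⟨
      ∑ a (l i) + ∑ (a + o) (l (suc i)) ∎
      where
      open ≤-Reasoning
      regroup : ∀ x y z → x + (y + z) ≡ y + (x + z)
      regroup = solve-∀

    beyond-down : ∀ i s → i < n → ∀ k k′ → k ≤ k′ → Beyond l r i s k′ → Beyond l r i s k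
    beyond-down i s i<n k k′ k≤k′ beyond = +-cancelʳ-< (∑ (suc k′) (l i)) _ _ (begin-strict
      s + ∑ (suc k) (l (suc i)) + ∑ (suc k′) (l i)     ≡⟨ +-assoc s _ _ ⟩
      s + (∑ (suc k) (l (suc i)) + ∑ (suc k′) (l i))   ≤⟨ +-monoʳ-≤ s (exchange i i<n (s≤s k≤k′)) ⟩
      s + (∑ (suc k) (l i) + ∑ (suc k′) (l (suc i)))   ≡⟨ regroup s (∑ (suc k) (l i)) _ ⟩
      (s + ∑ (suc k′) (l (suc i))) + ∑ (suc k) (l i)   <⟨ +-monoˡ-< (∑ (suc k) (l i)) beyond ⟩
      (r + ∑ (suc k′) (l i)) + ∑ (suc k) (l i)         ≡⟨ regroup′ r (∑ (suc k′) (l i)) _ ⟩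
      r + ∑ (suc k) (l i) + ∑ (suc k′) (l i)           ∎)
      where
      open ≤-Reasoning
      regroup : ∀ x y z → x + (y + z) ≡ (x + z) + y
      regroup = solve-∀
      regroup′ : ∀ x y z → (x + y) + z ≡ (x + z) + y
      regroup′ = solve-∀

    module _ {i s} (i<n : i < n) (s<r : s < r) where

      <w⁺ : ∀ {k} → k < n → Beyond l r i s k → k < w (r * i + s)
      <w⁺ k<n beyond = subst (_ <_) (sym (wordOf-block n l i s<r))
        (<∑χ⁺ (beyond? l r i s) (beyond-down i s i<n) k<n beyond)

      <w⁻ : ∀ {k} → k < w (r * i + s) → Beyond l r i s k
      <w⁻ k<w = <∑χ⁻ (beyond? l r i s) (beyond-down i s i<n) {n = n} (subst (_ <_) (wordOf-block n l i s<r) k<w)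

      w-small : w (r * i + s) < n
      w-small with w (r * i + s) <? n
      ... | yes p = p
      -- A letter `n` or larger would make `Beyond` hold at `k = n - 1`, where the prefix sums are
      -- full sizes; but `s + r (i + 1) < r + r i` is impossible.
      ... | no ¬p = contradiction (<w⁻ {pred n} (subst (_≤ w (r * i + s)) (sym n≡) (≮⇒≥ ¬p))) (≤⇒≯ (begin
        r + ∑ (suc (pred n)) (l i)          ≡⟨ cong (λ k → r + ∑ k (l i)) n≡ ⟩
        r + ∑ n (l i)                       ≡⟨ cong (r +_) (L.size i (<⇒≤ i<n)) ⟩
        r + r * i                           ≡⟨ *-suc r i ⟨
        r * suc i                           ≡⟨ L.size (suc i) i<n ⟨
        ∑ n (l (suc i))                     ≡⟨ cong (λ k → ∑ k (l (suc i))) n≡ ⟨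
        ∑ (suc (pred n)) (l (suc i))        ≤⟨ m≤n+m _ s ⟩
        s + ∑ (suc (pred n)) (l (suc i))    ∎))
        where
        open ≤-Reasoning
        n≡ : suc (pred n) ≡ n
        n≡ = suc-pred n {{>-nonZero (≤-<-trans z≤n i<n)}}

    -- Let `δ` be the number of cells of strip `i` in the rows up to `k`. Cancelling the earlier
    -- cells turns `Beyond` into `s + δ < r`, so exactly the last `δ` positions of the block carry
    -- letters at most `k`; they fit because the strip has `r` cells.
    block-count : ∀ {i k} → i < n → k < n →
      ∑ (suc k) (l i) + ∑ r (λ s → χ (w (r * i + s) <? suc k)) ≡ ∑ (suc k) (l (suc i))
    block-count {i} {k} i<n k<n with δ , p+δ≡p′ ← m≤n⇒∃[o]m+o≡n (∑-mono (suc k) λ k′ _ → L.grows i k′ i<n) = go δ≤r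
      where
      p = ∑ (suc k) (l i)
      p′ = ∑ (suc k) (l (suc i))
      open ≤-Reasoning
      δ≤r : δ ≤ r
      δ≤r = +-cancelˡ-≤ (p + ∑ n (l i)) _ _ (begin
        p + ∑ n (l i) + δ               ≡⟨ regroup p (∑ n (l i)) δ ⟩
        (p + δ) + ∑ n (l i)             ≡⟨ cong (_+ ∑ n (l i)) p+δ≡p′ ⟩
        p′ + ∑ n (l i)                  ≤⟨ exchange i i<n k<n ⟩
        p + ∑ n (l (suc i))             ≡⟨ cong (p +_) (trans (L.size (suc i) i<n) (trans (*-suc′ r i) (cong (_+ r) (sym (L.size i (<⇒≤ i<n)))))) ⟩
        p + (∑ n (l i) + r)             ≡⟨ +-assoc p _ r ⟨
        p + ∑ n (l i) + r               ∎)
        where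
        regroup : ∀ x y z → x + y + z ≡ (x + z) + y
        regroup = solve-∀
      regroup : ∀ s p δ → s + (p + δ) ≡ (s + δ) + p
      regroup = solve-∀
      beyond⇔ : ∀ {s} → Beyond l r i s k → s + δ < r
      beyond⇔ {s} b = +-cancelʳ-< p _ _ (subst (_< r + p) (trans (cong (s +_) (sym p+δ≡p′)) (regroup s p δ)) b)
      ⇔beyond : ∀ {s} → s + δ < r → Beyond l r i s k
      ⇔beyond {s} lt = subst (_< r + p) (sym (trans (cong (s +_) (sym p+δ≡p′)) (regroup s p δ))) (+-monoˡ-< p lt)
      go : δ ≤ r → p + ∑ r (λ s → χ (w (r * i + s) <? suc k)) ≡ p′
      go δ≤r with o , δ+o≡r ← m≤n⇒∃[o]m+o≡n δ≤r = trans (cong (p +_) count) p+δ≡p′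
        where
        o+δ≡r = trans (+-comm o δ) δ+o≡r
        f = λ s → χ (w (r * i + s) <? suc k)
        count : ∑ r f ≡ δ
        count = trans (cong (λ x → ∑ x f) (sym o+δ≡r)) (trans (∑-split o δ f) (cong₂ _+_
          (∑χ-none (λ s → w (r * i + s) <? suc k) o λ s s<o w≤k →
            let s+δ<r = <-≤-trans (+-monoˡ-< δ s<o) (≤-reflexive o+δ≡r) in
            ≤⇒≯ (s≤s⁻¹ w≤k) (<w⁺ i<n (≤-<-trans (m≤m+n s δ) s+δ<r) k<n (⇔beyond s+δ<r)))
          (∑χ-all (λ s → w (r * i + (o + s)) <? suc k) δ λ s s<δ → s≤s (≮⇒≥ λ k<w →
            let o+s<r = subst (o + s <_) o+δ≡r (+-monoʳ-< o s<δ) in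
            ≤⇒≯ (≤-trans (≤-reflexive (sym o+δ≡r)) (+-monoˡ-≤ δ (m≤m+n o s))) (beyond⇔ (<w⁻ i<n o+s<r k<w))))))

    prefix-count : ∀ i k → i ≤ n → k < n → ∑ (suc k) (λ k′ → occ w k′ (r * i)) ≡ ∑ (suc k) (l i)
    prefix-count i k i≤n k<n = trans (∑-occ w (suc k) (r * i)) (go i i≤n)
      where
      g = λ t → χ (w t <? suc k)
      go : ∀ i → i ≤ n → ∑ (r * i) g ≡ ∑ (suc k) (l i)
      go zero    _   = trans (cong (λ x → ∑ x g) (*-zeroʳ r)) (sym (∑-zero (suc k) λ k′ _ → L.start k′))
      go (suc i) i<n = trans (cong (λ x → ∑ x g) (*-suc′ r i)) (trans (∑-split (r * i) r g)
        (trans (cong (_+ ∑ r (λ s → g (r * i + s))) (go i (<⇒≤ i<n))) (block-count i<n k<n)))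

    w<n : ∀ t → t < n * r → w t < n
    w<n t t<m with i , s , i<n , s<r , refl ← splitIndex {r} {n} t<m = w-small i<n s<r

  occ-wordOf : rowsOfWord r w ≗⟨ n ⟩ l
  occ-wordOf i i≤n k with k <? n
  ... | no k≮n = trans (∑χ-none (λ t → w t ≟ k) (r * i) λ t t<ri wt≡k → k≮n (subst (_< n) wt≡k
          (w<n t (<-≤-trans t<ri (≤-trans (*-monoʳ-≤ r i≤n) (≤-reflexive (*-comm r n)))))))
        (sym (L.height i i≤n k (≤-trans i≤n (≮⇒≥ k≮n))))
  ... | yes k<n = +-cancelˡ-≡ (∑ k (l i)) _ _ (trans (cong (_+ occ w k (r * i)) (sym (below k (<⇒≤ k<n)))) (prefix-count i k i≤n k<n))
    where
    below : ∀ k → k ≤ n → ∑ k (λ k′ → occ w k′ (r * i)) ≡ ∑ k (l i)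
    below zero    _   = refl
    below (suc k) k<n = prefix-count i k i≤n k<n

  private
    occ-last : ∀ k → occ w k (n * r) ≡ l n k
    occ-last k = trans (cong (occ w k) (*-comm n r)) (occ-wordOf n ≤-refl k)

  wordOf-tableauWord : TableauWord n r d (conj n (l n) 0) w
  wordOf-tableauWord = record
    { range   = λ t t<m → <conj⁺ n (L.decreasing n ≤-refl) (w<n t t<m) (subst (0 <_) (occ-last (w t))
        (≤-trans (≤-reflexive (sym (χ-yes (w t ≟ w t) refl))) (∑-term (λ t′ → χ (w t′ ≟ w t)) t<m)))
    ; used    = λ k k<R → subst (0 <_) (sym (occ-last k)) (<conj⁻ n (L.decreasing n ≤-refl) k<R)
    ; lattice = λ k t t≤m → lattice k t (m≤n⇒m<n∨m≡n t≤m)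
    ; blocks  = λ i s i<n s<r → subst₂ _≤_ (sym (wordOf-block n l i s<r)) (sym (wordOf-block n l i (<-trans (n<1+n s) s<r)))
        (∑χ-mono n (beyond? l r i (suc s)) (beyond? l r i s) λ k _ → <-trans (n<1+n _))
    ; width   = subst (_≤ d) (sym (occ-last 0)) L.width }
    where
    -- The strip condition compares row `k + 1` after block `i` with row `k` before it, and
    -- monotonicity covers every time in between. The final time belongs to no block; there the last
    -- shape is a partition.
    lattice : ∀ k t → t < n * r ⊎ t ≡ n * r → occ w (suc k) t ≤ occ w k t
    lattice k t (inj₂ refl) = subst₂ _≤_ (sym (occ-last (suc k))) (sym (occ-last k)) (L.decreasing n ≤-refl k)
    lattice k t (inj₁ t<m) with i , s , i<n , s<r , refl ← splitIndex {r} {n} t<m = begin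
      occ w (suc k) (r * i + s)    ≤⟨ occ-mono w (suc k) (≤-trans (+-monoʳ-≤ (r * i) (<⇒≤ s<r)) (≤-reflexive (sym (*-suc′ r i)))) ⟩
      occ w (suc k) (r * suc i)    ≡⟨ occ-wordOf (suc i) i<n (suc k) ⟩
      l (suc i) (suc k)            ≤⟨ L.strip i k i<n ⟩
      l i k                        ≡⟨ occ-wordOf i (<⇒≤ i<n) k ⟨
      occ w k (r * i)              ≤⟨ occ-mono w k (m≤m+n (r * i) s) ⟩
      occ w k (r * i + s)          ∎
      where open ≤-Reasoning

-- `conj n (l n) 0` is the height of the first column, hence the number of nonempty rows.
tableauOf : (n r : ℕ) .{{_ : NonZero r}} → (ℕ → ℕ → ℕ) → Tableau
tableauOf n r l = tableau (wordOf n r l) (conj n (l n) 0) (n * r)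

rowsOfTableau : ℕ → Tableau → ℕ → ℕ → ℕ
rowsOfTableau r T = rowsOfWord r (word T)

module _ {n r d : ℕ} where

  restricted⇒rowChain : ∀ {T} → RestrictedSYT n r d T → RowChain n r d (rowsOfTableau r T)
  restricted⇒rowChain S = word-rowChain (word-restricted S)

  module _ .{{_ : NonZero r}} where

    rowChain⇒restricted : ∀ {l} → RowChain n r d l → RestrictedSYT n r d (tableauOf n r l)
    rowChain⇒restricted L = tableau-restricted (wordOf-tableauWord L)

    rowsOfTableau-tableauOf : ∀ {l} → RowChain n r d l → rowsOfTableau r (tableauOf n r l) ≗⟨ n ⟩ l
    rowsOfTableau-tableauOf {l} L i i≤n k = trans
      (occ-cong k (r * i) λ t t<ri → word-tableau (wordOf-tableauWord L) t
        (<-≤-trans t<ri (≤-trans (*-monoʳ-≤ r i≤n) (≤-reflexive (*-comm r n)))))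
      (occ-wordOf L i i≤n k)

    tableauOf-rowsOfTableau : ∀ {T l} → RestrictedSYT n r d T → l ≗⟨ n ⟩ rowsOfTableau r T → tableauOf n r l ≡ T
    tableauOf-rowsOfTableau {T} {l} S h = trans
      (cong (λ R → tableau (wordOf n r l) R (n * r)) (trans (conj-cong n (λ k _ → h n ≤-refl k) 0) (word-length W)))
      (trans (applyUpTo-cong (length T) λ k _ → row-cong k (n * r) λ t t<m →
        trans (wordOf-cong h t t<m) (wordOf-rowsOfWord W t t<m))
      (sym (tableau-word S)))
      where W = word-restricted S

-- The alternating sum over the symmetric group

-- Opened only now: with +_ in scope, sections (m +_) of addition on ℕ are ambiguous.
open import Data.Integer using (+_)

∑ℤ : {A : Set} → List A → (A → ℤ) → ℤ
∑ℤ []       f = 0ℤ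
∑ℤ (x ∷ xs) f = f x ℤ.+ ∑ℤ xs f

χℤ : {P : Set} → Dec P → ℤ
χℤ P? = + χ P?

+-interchangeℤ : ∀ a b c d → (a ℤ.+ b) ℤ.+ (c ℤ.+ d) ≡ (a ℤ.+ c) ℤ.+ (b ℤ.+ d)
+-interchangeℤ = solve-∀ℤ

module _ {A : Set} where

  ∑ℤ-cong : ∀ (xs : List A) {f g : A → ℤ} → (∀ x → x ∈ xs → f x ≡ g x) → ∑ℤ xs f ≡ ∑ℤ xs g
  ∑ℤ-cong []       h = refl
  ∑ℤ-cong (x ∷ xs) h = cong₂ ℤ._+_ (h x (here refl)) (∑ℤ-cong xs λ y y∈ → h y (there y∈))

  ∑ℤ-zero : ∀ (xs : List A) → ∑ℤ xs (λ _ → 0ℤ) ≡ 0ℤ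
  ∑ℤ-zero []       = refl
  ∑ℤ-zero (x ∷ xs) = trans (ℤ.+-identityˡ _) (∑ℤ-zero xs)

  ∑ℤ-+ : ∀ (xs : List A) f g → ∑ℤ xs (λ x → f x ℤ.+ g x) ≡ ∑ℤ xs f ℤ.+ ∑ℤ xs g
  ∑ℤ-+ []       f g = refl
  ∑ℤ-+ (x ∷ xs) f g = trans (cong (ℤ._+_ (f x ℤ.+ g x)) (∑ℤ-+ xs f g)) (+-interchangeℤ (f x) (g x) _ _)

  ∑ℤ-neg : ∀ (xs : List A) f → ∑ℤ xs (λ x → ℤ.- f x) ≡ ℤ.- ∑ℤ xs f
  ∑ℤ-neg []       f = refl
  ∑ℤ-neg (x ∷ xs) f = trans (cong (ℤ._+_ (ℤ.- f x)) (∑ℤ-neg xs f)) (sym (ℤ.neg-distrib-+ (f x) _))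

  ∑ℤ-* : ∀ (xs : List A) c f → ∑ℤ xs (λ x → c ℤ.* f x) ≡ c ℤ.* ∑ℤ xs f
  ∑ℤ-* []       c f = sym (ℤ.*-zeroʳ c)
  ∑ℤ-* (x ∷ xs) c f = trans (cong (ℤ._+_ (c ℤ.* f x)) (∑ℤ-* xs c f)) (sym (ℤ.*-distribˡ-+ c (f x) _))

  ∑ℤ-++ : ∀ (xs : List A) {ys} f → ∑ℤ (xs List.++ ys) f ≡ ∑ℤ xs f ℤ.+ ∑ℤ ys f
  ∑ℤ-++ []       f = sym (ℤ.+-identityˡ _)
  ∑ℤ-++ (x ∷ xs) f = trans (cong (ℤ._+_ (f x)) (∑ℤ-++ xs f)) (sym (ℤ.+-assoc (f x) _ _))

  length-filter : ∀ {P : A → Set} (P? : ∀ x → Dec (P x)) xs → + length (filter P? xs) ≡ ∑ℤ xs (χℤ ∘ P?)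
  length-filter P? []       = refl
  length-filter P? (x ∷ xs) with P? x
  ... | yes _ = cong (ℤ._+_ 1ℤ) (length-filter P? xs)
  ... | no _  = trans (length-filter P? xs) (sym (ℤ.+-identityˡ _))

∑ℤ-map : ∀ {A B : Set} (g : A → B) xs f → ∑ℤ (List.map g xs) f ≡ ∑ℤ xs (f ∘ g)
∑ℤ-map g []       f = refl
∑ℤ-map g (x ∷ xs) f = cong (ℤ._+_ (f (g x))) (∑ℤ-map g xs f)

∑ℤ-product : ∀ {A B C : Set} (g : A → B → C) xs ys (f : C → ℤ) →
  ∑ℤ (cartesianProductWith g xs ys) f ≡ ∑ℤ xs (λ x → ∑ℤ ys (λ y → f (g x y)))
∑ℤ-product g []       ys f = refl
∑ℤ-product g (x ∷ xs) ys f = trans (∑ℤ-++ (List.map (g x) ys) f)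
  (cong₂ ℤ._+_ (∑ℤ-map (g x) ys f) (∑ℤ-product g xs ys f))

∑ℤ-swap : ∀ {A B : Set} (xs : List A) (ys : List B) (f : A → B → ℤ) →
  ∑ℤ xs (λ x → ∑ℤ ys (f x)) ≡ ∑ℤ ys (λ y → ∑ℤ xs (λ x → f x y))
∑ℤ-swap []       ys f = sym (∑ℤ-zero ys)
∑ℤ-swap (x ∷ xs) ys f = trans (cong (ℤ._+_ (∑ℤ ys (f x))) (∑ℤ-swap xs ys f))
  (sym (∑ℤ-+ ys (f x) (λ y → ∑ℤ xs (λ x → f x y))))

∑ℤ-tabulate : ∀ {A : Set} {d} (g : Fin d → A) f → ∑ℤ (List.tabulate g) f ≡ ∑ℤ (allFin d) (f ∘ g)
∑ℤ-tabulate g f = trans (cong (λ xs → ∑ℤ xs f) (sym (List.map-tabulate id g))) (∑ℤ-map g (allFin _) f)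

∑ℤ-suc : ∀ d (f : Fin (suc d) → ℤ) → ∑ℤ (allFin (suc d)) f ≡ f Fin.zero ℤ.+ ∑ℤ (allFin d) (f ∘ Fin.suc)
∑ℤ-suc d f = cong (ℤ._+_ (f Fin.zero)) (∑ℤ-tabulate Fin.suc f)

-- The identity unless i + 1 < d.
swap : {A : Set} {d : ℕ} → ℕ → Vec A d → Vec A d
swap i       []          = []
swap zero    (x ∷ [])    = x ∷ []
swap zero    (x ∷ y ∷ z) = y ∷ x ∷ z
swap (suc i) (x ∷ z)     = x ∷ swap i z

swap-involutive : ∀ {A : Set} {d} i (z : Vec A d) → swap i (swap i z) ≡ z
swap-involutive i       []          = refl
swap-involutive zero    (x ∷ [])    = refl
swap-involutive zero    (x ∷ y ∷ z) = refl
swap-involutive (suc i) (x ∷ z)     = cong (x ∷_) (swap-involutive i z)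

swap-map : ∀ {A B : Set} {d} (f : A → B) i (z : Vec A d) → swap i (Vec.map f z) ≡ Vec.map f (swap i z)
swap-map f i       []          = refl
swap-map f zero    (x ∷ [])    = refl
swap-map f zero    (x ∷ y ∷ z) = refl
swap-map f (suc i) (x ∷ z)     = cong (f x ∷_) (swap-map f i z)

swap-zipWith : ∀ {A B C : Set} {d} (f : A → B → C) i (x : Vec A d) (y : Vec B d) →
  swap i (Vec.zipWith f x y) ≡ Vec.zipWith f (swap i x) (swap i y)
swap-zipWith f i       []            []            = refl
swap-zipWith f zero    (x ∷ [])      (y ∷ [])      = refl
swap-zipWith f zero    (x ∷ x′ ∷ xs) (y ∷ y′ ∷ ys) = refl
swap-zipWith f (suc i) (x ∷ xs)      (y ∷ ys)      = cong (f x y ∷_) (swap-zipWith f i xs ys)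

Tie : {d : ℕ} → Vec ℤ d → ℕ → Set
Tie z i = at 0ℤ z (suc i) ≡ at 0ℤ z i

swap-tie : ∀ {d} (z : Vec ℤ d) {i} → suc i < d → Tie z i → swap i z ≡ z
swap-tie (x ∷ [])    {zero}  (s≤s ()) _
swap-tie (x ∷ y ∷ z) {zero}  _   y≡x = cong₂ (λ a b → a ∷ b ∷ z) y≡x (sym y≡x)
swap-tie (x ∷ z)     {suc i} i<d tie = cong (x ∷_) (swap-tie z (s≤s⁻¹ i<d) tie)

-- Adjacent transpositions generate the symmetric group, and the hyperplanes they fix are the walls
-- that bound the chamber.
Antisymmetric : {d : ℕ} → (Vec ℤ d → ℤ) → Set
Antisymmetric {d} F = ∀ i z → suc i < d → F (swap i z) ≡ ℤ.- F z

x≡-x⇒x≡0 : ∀ x → x ≡ ℤ.- x → x ≡ 0ℤ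
x≡-x⇒x≡0 (+ zero) _ = refl

antisymmetric-tie : ∀ {d} {F : Vec ℤ d → ℤ} → Antisymmetric F → ∀ z {i} → suc i < d → Tie z i → F z ≡ 0ℤ
antisymmetric-tie {F = F} anti z {i} i<d tie =
  x≡-x⇒x≡0 (F z) (trans (cong F (sym (swap-tie z i<d tie))) (anti i z i<d))

larger : {d : ℕ} → ℤ → Vec ℤ d → ℕ
larger x []      = 0
larger x (y ∷ z) = χ (x ℤ.<? y) + larger x z

-- All pairs of positions count, not only neighbours, so on `vector π` these are the inversions of
-- `π`. Being defined for any vector, it lets the sign be computed from a point instead of a
-- permutation.
ascents : {d : ℕ} → Vec ℤ d → ℕ
ascents []      = 0
ascents (x ∷ z) = larger x z + ascents z

larger-swap : ∀ {d} x i (z : Vec ℤ d) → larger x (swap i z) ≡ larger x z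
larger-swap x i       []          = refl
larger-swap x zero    (y ∷ [])    = refl
larger-swap x zero    (y ∷ y′ ∷ z) = trans (sym (+-assoc (χ (x ℤ.<? y′)) _ _))
  (trans (cong (_+ larger x z) (+-comm (χ (x ℤ.<? y′)) _)) (+-assoc (χ (x ℤ.<? y)) _ _))
larger-swap x (suc i) (y ∷ z)     = cong (λ k → χ (x ℤ.<? y) + k) (larger-swap x i z)

parity : ℕ → ℤ
parity n = -1ℤ ℤ.^ n

parity-suc : ∀ n → parity (suc n) ≡ ℤ.- parity n
parity-suc n = ℤ.-1*i≡-i (parity n)

parity-+ : ∀ m n → parity (m + n) ≡ parity m ℤ.* parity n
parity-+ m n = ℤ.^-distribˡ-+-* -1ℤ m n

-- Comparisons with a third entry are merely relabelled by an adjacent swap. Only the comparison of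
-- the two exchanged entries changes, and without a tie it flips.
parity-ascents-swap : ∀ {d} (z : Vec ℤ d) {i} → suc i < d → ¬ Tie z i →
  parity (ascents (swap i z)) ≡ ℤ.- parity (ascents z)
parity-ascents-swap (x ∷ z) {suc i} i<d ¬tie = begin
  parity (larger x (swap i z) + ascents (swap i z))
    ≡⟨ cong (λ k → parity (k + ascents (swap i z))) (larger-swap x i z) ⟩
  parity (larger x z + ascents (swap i z))
    ≡⟨ parity-+ (larger x z) _ ⟩
  parity (larger x z) ℤ.* parity (ascents (swap i z))
    ≡⟨ cong (parity (larger x z) ℤ.*_) (parity-ascents-swap z (s≤s⁻¹ i<d) ¬tie) ⟩
  parity (larger x z) ℤ.* ℤ.- parity (ascents z)
    ≡⟨ ℤ.neg-distribʳ-* (parity (larger x z)) _ ⟨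
  ℤ.- (parity (larger x z) ℤ.* parity (ascents z))
    ≡⟨ cong ℤ.-_ (parity-+ (larger x z) _) ⟨
  ℤ.- parity (larger x z + ascents z) ∎
  where open ≡-Reasoning
parity-ascents-swap (x ∷ []) {zero} (s≤s ()) _
parity-ascents-swap (x ∷ y ∷ z) {zero} _ y≢x = go (ℤ.<-cmp x y)
  where
  a = larger x z
  b = larger y z
  c = ascents z
  new old : ℕ
  new = (χ (y ℤ.<? x) + b) + (a + c)
  old = (χ (x ℤ.<? y) + a) + (b + c)
  exchange : b + (a + c) ≡ a + (b + c)
  exchange = trans (sym (+-assoc b a c)) (trans (cong (_+ c) (+-comm b a)) (+-assoc a b c))
  go : _ → parity new ≡ ℤ.- parity old
  go (tri≈ _ x≡y _) = contradiction (sym x≡y) y≢x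
  go (tri< x<y _ y≮x) rewrite χ-yes (x ℤ.<? y) x<y | χ-no (y ℤ.<? x) y≮x =
    trans (sym (ℤ.neg-involutive _)) (cong ℤ.-_ (trans (sym (parity-suc (b + (a + c)))) (cong (parity ∘ suc) exchange)))
  go (tri> x≮y _ y<x) rewrite χ-no (x ℤ.<? y) x≮y | χ-yes (y ℤ.<? x) y<x =
    trans (parity-suc (b + (a + c))) (cong (ℤ.-_ ∘ parity) exchange)

larger-tabulate : ∀ {d} x (h : Fin d → ℤ) → ∑ℤ (allFin d) (λ j → χℤ (x ℤ.<? h j)) ≡ + larger x (Vec.tabulate h)
larger-tabulate {zero}  x h = refl
larger-tabulate {suc d} x h = trans (∑ℤ-suc d (λ j → χℤ (x ℤ.<? h j)))
  (cong (ℤ._+_ (χℤ (x ℤ.<? h Fin.zero))) (larger-tabulate x (h ∘ Fin.suc)))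

ascent? : ∀ {d} (h : Fin d → ℤ) i j → Dec (i Fin.< j × h i ℤ.< h j)
ascent? h i j = (i Fin.<? j) ×-dec (h i ℤ.<? h j)

ascents-tabulate : ∀ {d} (h : Fin d → ℤ) →
  ∑ℤ (allFin d) (λ i → ∑ℤ (allFin d) (λ j → χℤ (ascent? h i j))) ≡ + ascents (Vec.tabulate h)
ascents-tabulate {zero}  h = refl
ascents-tabulate {suc d} h = trans (∑ℤ-suc d (λ i → ∑ℤ (allFin (suc d)) (λ j → χℤ (ascent? h i j)))) (cong₂ ℤ._+_ ascents₀ ascents₊)
  where
  h′ = h ∘ Fin.suc
  ascents₀ : ∑ℤ (allFin (suc d)) (λ j → χℤ (ascent? h Fin.zero j)) ≡ + larger (h Fin.zero) (Vec.tabulate h′)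
  ascents₀ = trans (∑ℤ-suc d (λ j → χℤ (ascent? h Fin.zero j))) (trans (ℤ.+-identityˡ _)
    (trans (∑ℤ-cong (allFin d) λ j _ → cong +_ (χ-cong (ascent? h Fin.zero (Fin.suc j)) (h Fin.zero ℤ.<? h′ j) proj₂ (z<s ,_)))
      (larger-tabulate (h Fin.zero) h′)))
  ascents₊ : ∑ℤ (allFin d) (λ i → ∑ℤ (allFin (suc d)) (λ j → χℤ (ascent? h (Fin.suc i) j))) ≡ + ascents (Vec.tabulate h′)
  ascents₊ = trans (∑ℤ-cong (allFin d) λ i _ → trans (∑ℤ-suc d (λ j → χℤ (ascent? h (Fin.suc i) j))) (trans (ℤ.+-identityˡ _)
      (∑ℤ-cong (allFin d) λ j _ → cong +_ (χ-cong (ascent? h (Fin.suc i) (Fin.suc j)) (ascent? h′ i j)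
        (λ (p , q) → s≤s⁻¹ p , q) (λ (p , q) → s≤s p , q)))))
    (ascents-tabulate h′)

-- The values are negated so that the identity corresponds to a strictly
-- decreasing vector; inversions become ascents.
vector : {d : ℕ} → Permutation′ d → Vec ℤ d
vector π = Vec.tabulate λ i → ℤ.- + toℕ (π ⟨$⟩ʳ i)

sgn-ascents : ∀ {d} (π : Permutation′ d) → sgn π ≡ parity (ascents (vector π))
sgn-ascents {d} π = cong parity (ℤ.+-injective (trans
  (length-filter (λ (i , j) → (i Fin.<? j) ×-dec ((π ⟨$⟩ʳ j) Fin.<? (π ⟨$⟩ʳ i))) (cartesianProduct (allFin d) (allFin d)))
  (trans (∑ℤ-product _,_ (allFin d) (allFin d) _)
    (trans (∑ℤ-cong (allFin d) λ i _ → ∑ℤ-cong (allFin d) λ j _ → cong +_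
      (χ-cong ((i Fin.<? j) ×-dec ((π ⟨$⟩ʳ j) Fin.<? (π ⟨$⟩ʳ i)))
        ((i Fin.<? j) ×-dec ((ℤ.- + toℕ (π ⟨$⟩ʳ i)) ℤ.<? (ℤ.- + toℕ (π ⟨$⟩ʳ j))))
        (λ (p , q) → p , ℤ.neg-mono-< (ℤ.+<+ q)) (λ (p , q) → p , ℤ.drop‿+<+ (ℤ.neg-cancel-< q))))
      (ascents-tabulate (λ i → ℤ.- + toℕ (π ⟨$⟩ʳ i)))))))

_≟ᵛ_ : {d : ℕ} (y z : Vec ℤ d) → Dec (y ≡ z)
_≟ᵛ_ = Vec.≡-dec ℤ._≟_

vector-injective : ∀ {d} (π ρ : Permutation′ d) → vector π ≡ vector ρ → π ≈ ρ
vector-injective π ρ eq i = toℕ-injective (ℤ.+-injective (ℤ.neg-injective (trans (sym (Vec.lookup∘tabulate _ i))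
  (trans (cong (λ v → lookup v i) eq) (Vec.lookup∘tabulate _ i)))))

vector-cong : ∀ {d} (π ρ : Permutation′ d) → π ≈ ρ → vector π ≡ vector ρ
vector-cong π ρ h = Vec.tabulate-cong λ i → cong (λ j → ℤ.- + toℕ j) (h i)

adjacent : (i : ℕ) {d : ℕ} → Permutation′ d
adjacent i       {zero}        = Perm.id
adjacent zero    {suc zero}    = Perm.id
adjacent zero    {suc (suc d)} = Perm.swap Perm.id
adjacent (suc i) {suc d}       = Perm.lift₀ (adjacent i)

tabulate-adjacent : ∀ {A : Set} i {d} (h : Fin d → A) →
  Vec.tabulate (h ∘ (adjacent i ⟨$⟩ʳ_)) ≡ swap i (Vec.tabulate h)
tabulate-adjacent i       {zero}        h = refl
tabulate-adjacent zero    {suc zero}    h = refl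
tabulate-adjacent zero    {suc (suc d)} h = refl
tabulate-adjacent (suc i) {suc d}       h = cong (h Fin.zero ∷_) (tabulate-adjacent i (h ∘ Fin.suc))

-- Membership in the orbit of `vector Perm.id` under permutations of the coordinates. Searching the
-- finite list `perms d` makes it decidable.
Matches : {d : ℕ} → Vec ℤ d → Set
Matches {d} z = Any (λ π → z ≡ vector π) (perms d)

matches : ∀ {d} {z : Vec ℤ d} π → z ≡ vector π → Matches z
matches π z≡ = Any.map (λ {ρ} π≈ρ → trans z≡ (vector-cong π ρ π≈ρ)) (perms-complete π)

matches-swap : ∀ {d} i {z : Vec ℤ d} → Matches z → Matches (swap i z)
matches-swap i m with π , z≡ ← Any.satisfied m =
  matches (adjacent i ∘ₚ π) (trans (cong (swap i) z≡) (sym (tabulate-adjacent i λ j → ℤ.- + toℕ (π ⟨$⟩ʳ j))))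

matches-no-tie : ∀ {d} {z : Vec ℤ d} {i} → suc i < d → Matches z → ¬ Tie z i
matches-no-tie {d} {z} {i} i<d m tie with π , refl ← Any.satisfied m = 1+n≢n (begin
  suc i        ≡⟨ toℕ-fromℕ< i<d ⟨
  toℕ j′       ≡⟨ cong toℕ (Injection.injective (↔⇒↣ π) (toℕ-injective (ℤ.+-injective (ℤ.neg-injective same)))) ⟩
  toℕ j        ≡⟨ toℕ-fromℕ< (<-trans (n<1+n i) i<d) ⟩
  i            ∎)
  where
  open ≡-Reasoning
  j′ = fromℕ< i<d
  j  = fromℕ< (<-trans (n<1+n i) i<d)
  value : ∀ j → at 0ℤ (vector π) (toℕ j) ≡ ℤ.- + toℕ (π ⟨$⟩ʳ j)
  value j = trans (at-toℕ 0ℤ (vector π) j) (Vec.lookup∘tabulate _ j)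
  same : ℤ.- + toℕ (π ⟨$⟩ʳ j′) ≡ ℤ.- + toℕ (π ⟨$⟩ʳ j)
  same = begin
    ℤ.- + toℕ (π ⟨$⟩ʳ j′)          ≡⟨ value j′ ⟨
    at 0ℤ (vector π) (toℕ j′)      ≡⟨ cong (at 0ℤ (vector π)) (toℕ-fromℕ< i<d) ⟩
    at 0ℤ (vector π) (suc i)       ≡⟨ tie ⟩
    at 0ℤ (vector π) i             ≡⟨ cong (at 0ℤ (vector π)) (toℕ-fromℕ< (<-trans (n<1+n i) i<d)) ⟨
    at 0ℤ (vector π) (toℕ j)       ≡⟨ value j ⟩
    ℤ.- + toℕ (π ⟨$⟩ʳ j)           ∎

module _ {A : Set} {P : A → Set} (P? : ∀ x → Dec (P x)) where

  ∑ℤχ-none : ∀ xs → All (¬_ ∘ P) xs → ∑ℤ xs (χℤ ∘ P?) ≡ 0ℤ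
  ∑ℤχ-none []       []         = refl
  ∑ℤχ-none (x ∷ xs) (¬px ∷ ¬p) = cong₂ ℤ._+_ (cong +_ (χ-no (P? x) ¬px)) (∑ℤχ-none xs ¬p)

  ∑ℤχ-one : ∀ xs → AllPairs (λ x y → ¬ (P x × P y)) xs → Any P xs → ∑ℤ xs (χℤ ∘ P?) ≡ 1ℤ
  ∑ℤχ-one (x ∷ xs) (¬pp ∷ _)  (here px)  = cong₂ ℤ._+_ (cong +_ (χ-yes (P? x) px))
    (∑ℤχ-none xs (All.map (λ ¬p py → ¬p (px , py)) ¬pp))
  ∑ℤχ-one (x ∷ xs) (¬pp ∷ ps) (there p∈) = cong₂ ℤ._+_ (cong +_ (χ-no (P? x) λ px →
    let (¬p , py) = All.lookupAny ¬pp p∈ in ¬p (px , py))) (∑ℤχ-one xs ps p∈)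

matchCount : {d : ℕ} → Vec ℤ d → ℤ
matchCount {d} z = ∑ℤ (perms d) (λ π → χℤ (z ≟ᵛ vector π))

matches? : ∀ {d} (z : Vec ℤ d) → Dec (Matches z)
matches? z = Any.any? (λ π → z ≟ᵛ vector π) (perms _)

matchCount-χ : ∀ {d} (z : Vec ℤ d) → matchCount z ≡ χℤ (matches? z)
matchCount-χ {d} z with matches? z
... | yes m = ∑ℤχ-one (λ π → z ≟ᵛ vector π) (perms d) (AllPairs.map
      (λ {π} {ρ} ¬≈ (p , q) → ¬≈ (vector-injective π ρ (trans (sym p) q))) (perms-distinct d)) m
... | no ¬m = ∑ℤχ-none (λ π → z ≟ᵛ vector π) (perms d) (All.¬Any⇒All¬ (perms d) ¬m)

-- The weight in (ii) of a walk whose endpoint, shifted by `vector Perm.id`, is `z`. It appears when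
-- the sum over permutations is moved inside the sum over walks.
signedCount : {d : ℕ} → Vec ℤ d → ℤ
signedCount {d} z = ∑ℤ (perms d) (λ π → sgn π ℤ.* χℤ (z ≟ᵛ vector π))

-- A nonzero term forces `z ≡ vector π`, so its sign can be read from `z` and leaves the sum. What
-- remains is 0 or 1, as distinct permutations have distinct vectors.
signedCount-parity : ∀ {d} (z : Vec ℤ d) → signedCount z ≡ parity (ascents z) ℤ.* χℤ (matches? z)
signedCount-parity {d} z = trans (∑ℤ-cong (perms d) λ π _ → term π (z ≟ᵛ vector π))
  (trans (∑ℤ-* (perms d) (parity (ascents z)) _) (cong (parity (ascents z) ℤ.*_) (matchCount-χ z)))
  where
  term : ∀ π (eq? : Dec (z ≡ vector π)) → sgn π ℤ.* χℤ eq? ≡ parity (ascents z) ℤ.* χℤ eq?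
  term π (yes z≡) = cong (ℤ._* 1ℤ) (trans (sgn-ascents π) (cong (parity ∘ ascents) (sym z≡)))
  term π (no _)   = trans (ℤ.*-zeroʳ (sgn π)) (sym (ℤ.*-zeroʳ (parity (ascents z))))

signedCount-antisymmetric : ∀ {d} → Antisymmetric {d} signedCount
signedCount-antisymmetric i z i<d with at 0ℤ z (suc i) ℤ.≟ at 0ℤ z i
... | yes tie = trans (cong signedCount (swap-tie z i<d tie)) (trans zero′ (cong ℤ.-_ (sym zero′)))
  where
  zero′ : signedCount z ≡ 0ℤ
  zero′ = trans (signedCount-parity z) (trans (cong (λ n → parity (ascents z) ℤ.* + n)
    (χ-no (matches? z) λ m → matches-no-tie i<d m tie)) (ℤ.*-zeroʳ (parity (ascents z))))
... | no ¬tie = begin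
  signedCount (swap i z)
    ≡⟨ signedCount-parity (swap i z) ⟩
  parity (ascents (swap i z)) ℤ.* χℤ (matches? (swap i z))
    ≡⟨ cong₂ ℤ._*_ (parity-ascents-swap z i<d ¬tie) (cong +_ (χ-cong (matches? (swap i z)) (matches? z)
         (λ m → subst Matches (swap-involutive i z) (matches-swap i m)) (matches-swap i))) ⟩
  (ℤ.- parity (ascents z)) ℤ.* χℤ (matches? z)
    ≡⟨ ℤ.neg-distribˡ-* (parity (ascents z)) _ ⟨
  ℤ.- (parity (ascents z) ℤ.* χℤ (matches? z))
    ≡⟨ cong ℤ.-_ (signedCount-parity z) ⟨
  ℤ.- signedCount z ∎
  where open ≡-Reasoning

StrictlyDecreasing : {d : ℕ} → Vec ℤ d → Set
StrictlyDecreasing {d} z = ∀ i → suc i < d → at 0ℤ z (suc i) ℤ.< at 0ℤ z i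

strictlyDecreasing-< : ∀ {d} {z : Vec ℤ d} → StrictlyDecreasing z → ∀ {i j} → i < j → j < d → at 0ℤ z j ℤ.< at 0ℤ z i
strictlyDecreasing-< {z = z} sd {i} {suc j} i<j j<d with m≤n⇒m<n∨m≡n (s≤s⁻¹ i<j)
... | inj₁ i<j′ = ℤ.<-trans (sd j j<d) (strictlyDecreasing-< {z = z} sd i<j′ (<-trans (n<1+n j) j<d))
... | inj₂ refl = sd j j<d

ascents-decreasing : ∀ {d} (z : Vec ℤ d) → StrictlyDecreasing z → ascents z ≡ 0
ascents-decreasing []      sd = refl
ascents-decreasing (x ∷ z) sd = cong₂ _+_
  (larger-none z λ j<d → strictlyDecreasing-< {z = x ∷ z} sd z<s (s≤s j<d))
  (ascents-decreasing z λ i i<d → sd (suc i) (s≤s i<d))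
  where
  larger-none : ∀ {d x} (z : Vec ℤ d) → (∀ {j} → j < d → at 0ℤ z j ℤ.< x) → larger x z ≡ 0
  larger-none         []      h = refl
  larger-none {x = x} (y ∷ z) h = cong₂ _+_ (χ-no (x ℤ.<? y) (ℤ.<-asym (h z<s))) (larger-none z λ j<d → h (s≤s j<d))

-- An increasing self-map of `Fin d` never moves a point down; `π` and its inverse give the two
-- inequalities.
increasing⇒id : ∀ {d} (π : Permutation′ d) → (∀ {i j} → i Fin.< j → (π ⟨$⟩ʳ i) Fin.< (π ⟨$⟩ʳ j)) → π ≈ Perm.id
increasing⇒id π inc i = toℕ-injective (≤-antisym
  (≤-trans (expand (π ⟨$⟩ˡ_) inc⁻¹ (toℕ (π ⟨$⟩ʳ i)) refl) (≤-reflexive (cong toℕ (Perm.inverseˡ π))))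
  (expand (π ⟨$⟩ʳ_) inc (toℕ i) refl))
  where
  inc⁻¹ : ∀ {i j} → i Fin.< j → (π ⟨$⟩ˡ i) Fin.< (π ⟨$⟩ˡ j)
  inc⁻¹ {i} {j} i<j with <-cmp (toℕ (π ⟨$⟩ˡ i)) (toℕ (π ⟨$⟩ˡ j))
  ... | tri< lt _ _ = lt
  ... | tri≈ _ eq _ = contradiction (cong toℕ (trans (sym (Perm.inverseʳ π)) (trans (cong (π ⟨$⟩ʳ_) (toℕ-injective eq)) (Perm.inverseʳ π)))) (<⇒≢ i<j)
  ... | tri> _ _ gt = contradiction (subst₂ Fin._<_ (Perm.inverseʳ π) (Perm.inverseʳ π) (inc gt)) (<-asym i<j)
  expand : ∀ {d} (f : Fin d → Fin d) → (∀ {i j} → i Fin.< j → f i Fin.< f j) → ∀ k {i} → toℕ i ≡ k → k ≤ toℕ (f i)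
  expand f inc zero    _  = z≤n
  expand f inc (suc k) {Fin.suc i} eq = ≤-<-trans (expand f inc k {Fin.inject₁ i} (trans (toℕ-inject₁ i) (cong pred eq)))
    (inc (s≤s (≤-reflexive (toℕ-inject₁ i))))

signedCount-decreasing : ∀ {d} (z : Vec ℤ d) → StrictlyDecreasing z → signedCount z ≡ χℤ (z ≟ᵛ vector Perm.id)
signedCount-decreasing {d} z sd = trans (signedCount-parity z) (trans
  (cong (λ k → parity k ℤ.* χℤ (matches? z)) (ascents-decreasing z sd)) (trans (ℤ.*-identityˡ _)
  (cong +_ (χ-cong (matches? z) (z ≟ᵛ vector Perm.id) to (matches Perm.id)))))
  where
  to : Matches z → z ≡ vector Perm.id
  to m with π , refl ← Any.satisfied m = vector-cong π Perm.id (increasing⇒id π λ {i} {j} i<j →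
    ℤ.drop‿+<+ (ℤ.neg-cancel-< (subst₂ ℤ._<_ (value j) (value i) (strictlyDecreasing-< {z = vector π} sd i<j (toℕ<n j)))))
    where
    value : ∀ j → at 0ℤ (vector π) (toℕ j) ≡ ℤ.- + toℕ (π ⟨$⟩ʳ j)
    value j = trans (at-toℕ 0ℤ (vector π) j) (Vec.lookup∘tabulate _ j)

-- The reflection principle

sequences : {A : Set} (n : ℕ) → List A → List (Vec A n)
sequences zero    xs = [] ∷ []
sequences (suc n) xs = cartesianProductWith _∷_ xs (sequences n xs)

module _ {A : Set} where

  ∈-sequences⁺ : ∀ {n} {xs : List A} {x v} → x ∈ xs → v ∈ sequences n xs → (x ∷ v) ∈ sequences (suc n) xs
  ∈-sequences⁺ = ∈-cartesianProductWith⁺ _∷_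

  ∈-sequences⁻ : ∀ {n} (xs : List A) {x v} → (x ∷ v) ∈ sequences (suc n) xs → x ∈ xs × v ∈ sequences n xs
  ∈-sequences⁻ {n} xs v∈ with _ , _ , x∈ , v∈′ , refl ← ∈-cartesianProductWith⁻ _∷_ xs (sequences n xs) v∈ = x∈ , v∈′

  sequences-unique : ∀ n {xs : List A} → Unique xs → Unique (sequences n xs)
  sequences-unique zero    u = [] ∷ []
  sequences-unique (suc n) u = Unique.cartesianProductWith⁺ _∷_ Vec.∷-injective u (sequences-unique n u)

∑ℤ-sequences-map : ∀ {A B : Set} (f : A → B) n xs G →
  ∑ℤ (sequences n (List.map f xs)) G ≡ ∑ℤ (sequences n xs) (G ∘ Vec.map f)
∑ℤ-sequences-map f zero    xs G = refl
∑ℤ-sequences-map f (suc n) xs G = trans (∑ℤ-product _∷_ (List.map f xs) _ G)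
  (trans (∑ℤ-map f xs _) (trans (∑ℤ-cong xs λ x _ → ∑ℤ-sequences-map f n xs (G ∘ (f x ∷_)))
    (sym (∑ℤ-product _∷_ xs _ (G ∘ Vec.map f)))))

bits : (d r : ℕ) → List (Vec ℕ d)
bits zero    zero    = [] ∷ []
bits zero    (suc r) = []
bits (suc d) zero    = List.map (0 ∷_) (bits d zero)
bits (suc d) (suc r) = List.map (1 ∷_) (bits d r) List.++ List.map (0 ∷_) (bits d (suc r))

∈-bits⁺ : ∀ {d r} (ε : Vec ℕ d) → (∀ c → at 0 ε c ≤ 1) → Vec.sum ε ≡ r → ε ∈ bits d r
∈-bits⁺         []                bit refl = here refl
∈-bits⁺ {r = r} (suc (suc x) ∷ ε) bit sum≡ with s≤s () ← bit 0
∈-bits⁺         (1 ∷ ε)           bit refl = ∈-++⁺ˡ (∈-map⁺ (1 ∷_) (∈-bits⁺ ε (bit ∘ suc) refl))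
∈-bits⁺ {r = zero}  (0 ∷ ε)       bit sum≡ = ∈-map⁺ (0 ∷_) (∈-bits⁺ ε (bit ∘ suc) sum≡)
∈-bits⁺ {suc d} {suc r} (0 ∷ ε)   bit sum≡ = ∈-++⁺ʳ (List.map (1 ∷_) (bits d r)) (∈-map⁺ (0 ∷_) (∈-bits⁺ ε (bit ∘ suc) sum≡))

∈-bits⁻ : ∀ d r {ε : Vec ℕ d} → ε ∈ bits d r → (∀ c → at 0 ε c ≤ 1) × Vec.sum ε ≡ r
∈-bits⁻ zero    zero    {[]} _ = (λ _ → z≤n) , refl
∈-bits⁻ (suc d) zero    ε∈ with ε′ , ε′∈ , refl ← ∈-map⁻ (0 ∷_) ε∈ with bit , sum≡ ← ∈-bits⁻ d zero ε′∈ =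
  (λ { zero → z≤n ; (suc c) → bit c }) , sum≡
∈-bits⁻ (suc d) (suc r) ε∈ with ∈-++⁻ (List.map (1 ∷_) (bits d r)) ε∈
... | inj₁ ε∈₁ with ε′ , ε′∈ , refl ← ∈-map⁻ (1 ∷_) ε∈₁ with bit , sum≡ ← ∈-bits⁻ d r ε′∈ =
  (λ { zero → ≤-refl ; (suc c) → bit c }) , cong suc sum≡
... | inj₂ ε∈₂ with ε′ , ε′∈ , refl ← ∈-map⁻ (0 ∷_) ε∈₂ with bit , sum≡ ← ∈-bits⁻ d (suc r) ε′∈ =
  (λ { zero → z≤n ; (suc c) → bit c }) , sum≡

bits-unique : ∀ d r → Unique (bits d r)
bits-unique zero    zero    = [] ∷ []
bits-unique zero    (suc r) = []
bits-unique (suc d) zero    = Unique.map⁺ Vec.∷-injectiveʳ (bits-unique d zero)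
bits-unique (suc d) (suc r) = Unique.++⁺ (Unique.map⁺ Vec.∷-injectiveʳ (bits-unique d r))
  (Unique.map⁺ Vec.∷-injectiveʳ (bits-unique d (suc r)))
  λ (v∈ , v∈′) → distinct (∈-map⁻ (1 ∷_) v∈) (∈-map⁻ (0 ∷_) v∈′)
  where
  distinct : ∀ {v : Vec ℕ (suc d)} → ∃[ ε ] ε ∈ bits d r × v ≡ 1 ∷ ε → ∃[ ε ] ε ∈ bits d (suc r) × v ≡ 0 ∷ ε → ⊥
  distinct (_ , _ , refl) (_ , _ , ())

∑ℤ-bits : ∀ d r G → ∑ℤ (bits (suc d) (suc r)) G ≡ ∑ℤ (bits d r) (G ∘ (1 ∷_)) ℤ.+ ∑ℤ (bits d (suc r)) (G ∘ (0 ∷_))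
∑ℤ-bits d r G = trans (∑ℤ-++ (List.map (1 ∷_) (bits d r)) G) (cong₂ ℤ._+_ (∑ℤ-map (1 ∷_) (bits d r) G) (∑ℤ-map (0 ∷_) (bits d (suc r)) G))

-- For `i = 0` the first two entries sort the vectors into the classes 11, 10, 01 and 00, of which
-- the swap exchanges the middle two. It reorders the list, so the symmetry is stated for sums.
∑ℤ-bits-swap : ∀ d r i G → ∑ℤ (bits d r) (G ∘ swap i) ≡ ∑ℤ (bits d r) G
∑ℤ-bits-swap zero          r             i       G = ∑ℤ-cong (bits zero r) λ { [] _ → refl }
∑ℤ-bits-swap (suc zero)    r             zero    G = ∑ℤ-cong (bits 1 r) λ { (x ∷ []) _ → refl }
∑ℤ-bits-swap (suc d)       zero          (suc i) G = trans (∑ℤ-map (0 ∷_) (bits d 0) (G ∘ swap (suc i)))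
  (trans (∑ℤ-bits-swap d 0 i (G ∘ (0 ∷_))) (sym (∑ℤ-map (0 ∷_) (bits d 0) G)))
∑ℤ-bits-swap (suc d)       (suc r)       (suc i) G = trans (∑ℤ-bits d r (G ∘ swap (suc i)))
  (trans (cong₂ ℤ._+_ (∑ℤ-bits-swap d r i (G ∘ (1 ∷_))) (∑ℤ-bits-swap d (suc r) i (G ∘ (0 ∷_)))) (sym (∑ℤ-bits d r G)))
∑ℤ-bits-swap (suc (suc d)) zero          zero    G = trans (both (G ∘ swap 0)) (sym (both G))
  where
  both : ∀ G → ∑ℤ (bits (2 + d) 0) G ≡ ∑ℤ (bits d 0) (λ ε → G (0 ∷ 0 ∷ ε))
  both G = trans (∑ℤ-map (0 ∷_) (bits (suc d) 0) G) (∑ℤ-map (0 ∷_) (bits d 0) (G ∘ (0 ∷_)))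
∑ℤ-bits-swap (suc (suc d)) (suc zero)    zero    G =
  trans (all (G ∘ swap 0)) (trans (exchange (part G 0 1 0) (part G 1 0 0) (part G 0 0 1)) (sym (all G)))
  where
  part : (Vec ℕ (2 + d) → ℤ) → ℕ → ℕ → ℕ → ℤ
  part G x y r = ∑ℤ (bits d r) (λ ε → G (x ∷ y ∷ ε))
  all : ∀ G → ∑ℤ (bits (2 + d) 1) G ≡ part G 1 0 0 ℤ.+ (part G 0 1 0 ℤ.+ part G 0 0 1)
  all G = trans (∑ℤ-bits (suc d) 0 G) (cong₂ ℤ._+_ (∑ℤ-map (0 ∷_) (bits d 0) (G ∘ (1 ∷_))) (∑ℤ-bits d 0 (G ∘ (0 ∷_))))
  exchange : ∀ a b c → a ℤ.+ (b ℤ.+ c) ≡ b ℤ.+ (a ℤ.+ c)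
  exchange = solve-∀ℤ
∑ℤ-bits-swap (suc (suc d)) (suc (suc r)) zero    G =
  trans (all (G ∘ swap 0)) (trans (+-interchangeℤ (part G 1 1 r) (part G 0 1 (suc r)) (part G 1 0 (suc r)) (part G 0 0 (2 + r))) (sym (all G)))
  where
  part : (Vec ℕ (2 + d) → ℤ) → ℕ → ℕ → ℕ → ℤ
  part G x y r = ∑ℤ (bits d r) (λ ε → G (x ∷ y ∷ ε))
  all : ∀ G → ∑ℤ (bits (2 + d) (2 + r)) G ≡
    (part G 1 1 r ℤ.+ part G 1 0 (suc r)) ℤ.+ (part G 0 1 (suc r) ℤ.+ part G 0 0 (2 + r))
  all G = trans (∑ℤ-bits (suc d) (suc r) G) (cong₂ ℤ._+_ (∑ℤ-bits d r (G ∘ (1 ∷_))) (∑ℤ-bits d (suc r) (G ∘ (0 ∷_))))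

module _ {d : ℕ} where

  ⊕-assoc : (x y z : Point d) → (x ⊕ y) ⊕ z ≡ x ⊕ (y ⊕ z)
  ⊕-assoc = Vec.zipWith-assoc ℤ.+-assoc

  ⊕-comm : (x y : Point d) → x ⊕ y ≡ y ⊕ x
  ⊕-comm = Vec.zipWith-comm ℤ.+-comm

  ⊕-identityˡ : (x : Point d) → origin ⊕ x ≡ x
  ⊕-identityˡ = Vec.zipWith-identityˡ ℤ.+-identityˡ

  ⊕-identityʳ : (x : Point d) → x ⊕ origin ≡ x
  ⊕-identityʳ = Vec.zipWith-identityʳ ℤ.+-identityʳ

⊖-⊕ : ∀ {d} (x y : Point d) → ⊖ (x ⊕ y) ≡ (⊖ x) ⊕ (⊖ y)
⊖-⊕ []       []       = refl
⊖-⊕ (x ∷ xs) (y ∷ ys) = cong₂ _∷_ (ℤ.neg-distrib-+ x y) (⊖-⊕ xs ys)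

⊖-origin : ∀ d → ⊖ origin {d} ≡ origin
⊖-origin zero    = refl
⊖-origin (suc d) = cong (0ℤ ∷_) (⊖-origin d)

⊖-inverseʳ : ∀ {d} (x : Point d) → x ⊕ (⊖ x) ≡ origin
⊖-inverseʳ []       = refl
⊖-inverseʳ (x ∷ xs) = cong₂ _∷_ (ℤ.+-inverseʳ x) (⊖-inverseʳ xs)

⊕-⊖-cancel : ∀ {d} (x y : Point d) → (x ⊕ y) ⊕ (⊖ y) ≡ x
⊕-⊖-cancel x y = trans (⊕-assoc x y (⊖ y)) (trans (cong (x ⊕_) (⊖-inverseʳ y)) (⊕-identityʳ x))

⊖-⊕-cancel : ∀ {d} (x y : Point d) → (x ⊕ (⊖ y)) ⊕ y ≡ x
⊖-⊕-cancel x y = trans (⊕-assoc x (⊖ y) y) (trans (cong (x ⊕_) (trans (⊕-comm (⊖ y) y) (⊖-inverseʳ y))) (⊕-identityʳ x))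

⊕-cancelˡ : ∀ {d} (x : Point d) {y z} → x ⊕ y ≡ x ⊕ z → y ≡ z
⊕-cancelˡ x {y} {z} eq = trans (sym (⊕-⊖-cancel y x)) (trans (cong (_⊕ (⊖ x)) (trans (⊕-comm y x) (trans eq (⊕-comm x z)))) (⊕-⊖-cancel z x))

at-⊕ : ∀ {d} (x y : Point d) i → at 0ℤ (x ⊕ y) i ≡ at 0ℤ x i ℤ.+ at 0ℤ y i
at-⊕ []       []       i       = refl
at-⊕ (x ∷ xs) (y ∷ ys) zero    = refl
at-⊕ (x ∷ xs) (y ∷ ys) (suc i) = at-⊕ xs ys i

⟦_⟧ : {d : ℕ} → Vec ℕ d → Point d
⟦_⟧ = Vec.map (+_)

at-⟦⟧ : ∀ {d} (ε : Vec ℕ d) i → at 0ℤ ⟦ ε ⟧ i ≡ + at 0 ε i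
at-⟦⟧ []      i       = refl
at-⟦⟧ (x ∷ ε) zero    = refl
at-⟦⟧ (x ∷ ε) (suc i) = at-⟦⟧ ε i

at-⊖ : ∀ {d} (x : Point d) i → at 0ℤ (⊖ x) i ≡ ℤ.- at 0ℤ x i
at-⊖ []       i       = refl
at-⊖ (x ∷ xs) zero    = refl
at-⊖ (x ∷ xs) (suc i) = at-⊖ xs i

strictlyDecreasing? : ∀ {d} (z : Point d) → Dec (StrictlyDecreasing z)
strictlyDecreasing? {d} z = map′ (λ f i i<d → f (<-trans (n<1+n i) i<d) i<d) (λ f {i} _ i<d → f i i<d)
  (allUpTo? (λ i → (suc i <? d) →-dec (at 0ℤ z (suc i) ℤ.<? at 0ℤ z i)) d)

-- The gap between neighbouring coordinates shrinks by at most one, so a positive gap becomes at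
-- worst a tie. This holds for a 0/1 vector and for its negative, however many coordinates move at
-- once.
ShortStep : {d : ℕ} → Point d → Set
ShortStep {d} s = ∀ i → at 0ℤ s (suc i) ℤ.≤ at 0ℤ s i ℤ.+ 1ℤ

-- Hence an antisymmetric function vanishes wherever a step leaves the chamber.
step-to-wall : ∀ {d} {z s : Point d} → StrictlyDecreasing z → ShortStep s →
  StrictlyDecreasing (z ⊕ s) ⊎ (∃[ i ] suc i < d × Tie (z ⊕ s) i)
step-to-wall {d} {z} {s} sd short with anyUpTo? (λ i → (suc i <? d) ×-dec (at 0ℤ (z ⊕ s) (suc i) ℤ.≟ at 0ℤ (z ⊕ s) i)) d
... | yes (i , _ , i<d , tie) = inj₂ (i , i<d , tie)
... | no ¬tie = inj₁ λ i i<d → ℤ.≤∧≢⇒< (weak i i<d) λ tie → ¬tie (i , <-trans (n<1+n i) i<d , i<d , tie)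
  where
  open ℤ.≤-Reasoning
  regroup : ∀ a b → a ℤ.+ (b ℤ.+ 1ℤ) ≡ (1ℤ ℤ.+ a) ℤ.+ b
  regroup = solve-∀ℤ
  weak : ∀ i → suc i < d → at 0ℤ (z ⊕ s) (suc i) ℤ.≤ at 0ℤ (z ⊕ s) i
  weak i i<d = begin
    at 0ℤ (z ⊕ s) (suc i)                         ≡⟨ at-⊕ z s (suc i) ⟩
    at 0ℤ z (suc i) ℤ.+ at 0ℤ s (suc i)           ≤⟨ ℤ.+-monoʳ-≤ (at 0ℤ z (suc i)) (short i) ⟩
    at 0ℤ z (suc i) ℤ.+ (at 0ℤ s i ℤ.+ 1ℤ)        ≡⟨ regroup (at 0ℤ z (suc i)) (at 0ℤ s i) ⟩
    ℤ.suc (at 0ℤ z (suc i)) ℤ.+ at 0ℤ s i         ≤⟨ ℤ.+-monoˡ-≤ (at 0ℤ s i) (ℤ.i<j⇒suc[i]≤j (sd i i<d)) ⟩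
    at 0ℤ z i ℤ.+ at 0ℤ s i                       ≡⟨ at-⊕ z s i ⟨
    at 0ℤ (z ⊕ s) i                               ∎

module _ {d : ℕ} {ε : Vec ℕ d} (bit : ∀ c → at 0 ε c ≤ 1) where

  ⟦⟧-short : ShortStep ⟦ ε ⟧
  ⟦⟧-short i = subst₂ ℤ._≤_ (sym (at-⟦⟧ ε (suc i))) (cong (ℤ._+ 1ℤ) (sym (at-⟦⟧ ε i)))
    (ℤ.+≤+ (≤-trans (bit (suc i)) (m≤n+m 1 (at 0 ε i))))

  ⊖⟦⟧-short : ShortStep (⊖ ⟦ ε ⟧)
  ⊖⟦⟧-short i = subst₂ ℤ._≤_ (sym (trans (at-⊖ ⟦ ε ⟧ (suc i)) (cong ℤ.-_ (at-⟦⟧ ε (suc i)))))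
    (cong (ℤ._+ 1ℤ) (sym (trans (at-⊖ ⟦ ε ⟧ i) (cong ℤ.-_ (at-⟦⟧ ε i)))))
    (ℤ.≤-trans ℤ.neg-≤-pos (below (bit i)))
    where
    below : ∀ {x} → x ≤ 1 → 0ℤ ℤ.≤ ℤ.- + x ℤ.+ 1ℤ
    below {zero}  _       = ℤ.+≤+ z≤n
    below {suc zero} _    = ℤ.+≤+ z≤n
    below {suc (suc _)} (s≤s ())

-- Replacing `ε` by `swap i ε` permutes the summands and makes the swap act on the whole argument of
-- `F`. The map `u` admits both signs of a step, one for each half of a walk.
sum-antisymmetric : ∀ {d} r (u : Vec ℕ d → Point d) → (∀ i ε → swap i (u ε) ≡ u (swap i ε)) →
  ∀ {F} → Antisymmetric F → Antisymmetric (λ z → ∑ℤ (bits d r) (λ ε → F (z ⊕ u ε)))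
sum-antisymmetric {d} r u equivariant {F} anti i z i<d = begin
  ∑ℤ (bits d r) (λ ε → F (swap i z ⊕ u ε))
    ≡⟨ ∑ℤ-bits-swap d r i (λ ε → F (swap i z ⊕ u ε)) ⟨
  ∑ℤ (bits d r) (λ ε → F (swap i z ⊕ u (swap i ε)))
    ≡⟨ ∑ℤ-cong (bits d r) (λ ε _ → cong F (trans (cong (swap i z ⊕_) (sym (equivariant i ε))) (sym (swap-zipWith ℤ._+_ i z (u ε))))) ⟩
  ∑ℤ (bits d r) (λ ε → F (swap i (z ⊕ u ε)))
    ≡⟨ ∑ℤ-cong (bits d r) (λ ε _ → anti i (z ⊕ u ε) i<d) ⟩
  ∑ℤ (bits d r) (λ ε → ℤ.- F (z ⊕ u ε))
    ≡⟨ ∑ℤ-neg (bits d r) _ ⟩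
  ℤ.- ∑ℤ (bits d r) (λ ε → F (z ⊕ u ε)) ∎
  where open ≡-Reasoning

displacement : ∀ {n d} → Vec (Vec ℕ d) n → Point d
displacement []      = origin
displacement (ε ∷ A) = displacement A ⊕ ⟦ ε ⟧

-- Shifting by ρ turns weakly decreasing vectors into strictly decreasing ones, so
-- that the walls become the fixed points of the coordinate swaps.
ρ : (d : ℕ) → Point d
ρ d = vector {d} Perm.id

position : ∀ {n d} → Vec (Vec ℕ d) n → Point d
position {d = d} A = ρ d ⊕ displacement A

position-∷ : ∀ {n d} (ε : Vec ℕ d) (A : Vec (Vec ℕ d) n) → position (ε ∷ A) ≡ position A ⊕ ⟦ ε ⟧
position-∷ ε A = sym (⊕-assoc _ (displacement A) ⟦ ε ⟧)

-- Only the ends of blocks are tested, since a block is one step. The base case is trivial because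
-- the starting point `ρ` lies in the chamber.
InChamber : ∀ {n d} → Vec (Vec ℕ d) n → Set
InChamber []      = ⊤
InChamber (ε ∷ A) = InChamber A × StrictlyDecreasing (position (ε ∷ A))

inChamber? : ∀ {n d} (A : Vec (Vec ℕ d) n) → Dec (InChamber A)
inChamber? []      = yes tt
inChamber? (ε ∷ A) = inChamber? A ×-dec strictlyDecreasing? (position (ε ∷ A))

at-ρ : ∀ d {i} → i < d → at 0ℤ (ρ d) i ≡ ℤ.- + i
at-ρ d i<d = at-tab 0ℤ (λ i → ℤ.- + i) i<d

ρ-decreasing : ∀ d → StrictlyDecreasing (ρ d)
ρ-decreasing d i i<d = subst₂ ℤ._<_ (sym (at-ρ d i<d)) (sym (at-ρ d (<-trans (n<1+n i) i<d))) (ℤ.neg-mono-< (ℤ.+<+ (n<1+n i)))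

inChamber-position : ∀ {n d} (A : Vec (Vec ℕ d) n) → InChamber A → StrictlyDecreasing (position A)
inChamber-position {d = d} [] _ = subst StrictlyDecreasing (sym (⊕-identityʳ (ρ d))) (ρ-decreasing d)
inChamber-position (ε ∷ A) (_ , sd) = sd

module _ (d r : ℕ) where

  private
    K = bits d r
    steps′ : ∀ n → List (Vec (Vec ℕ d) n)
    steps′ n = sequences n K

  -- The head of the vector is the last step. Summing over it turns `F` into another antisymmetric
  -- function, to which the induction hypothesis applies; the terms whose last step leaves the
  -- chamber then end on a wall and vanish.
  ∑ℤ-inChamber : ∀ n {F} → Antisymmetric F →
    ∑ℤ (steps′ n) (F ∘ position) ≡ ∑ℤ (steps′ n) (λ A → χℤ (inChamber? A) ℤ.* F (position A))
  ∑ℤ-inChamber zero    {F} anti = cong (ℤ._+ 0ℤ) (sym (ℤ.*-identityˡ (F (position {d = d} []))))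
  ∑ℤ-inChamber (suc n) {F} anti = begin
    ∑ℤ (steps′ (suc n)) (F ∘ position)
      ≡⟨ ∑ℤ-product _∷_ K (steps′ n) (F ∘ position) ⟩
    ∑ℤ K (λ ε → ∑ℤ (steps′ n) (λ A → F (position (ε ∷ A))))
      ≡⟨ ∑ℤ-swap K (steps′ n) (λ ε A → F (position (ε ∷ A))) ⟩
    ∑ℤ (steps′ n) (λ A → ∑ℤ K (λ ε → F (position (ε ∷ A))))
      ≡⟨ ∑ℤ-cong (steps′ n) (λ A _ → ∑ℤ-cong K λ ε _ → cong F (position-∷ ε A)) ⟩
    ∑ℤ (steps′ n) (λ A → ∑ℤ K (λ ε → F (position A ⊕ ⟦ ε ⟧)))
      ≡⟨ ∑ℤ-inChamber n (sum-antisymmetric r ⟦_⟧ (swap-map (+_)) anti) ⟩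
    ∑ℤ (steps′ n) (λ A → χℤ (inChamber? A) ℤ.* ∑ℤ K (λ ε → F (position A ⊕ ⟦ ε ⟧)))
      ≡⟨ ∑ℤ-cong (steps′ n) (λ A _ → ∑ℤ-* K (χℤ (inChamber? A)) _) ⟨
    ∑ℤ (steps′ n) (λ A → ∑ℤ K (λ ε → χℤ (inChamber? A) ℤ.* F (position A ⊕ ⟦ ε ⟧)))
      ≡⟨ ∑ℤ-cong (steps′ n) (λ A _ → ∑ℤ-cong K λ ε ε∈ → term A ε ε∈ (inChamber? A) (strictlyDecreasing? (position (ε ∷ A)))) ⟩
    ∑ℤ (steps′ n) (λ A → ∑ℤ K (λ ε → χℤ (inChamber? (ε ∷ A)) ℤ.* F (position (ε ∷ A))))
      ≡⟨ ∑ℤ-swap K (steps′ n) (λ ε A → χℤ (inChamber? (ε ∷ A)) ℤ.* F (position (ε ∷ A))) ⟨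
    ∑ℤ K (λ ε → ∑ℤ (steps′ n) (λ A → χℤ (inChamber? (ε ∷ A)) ℤ.* F (position (ε ∷ A))))
      ≡⟨ ∑ℤ-product _∷_ K (steps′ n) (λ A → χℤ (inChamber? A) ℤ.* F (position A)) ⟨
    ∑ℤ (steps′ (suc n)) (λ A → χℤ (inChamber? A) ℤ.* F (position A)) ∎
    where
    open ≡-Reasoning
    term : ∀ A ε → ε ∈ K → (A? : Dec (InChamber A)) (sd? : Dec (StrictlyDecreasing (position (ε ∷ A)))) →
      χℤ A? ℤ.* F (position A ⊕ ⟦ ε ⟧) ≡ χℤ (A? ×-dec sd?) ℤ.* F (position (ε ∷ A))
    term A ε ε∈ (no _)  sd?      = refl
    term A ε ε∈ (yes _) (yes _)  = cong (λ z → 1ℤ ℤ.* F z) (sym (position-∷ ε A))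
    term A ε ε∈ (yes inA) (no ¬sd)
      with step-to-wall {z = position A} (inChamber-position A inA) (⟦⟧-short {ε = ε} (proj₁ (∈-bits⁻ d r ε∈)))
    ... | inj₁ sd = contradiction (subst StrictlyDecreasing (sym (position-∷ ε A)) sd) ¬sd
    ... | inj₂ (i , i<d , tie) = trans (cong (1ℤ ℤ.*_) (antisymmetric-tie anti (position A ⊕ ⟦ ε ⟧) i<d tie)) refl

  -- The total weight of all second halves of walks that start at `z`. As a function of the point
  -- alone it can be antisymmetric, and so serve as `F` for the first half.
  descend : ℕ → Point d → ℤ
  descend zero    z = signedCount z
  descend (suc n) z = ∑ℤ K (λ ε → descend n (z ⊕ (⊖ ⟦ ε ⟧)))

  descend-antisymmetric : ∀ n → Antisymmetric (descend n)
  descend-antisymmetric zero    = signedCount-antisymmetric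
  descend-antisymmetric (suc n) = sum-antisymmetric r (λ ε → ⊖ ⟦ ε ⟧)
    (λ i ε → trans (swap-map _ i ⟦ ε ⟧) (cong ⊖_ (swap-map (+_) i ε))) (descend-antisymmetric n)

  ∑ℤ-descend : ∀ n z → ∑ℤ (steps′ n) (λ B → signedCount (z ⊕ (⊖ displacement B))) ≡ descend n z
  ∑ℤ-descend zero    z = trans (ℤ.+-identityʳ _) (cong signedCount (trans (cong (z ⊕_) (⊖-origin d)) (⊕-identityʳ z)))
  ∑ℤ-descend (suc n) z = trans (∑ℤ-product _∷_ K (steps′ n) _) (∑ℤ-cong K λ ε _ →
    trans (∑ℤ-cong (steps′ n) λ B _ → cong signedCount (regroup ε B)) (∑ℤ-descend n (z ⊕ (⊖ ⟦ ε ⟧))))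
    where
    regroup : ∀ ε (B : Vec (Vec ℕ d) n) → z ⊕ (⊖ (displacement B ⊕ ⟦ ε ⟧)) ≡ (z ⊕ (⊖ ⟦ ε ⟧)) ⊕ (⊖ displacement B)
    regroup ε B = trans (cong (λ x → z ⊕ (⊖ x)) (⊕-comm (displacement B) ⟦ ε ⟧))
      (trans (cong (z ⊕_) (⊖-⊕ ⟦ ε ⟧ (displacement B))) (sym (⊕-assoc z (⊖ ⟦ ε ⟧) (⊖ displacement B))))

  -- The first step down from `z` undoes the head of `B`, its last step, so the descent visits the
  -- positions of the tails of `B` and is tested by `InChamber`. At the bottom
  -- `signedCount-decreasing` admits only `ρ`.
  descend-inChamber : ∀ n {z} → StrictlyDecreasing z →
    descend n z ≡ ∑ℤ (steps′ n) (λ B → χℤ (inChamber? B ×-dec (z ≟ᵛ position B)))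
  descend-inChamber zero    {z} sd = trans (signedCount-decreasing z sd) (trans (cong +_
    (χ-cong (z ≟ᵛ ρ d) (yes tt ×-dec (z ≟ᵛ position {d = d} []))
      (λ eq → tt , trans eq (sym (⊕-identityʳ (ρ d)))) (λ (_ , eq) → trans eq (⊕-identityʳ (ρ d)))))
    (sym (ℤ.+-identityʳ _)))
  descend-inChamber (suc n) {z} sd = trans (∑ℤ-cong K each) (sym (∑ℤ-product _∷_ K (steps′ n) _))
    where
    each : ∀ ε → ε ∈ K → descend n (z ⊕ (⊖ ⟦ ε ⟧)) ≡ ∑ℤ (steps′ n) (λ B → χℤ (inChamber? (ε ∷ B) ×-dec (z ≟ᵛ position (ε ∷ B))))
    each ε ε∈ with step-to-wall {z = z} {⊖ ⟦ ε ⟧} sd (⊖⟦⟧-short {ε = ε} (proj₁ (∈-bits⁻ d r ε∈)))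
    ... | inj₁ sd′ = trans (descend-inChamber n sd′) (∑ℤ-cong (steps′ n) λ B _ → cong +_
      (χ-cong (inChamber? B ×-dec ((z ⊕ (⊖ ⟦ ε ⟧)) ≟ᵛ position B)) (inChamber? (ε ∷ B) ×-dec (z ≟ᵛ position (ε ∷ B)))
        (λ (inB , eq) → let eq′ = trans (sym (⊖-⊕-cancel z ⟦ ε ⟧)) (trans (cong (_⊕ ⟦ ε ⟧) eq) (sym (position-∷ ε B))) in
          (inB , subst StrictlyDecreasing eq′ sd) , eq′)
        (λ ((inB , _) , eq) → inB , trans (cong (_⊕ (⊖ ⟦ ε ⟧)) (trans eq (position-∷ ε B))) (⊕-⊖-cancel (position B) ⟦ ε ⟧))))
    -- On a wall the left side vanishes by antisymmetry, the right side because no chain in the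
    -- chamber has its position on a wall.
    ... | inj₂ (i , i<d , tie) = trans (antisymmetric-tie (descend-antisymmetric n) (z ⊕ (⊖ ⟦ ε ⟧)) i<d tie)
      (trans (sym (∑ℤ-zero (steps′ n))) (∑ℤ-cong (steps′ n) λ B _ → sym (cong +_
        (χ-no (inChamber? (ε ∷ B) ×-dec (z ≟ᵛ position (ε ∷ B))) λ ((inB , _) , eq) →
          ℤ.<-irrefl (subst (λ z → Tie z i) (trans (cong (_⊕ (⊖ ⟦ ε ⟧)) (trans eq (position-∷ ε B))) (⊕-⊖-cancel (position B) ⟦ ε ⟧)) tie)
            (inChamber-position B inB i i<d)))))

  PairInChamber : ∀ {n} → Vec (Vec ℕ d) n × Vec (Vec ℕ d) n → Set
  PairInChamber (A , B) = InChamber A × InChamber B × position A ≡ position B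

  pairInChamber? : ∀ {n} (p : Vec (Vec ℕ d) n × Vec (Vec ℕ d) n) → Dec (PairInChamber p)
  pairInChamber? (A , B) = inChamber? A ×-dec (inChamber? B ×-dec (position A ≟ᵛ position B))

  reflection : ∀ n → ∑ℤ (steps′ n) (λ A → ∑ℤ (steps′ n) (λ B → signedCount (position A ⊕ (⊖ displacement B)))) ≡
    + length (filter pairInChamber? (cartesianProduct (steps′ n) (steps′ n)))
  reflection n = begin
    ∑ℤ (steps′ n) (λ A → ∑ℤ (steps′ n) (λ B → signedCount (position A ⊕ (⊖ displacement B))))
      ≡⟨ ∑ℤ-cong (steps′ n) (λ A _ → ∑ℤ-descend n (position A)) ⟩
    ∑ℤ (steps′ n) (descend n ∘ position)
      ≡⟨ ∑ℤ-inChamber n (descend-antisymmetric n) ⟩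
    ∑ℤ (steps′ n) (λ A → χℤ (inChamber? A) ℤ.* descend n (position A))
      ≡⟨ ∑ℤ-cong (steps′ n) (λ A _ → term A (inChamber? A)) ⟩
    ∑ℤ (steps′ n) (λ A → ∑ℤ (steps′ n) (λ B → χℤ (pairInChamber? (A , B))))
      ≡⟨ ∑ℤ-product _,_ (steps′ n) (steps′ n) (χℤ ∘ pairInChamber?) ⟨
    ∑ℤ (cartesianProduct (steps′ n) (steps′ n)) (χℤ ∘ pairInChamber?)
      ≡⟨ length-filter pairInChamber? (cartesianProduct (steps′ n) (steps′ n)) ⟨
    + length (filter pairInChamber? (cartesianProduct (steps′ n) (steps′ n))) ∎
    where
    open ≡-Reasoning
    term : ∀ A (A? : Dec (InChamber A)) → χℤ A? ℤ.* descend n (position A) ≡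
      ∑ℤ (steps′ n) (λ B → χℤ (A? ×-dec (inChamber? B ×-dec (position A ≟ᵛ position B))))
    term A (no _)    = sym (∑ℤ-zero (steps′ n))
    term A (yes inA) = trans (ℤ.*-identityˡ _) (trans (descend-inChamber n (inChamber-position A inA))
      (∑ℤ-cong (steps′ n) λ B _ → cong +_ (χ-cong _ _ (inA ,_) proj₂)))

-- Walks

hasCard-filter : ∀ {A : Set} {P : A → Set} (P? : ∀ x → Dec (P x)) {xs} → Unique xs →
  HasCard (λ x → x ∈ xs × P x) (length (filter P? xs))
hasCard-filter P? {xs} u = filter P? xs , Unique.filter⁺ P? u ,
  (λ x → mk⇔ (∈-filter⁻ P?) (λ (x∈ , px) → ∈-filter⁺ P? x∈ px)) , refl

hasCard-map : ∀ {A B : Set} {P : A → Set} {Q : B → Set} {N} (f : A → B) → HasCard P N →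
  (∀ {x} → P x → Q (f x)) → (∀ {x y} → P x → P y → f x ≡ f y → x ≡ y) →
  (∀ {y} → Q y → ∃[ x ] P x × f x ≡ y) → HasCard Q N
hasCard-map {P = P} {Q} f (xs , u , xs⇔P , refl) into injective onto =
  List.map f xs , unique u (All.tabulate λ {x} x∈ → Equivalence.to (xs⇔P x) x∈) ,
  (λ y → mk⇔ (to y) from) , List.length-map f xs
  where
  unique : ∀ {xs} → Unique xs → All P xs → Unique (List.map f xs)
  unique []       []         = []
  unique (x∉ ∷ u) (px ∷ pxs) = All.map⁺ (All.zipWith (λ (x≢y , py) fx≡fy → x≢y (injective px py fx≡fy)) (x∉ , pxs)) ∷ unique u pxs
  to : ∀ y → y ∈ List.map f xs → Q y
  to y y∈ with x , x∈ , refl ← ∈-map⁻ f y∈ = into (Equivalence.to (xs⇔P x) x∈)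
  from : ∀ {y} → Q y → y ∈ List.map f xs
  from qy with x , px , refl ← onto qy = ∈-map⁺ f (Equivalence.from (xs⇔P x) px)

-- The clauses mirror those of `bits`, so that `content` carries one list to the other in the same
-- order and sums are transferred by rewriting.
combs : (d r : ℕ) → List (Vec (Fin d) r)
combs zero    zero    = [] ∷ []
combs zero    (suc r) = []
combs (suc d) zero    = List.map (Vec.map Fin.suc) (combs d zero)
combs (suc d) (suc r) = List.map (λ xs → Fin.zero ∷ Vec.map Fin.suc xs) (combs d r)
  List.++ List.map (Vec.map Fin.suc) (combs d (suc r))

content : ∀ {d r} → Vec (Fin d) r → Vec ℕ d
content []       = Vec.replicate _ 0
content (x ∷ xs) = content xs Vec.[ x ]%= suc

content-suc : ∀ {d r} (xs : Vec (Fin d) r) → content (Vec.map Fin.suc xs) ≡ 0 ∷ content xs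
content-suc []       = refl
content-suc (x ∷ xs) = cong (Vec._[ Fin.suc x ]%= suc) (content-suc xs)

bits-content : ∀ d r → List.map content (combs d r) ≡ bits d r
bits-content zero    zero    = refl
bits-content zero    (suc r) = refl
bits-content (suc d) zero    = begin
  List.map content (List.map (Vec.map Fin.suc) (combs d 0))   ≡⟨ List.map-∘ (combs d 0) ⟨
  List.map (content ∘ Vec.map Fin.suc) (combs d 0)            ≡⟨ List.map-cong content-suc (combs d 0) ⟩
  List.map ((0 ∷_) ∘ content) (combs d 0)                     ≡⟨ List.map-∘ (combs d 0) ⟩
  List.map (0 ∷_) (List.map content (combs d 0))              ≡⟨ cong (List.map (0 ∷_)) (bits-content d 0) ⟩
  List.map (0 ∷_) (bits d 0)                                  ∎
  where open ≡-Reasoning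
bits-content (suc d) (suc r) = trans (List.map-++ content (List.map (λ xs → Fin.zero ∷ Vec.map Fin.suc xs) (combs d r)) _)
  (cong₂ List._++_
    (begin
      List.map content (List.map (λ xs → Fin.zero ∷ Vec.map Fin.suc xs) (combs d r))   ≡⟨ List.map-∘ (combs d r) ⟨
      List.map (λ xs → content (Fin.zero ∷ Vec.map Fin.suc xs)) (combs d r)
        ≡⟨ List.map-cong (λ xs → cong (Vec._[ Fin.zero ]%= suc) (content-suc xs)) (combs d r) ⟩
      List.map ((1 ∷_) ∘ content) (combs d r)                                          ≡⟨ List.map-∘ (combs d r) ⟩
      List.map (1 ∷_) (List.map content (combs d r))                                   ≡⟨ cong (List.map (1 ∷_)) (bits-content d r) ⟩
      List.map (1 ∷_) (bits d r)                                                       ∎)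
    (begin
      List.map content (List.map (Vec.map Fin.suc) (combs d (suc r)))   ≡⟨ List.map-∘ (combs d (suc r)) ⟨
      List.map (content ∘ Vec.map Fin.suc) (combs d (suc r))            ≡⟨ List.map-cong content-suc (combs d (suc r)) ⟩
      List.map ((0 ∷_) ∘ content) (combs d (suc r))                     ≡⟨ List.map-∘ (combs d (suc r)) ⟩
      List.map (0 ∷_) (List.map content (combs d (suc r)))              ≡⟨ cong (List.map (0 ∷_)) (bits-content d (suc r)) ⟩
      List.map (0 ∷_) (bits d (suc r))                                  ∎))
  where open ≡-Reasoning

map-suc-injective : ∀ {d r} {xs ys : Vec (Fin d) r} → Vec.map Fin.suc xs ≡ Vec.map Fin.suc ys → xs ≡ ys
map-suc-injective {xs = []}     {[]}     _  = refl
map-suc-injective {xs = x ∷ xs} {y ∷ ys} eq with refl ← Vec.∷-injectiveˡ eq = cong (x ∷_) (map-suc-injective (Vec.∷-injectiveʳ eq))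

combs-unique : ∀ d r → Unique (combs d r)
combs-unique zero    zero    = [] ∷ []
combs-unique zero    (suc r) = []
combs-unique (suc d) zero    = Unique.map⁺ map-suc-injective (combs-unique d zero)
combs-unique (suc d) (suc r) = Unique.++⁺ (Unique.map⁺ (map-suc-injective ∘ Vec.∷-injectiveʳ) (combs-unique d r))
  (Unique.map⁺ map-suc-injective (combs-unique d (suc r)))
  λ (v∈ , v∈′) → distinct (∈-map⁻ _ v∈) (∈-map⁻ _ v∈′)
  where
  distinct : ∀ {v} → ∃[ xs ] xs ∈ combs d r × v ≡ Fin.zero ∷ Vec.map Fin.suc xs →
    ∃[ ys ] ys ∈ combs d (suc r) × v ≡ Vec.map Fin.suc ys → ⊥
  distinct (_ , _ , refl) (y ∷ ys , _ , ())

Increasing : ∀ {d r} → Vec (Fin d) r → Set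
Increasing {r = r} xs = (s t : Fin r) → s Fin.< t → lookup xs s Fin.< lookup xs t

unsuc : ∀ {d r} (xs : Vec (Fin (suc d)) r) → (∀ s → Fin.zero {d} Fin.< lookup xs s) → ∃[ ys ] xs ≡ Vec.map Fin.suc ys
unsuc []               h = [] , refl
unsuc (Fin.zero ∷ xs)  h with () ← h Fin.zero
unsuc (Fin.suc x ∷ xs) h with ys , refl ← unsuc xs (h ∘ Fin.suc) = x ∷ ys , refl

increasing-unsuc : ∀ {d r} (ys : Vec (Fin d) r) → Increasing (Vec.map Fin.suc ys) → Increasing ys
increasing-unsuc ys inc s t s<t = s≤s⁻¹ (subst₂ Fin._<_ (Vec.lookup-map s Fin.suc ys) (Vec.lookup-map t Fin.suc ys) (inc s t s<t))

increasing-suc : ∀ {d r} (ys : Vec (Fin d) r) → Increasing ys → Increasing (Vec.map Fin.suc ys)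
increasing-suc ys inc s t s<t = subst₂ Fin._<_ (sym (Vec.lookup-map s Fin.suc ys)) (sym (Vec.lookup-map t Fin.suc ys)) (s≤s (inc s t s<t))

∈-combs⁺ : ∀ d {r} (xs : Vec (Fin d) r) → Increasing xs → xs ∈ combs d r
∈-combs⁺ zero    []       inc = here refl
∈-combs⁺ (suc d) []       inc = ∈-map⁺ (Vec.map Fin.suc) (∈-combs⁺ d [] λ ())
∈-combs⁺ (suc d) (Fin.zero ∷ xs) inc with ys , refl ← unsuc xs (λ s → inc Fin.zero (Fin.suc s) z<s) =
  ∈-++⁺ˡ (∈-map⁺ (λ xs → Fin.zero ∷ Vec.map Fin.suc xs) (∈-combs⁺ d ys (increasing-unsuc ys λ s t s<t → inc (Fin.suc s) (Fin.suc t) (s≤s s<t))))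
∈-combs⁺ (suc d) {suc r} (Fin.suc x ∷ xs) inc with ys , refl ← unsuc xs (λ s → ≤-<-trans z≤n (inc Fin.zero (Fin.suc s) z<s)) =
  ∈-++⁺ʳ (List.map (λ xs → Fin.zero ∷ Vec.map Fin.suc xs) (combs d r)) (∈-map⁺ (Vec.map Fin.suc) (∈-combs⁺ d (x ∷ ys) (increasing-unsuc (x ∷ ys) inc)))

∈-combs⁻ : ∀ d r {xs : Vec (Fin d) r} → xs ∈ combs d r → Increasing xs
∈-combs⁻ zero    zero    _   = λ ()
∈-combs⁻ (suc d) zero    _   = λ ()
∈-combs⁻ (suc d) (suc r) xs∈ with ∈-++⁻ (List.map (λ xs → Fin.zero ∷ Vec.map Fin.suc xs) (combs d r)) xs∈
... | inj₂ xs∈₂ with ys , ys∈ , refl ← ∈-map⁻ (Vec.map Fin.suc) xs∈₂ = increasing-suc ys (∈-combs⁻ d (suc r) ys∈)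
... | inj₁ xs∈₁ with ys , ys∈ , refl ← ∈-map⁻ (λ xs → Fin.zero ∷ Vec.map Fin.suc xs) xs∈₁ = inc
  where
  inc : Increasing (Fin.zero ∷ Vec.map Fin.suc ys)
  inc Fin.zero    (Fin.suc t) _   = subst (Fin.zero {d} Fin.<_) (sym (Vec.lookup-map t Fin.suc ys)) z<s
  inc (Fin.suc s) (Fin.suc t) s<t = increasing-suc ys (∈-combs⁻ d r ys∈) s t (s≤s⁻¹ s<t)

consecutive⇒increasing : ∀ {d r} (xs : Vec (Fin d) r) →
  (∀ s t → toℕ t ≡ suc (toℕ s) → lookup xs s Fin.< lookup xs t) → Increasing xs
consecutive⇒increasing {r = r} xs step s t = go (toℕ t) t refl
  where
  go : ∀ k t → toℕ t ≡ k → toℕ s < k → lookup xs s Fin.< lookup xs t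
  go (suc k) t t≡ s<k with m≤n⇒m<n∨m≡n (s≤s⁻¹ s<k)
  ... | inj₂ s≡k = step s t (trans t≡ (cong suc (sym s≡k)))
  ... | inj₁ s<k′ = <-trans (go k t′ (toℕ-fromℕ< k<r) s<k′) (step t′ t (trans t≡ (cong suc (sym (toℕ-fromℕ< k<r)))))
    where
    k<r : k < r
    k<r = <-trans (≤-reflexive (sym t≡)) (toℕ<n t)
    t′ = fromℕ< k<r

∈-sequences-lookup⁺ : ∀ {A : Set} {n} {xs : List A} (v : Vec A n) → (∀ i → lookup v i ∈ xs) → v ∈ sequences n xs
∈-sequences-lookup⁺ []      h = here refl
∈-sequences-lookup⁺ (x ∷ v) h = ∈-sequences⁺ (h Fin.zero) (∈-sequences-lookup⁺ v (h ∘ Fin.suc))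

∈-sequences-lookup⁻ : ∀ {A : Set} {n} {xs : List A} (v : Vec A n) → v ∈ sequences n xs → ∀ i → lookup v i ∈ xs
∈-sequences-lookup⁻ {xs = xs} (x ∷ v) v∈ Fin.zero    = proj₁ (∈-sequences⁻ xs v∈)
∈-sequences-lookup⁻ {xs = xs} (x ∷ v) v∈ (Fin.suc i) = ∈-sequences-lookup⁻ v (proj₂ (∈-sequences⁻ xs v∈)) i

concat-injective : ∀ {A : Set} {m n} (xs ys : Vec (Vec A m) n) → Vec.concat xs ≡ Vec.concat ys → xs ≡ ys
concat-injective []       []       _  = refl
concat-injective (x ∷ xs) (y ∷ ys) eq = cong₂ _∷_ (Vec.++-injectiveˡ x y eq) (concat-injective xs ys (Vec.++-injectiveʳ x y eq))

module _ (n r d : ℕ) where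

  blockWords : List (Vec (Vec (Fin d) r) n)
  blockWords = sequences n (combs d r)

  blockAscending⁺ : ∀ X → X ∈ blockWords → BlockAscending n r (Vec.concat X)
  blockAscending⁺ X X∈ i s t t≡ = subst₂ Fin._<_ (sym (Vec.lookup-concat X i s)) (sym (Vec.lookup-concat X i t))
    (∈-combs⁻ d r (∈-sequences-lookup⁻ X X∈ i) s t (≤-reflexive (sym t≡)))

  blockAscending⁻ : ∀ X → BlockAscending n r (Vec.concat X) → X ∈ blockWords
  blockAscending⁻ X asc = ∈-sequences-lookup⁺ X λ i → ∈-combs⁺ d (lookup X i) (consecutive⇒increasing (lookup X i)
    λ s t t≡ → subst₂ Fin._<_ (Vec.lookup-concat X i s) (Vec.lookup-concat X i t) (asc i s t t≡))

  walk : Vec (Vec (Fin d) r) n × Vec (Vec (Fin d) r) n → Walk d (n * r)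
  walk (X , Y) = Vec.concat X , Vec.concat Y

  endsAt? : ∀ P X → Dec (endpoint (walk X) ≡ P)
  endsAt? P X = endpoint (walk X) ≟ᵛ P

  walkCount : Permutation′ d → ℕ
  walkCount π = length (filter (endsAt? T⟨ π ⟩) (cartesianProduct blockWords blockWords))

  walks-hasCard : ∀ π → HasCard (Ŵ′ n r T⟨ π ⟩) (walkCount π)
  walks-hasCard π = hasCard-map walk (hasCard-filter (endsAt? T⟨ π ⟩) (Unique.cartesianProduct⁺ u u))
    (λ {(X , Y)} (XY∈ , end) → let (X∈ , Y∈) = ∈-cartesianProduct⁻ blockWords blockWords XY∈ in
      end , blockAscending⁺ X X∈ , blockAscending⁺ Y Y∈)
    (λ {(X , Y)} {(X′ , Y′)} _ _ eq → cong₂ _,_ (concat-injective X X′ (cong proj₁ eq)) (concat-injective Y Y′ (cong proj₂ eq)))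
    onto
    where
    u = sequences-unique n (combs-unique d r)
    onto : ∀ {w} → Ŵ′ n r T⟨ π ⟩ w →
      ∃[ X ] (X ∈ cartesianProduct blockWords blockWords × endpoint (walk X) ≡ T⟨ π ⟩) × walk X ≡ w
    onto {a , b} (end , ascA , ascB) with X , refl ← Vec.group n r a | Y , refl ← Vec.group n r b =
      (X , Y) , (∈-cartesianProduct⁺ (blockAscending⁻ X ascA) (blockAscending⁻ Y ascB) , end) , refl

-- Endpoints of walks

vsum : ∀ {d k} → Vec (Point d) k → Point d
vsum []       = origin
vsum (x ∷ xs) = x ⊕ vsum xs

module _ {d : ℕ} where

  foldl-vsum : ∀ {k} (p : Point d) (xs : Vec (Point d) k) → Vec.foldl′ _⊕_ p xs ≡ p ⊕ vsum xs
  foldl-vsum p []       = sym (⊕-identityʳ p)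
  foldl-vsum p (x ∷ xs) = trans (foldl-vsum (p ⊕ x) xs) (⊕-assoc p x (vsum xs))

  vsum-++ : ∀ {k l} (xs : Vec (Point d) k) (ys : Vec (Point d) l) → vsum (xs Vec.++ ys) ≡ vsum xs ⊕ vsum ys
  vsum-++ []       ys = sym (⊕-identityˡ (vsum ys))
  vsum-++ (x ∷ xs) ys = trans (cong (x ⊕_) (vsum-++ xs ys)) (sym (⊕-assoc x (vsum xs) (vsum ys)))

  vsum-⊖ : ∀ {k} (a : Vec (Fin d) k) → vsum (Vec.map (⊖_ ∘ e) a) ≡ ⊖ vsum (Vec.map e a)
  vsum-⊖ []      = sym (⊖-origin d)
  vsum-⊖ (x ∷ a) = trans (cong ((⊖ e x) ⊕_) (vsum-⊖ a)) (sym (⊖-⊕ (e x) (vsum (Vec.map e a))))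

e-⟦⟧ : ∀ {d} (x : Fin d) (c : Vec ℕ d) → e x ⊕ ⟦ c ⟧ ≡ ⟦ c Vec.[ x ]%= suc ⟧
e-⟦⟧ Fin.zero    (k ∷ c) = cong (+ suc k ∷_) (⊕-identityˡ ⟦ c ⟧)
e-⟦⟧ (Fin.suc x) (k ∷ c) = cong (+ k ∷_) (e-⟦⟧ x c)

vsum-content : ∀ {d r} (xs : Vec (Fin d) r) → vsum (Vec.map e xs) ≡ ⟦ content xs ⟧
vsum-content {d} []   = sym (Vec.map-replicate (+_) 0 d)
vsum-content (x ∷ xs) = trans (cong (e x ⊕_) (vsum-content xs)) (e-⟦⟧ x (content xs))

-- The first block of the word becomes the head of the vector, which is the last step of a chain.
-- This reversal is harmless, since the endpoint depends only on the sum of the steps.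
vsum-concat : ∀ {d r n} (X : Vec (Vec (Fin d) r) n) → vsum (Vec.map e (Vec.concat X)) ≡ displacement (Vec.map content X)
vsum-concat []       = refl
vsum-concat (x ∷ X) = trans (cong vsum (Vec.map-++ e x (Vec.concat X)))
  (trans (vsum-++ (Vec.map e x) (Vec.map e (Vec.concat X)))
    (trans (cong₂ _⊕_ (vsum-content x) (vsum-concat X)) (⊕-comm ⟦ content x ⟧ _)))

endpoint-displacement : ∀ {n r d} (X Y : Vec (Vec (Fin d) r) n) →
  endpoint (walk n r d (X , Y)) ≡ displacement (Vec.map content X) ⊕ (⊖ displacement (Vec.map content Y))
endpoint-displacement X Y = begin
  Vec.foldl′ _⊕_ origin (Vec.map e a Vec.++ Vec.map (⊖_ ∘ e) b)
    ≡⟨ foldl-vsum origin (Vec.map e a Vec.++ Vec.map (⊖_ ∘ e) b) ⟩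
  origin ⊕ vsum (Vec.map e a Vec.++ Vec.map (⊖_ ∘ e) b)
    ≡⟨ trans (⊕-identityˡ _) (vsum-++ (Vec.map e a) (Vec.map (⊖_ ∘ e) b)) ⟩
  vsum (Vec.map e a) ⊕ vsum (Vec.map (⊖_ ∘ e) b)
    ≡⟨ cong₂ _⊕_ (vsum-concat X) (trans (vsum-⊖ b) (cong ⊖_ (vsum-concat Y))) ⟩
  displacement (Vec.map content X) ⊕ (⊖ displacement (Vec.map content Y)) ∎
  where
  open ≡-Reasoning
  a = Vec.concat X
  b = Vec.concat Y

-- The origin of the endpoints in (ii): `T(π)` is the difference between a point of the orbit of `ρ`
-- and `ρ` itself.
ρ-T : ∀ {d} (π : Permutation′ d) → ρ d ⊕ T⟨ π ⟩ ≡ vector π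
ρ-T {d} π = go (λ i → + toℕ i) (λ i → + toℕ (π ⟨$⟩ʳ i))
  where
  cancel : ∀ x y → ℤ.- x ℤ.+ (x ℤ.- y) ≡ ℤ.- y
  cancel = solve-∀ℤ
  go : ∀ {d} (f g : Fin d → ℤ) → Vec.tabulate (λ i → ℤ.- f i) ⊕ Vec.tabulate (λ i → f i ℤ.- g i) ≡ Vec.tabulate (λ i → ℤ.- g i)
  go {zero}  f g = refl
  go {suc d} f g = cong₂ _∷_ (cancel (f Fin.zero) (g Fin.zero)) (go (f ∘ Fin.suc) (g ∘ Fin.suc))

module _ (n r d : ℕ) where

  private
    S = blockWords n r d

  signedWalkCount : ∑Sym d (λ π → sgn π ℤ.* + walkCount n r d π) ≡
    ∑ℤ (sequences n (bits d r)) (λ A → ∑ℤ (sequences n (bits d r)) (λ B → signedCount (position A ⊕ (⊖ displacement B))))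
  signedWalkCount = begin
    ∑Sym d (λ π → sgn π ℤ.* + walkCount n r d π)
      ≡⟨ foldr-∑ℤ (perms d) ⟩
    ∑ℤ (perms d) (λ π → sgn π ℤ.* + walkCount n r d π)
      ≡⟨ ∑ℤ-cong (perms d) (λ π _ → trans (cong (sgn π ℤ.*_)
           (trans (length-filter (endsAt? n r d T⟨ π ⟩) (cartesianProduct S S)) (∑ℤ-cong (cartesianProduct S S) λ X _ → match π X)))
           (sym (∑ℤ-* (cartesianProduct S S) (sgn π) _))) ⟩
    ∑ℤ (perms d) (λ π → ∑ℤ (cartesianProduct S S) (λ X → sgn π ℤ.* χℤ (end X ≟ᵛ vector π)))
      ≡⟨ ∑ℤ-swap (perms d) (cartesianProduct S S) (λ π X → sgn π ℤ.* χℤ (end X ≟ᵛ vector π)) ⟩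
    ∑ℤ (cartesianProduct S S) (signedCount ∘ end)
      ≡⟨ ∑ℤ-product _,_ S S (signedCount ∘ end) ⟩
    ∑ℤ S (λ X → ∑ℤ S (λ Y → signedCount (position (Vec.map content X) ⊕ (⊖ displacement (Vec.map content Y)))))
      -- The weight of a pair of block words depends only on their contents, which run through the
      -- 0/1 vectors of weight `r` once each.
      ≡⟨ trans (∑ℤ-cong S λ X _ → sym (∑ℤ-sequences-map content n (combs d r) (λ B → signedCount (position (Vec.map content X) ⊕ (⊖ displacement B)))))
           (sym (∑ℤ-sequences-map content n (combs d r) (λ A → ∑ℤ (sequences n (List.map content (combs d r))) (λ B → signedCount (position A ⊕ (⊖ displacement B)))))) ⟩
    ∑ℤ (sequences n (List.map content (combs d r))) (λ A → ∑ℤ (sequences n (List.map content (combs d r))) (λ B → signedCount (position A ⊕ (⊖ displacement B))))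
      ≡⟨ cong (λ K → ∑ℤ (sequences n K) (λ A → ∑ℤ (sequences n K) (λ B → signedCount (position A ⊕ (⊖ displacement B))))) (bits-content d r) ⟩
    ∑ℤ (sequences n (bits d r)) (λ A → ∑ℤ (sequences n (bits d r)) (λ B → signedCount (position A ⊕ (⊖ displacement B)))) ∎
    where
    open ≡-Reasoning
    end : Vec (Vec (Fin d) r) n × Vec (Vec (Fin d) r) n → Point d
    end (X , Y) = position (Vec.map content X) ⊕ (⊖ displacement (Vec.map content Y))
    end≡ : ∀ X → ρ d ⊕ endpoint (walk n r d X) ≡ end X
    end≡ (X , Y) = trans (cong (ρ d ⊕_) (endpoint-displacement X Y)) (sym (⊕-assoc (ρ d) _ _))
    match : ∀ π X → χℤ (endsAt? n r d T⟨ π ⟩ X) ≡ χℤ (end X ≟ᵛ vector π)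
    match π X = cong +_ (χ-cong (endsAt? n r d T⟨ π ⟩ X) (end X ≟ᵛ vector π)
      (λ eq → trans (sym (end≡ X)) (trans (cong (ρ d ⊕_) eq) (ρ-T π)))
      (λ eq → ⊕-cancelˡ (ρ d) (trans (end≡ X) (trans eq (sym (ρ-T π))))))
    foldr-∑ℤ : ∀ {A : Set} {f : A → ℤ} (xs : List A) → List.foldr ℤ._+_ 0ℤ (List.map f xs) ≡ ∑ℤ xs f
    foldr-∑ℤ []       = refl
    foldr-∑ℤ {f = f} (x ∷ xs) = cong (ℤ._+_ (f x)) (foldr-∑ℤ xs)

at-displacement : ∀ {n d} (A : Vec (Vec ℕ d) n) i → at 0ℤ (displacement A) i ≡ + total A i
at-displacement {d = d} [] i = go d i
  where
  go : ∀ d i → at 0ℤ (origin {d}) i ≡ 0ℤ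
  go zero    i       = refl
  go (suc d) zero    = refl
  go (suc d) (suc i) = go d i
at-displacement (ε ∷ A) i = trans (at-⊕ (displacement A) ⟦ ε ⟧ i) (cong₂ ℤ._+_ (at-displacement A i) (at-⟦⟧ ε i))

total-≥ : ∀ {n d} (A : Vec (Vec ℕ d) n) {c} → d ≤ c → total A c ≡ 0
total-≥ []      _   = refl
total-≥ (ε ∷ A) d≤c = cong₂ _+_ (total-≥ A d≤c) (at-≥ 0 ε d≤c)

at-position : ∀ {n d} (A : Vec (Vec ℕ d) n) {i} → i < d → at 0ℤ (position A) i ≡ ℤ.- + i ℤ.+ + total A i
at-position {d = d} A {i} i<d = trans (at-⊕ (ρ d) (displacement A) i) (cong₂ ℤ._+_ (at-ρ d i<d) (at-displacement A i))

module _ {n d : ℕ} (A : Vec (Vec ℕ d) n) where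

  private
    shiftˡ : ∀ i a → (1ℤ ℤ.+ i) ℤ.+ (ℤ.- (1ℤ ℤ.+ i) ℤ.+ a) ≡ a
    shiftˡ = solve-∀ℤ
    shiftʳ : ∀ i a → (1ℤ ℤ.+ i) ℤ.+ (ℤ.- i ℤ.+ a) ≡ 1ℤ ℤ.+ a
    shiftʳ = solve-∀ℤ
    unshift : ∀ i a → ℤ.- (1ℤ ℤ.+ i) ℤ.+ ((1ℤ ℤ.+ i) ℤ.+ a) ≡ a
    unshift = solve-∀ℤ

  -- Coordinate `i` of the position is the column height minus `i`, so the shift by `ρ` widens every
  -- gap between neighbours by one; adding `i + 1` to both sides clears it.
  decreasing⇒strictlyDecreasing : Decreasing (total A) → StrictlyDecreasing (position A)
  decreasing⇒strictlyDecreasing dec i i<d = subst₂ ℤ._<_ (sym (at-position A i<d)) (sym (at-position A (<-trans (n<1+n i) i<d)))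
    (subst₂ ℤ._<_ (unshift (+ i) _) (unshift (+ i) _) (ℤ.+-monoʳ-< (ℤ.- + suc i)
      (subst₂ ℤ._<_ (sym (shiftˡ (+ i) _)) (sym (shiftʳ (+ i) _)) (ℤ.+<+ (s≤s (dec i))))))

  strictlyDecreasing⇒decreasing : StrictlyDecreasing (position A) → Decreasing (total A)
  strictlyDecreasing⇒decreasing sd i with suc i <? d
  ... | no i≮d  = ≤-trans (≤-reflexive (total-≥ A (≮⇒≥ i≮d))) z≤n
  ... | yes i<d = s≤s⁻¹ (ℤ.drop‿+<+ (subst₂ ℤ._<_ (shiftˡ (+ i) _) (shiftʳ (+ i) _) (ℤ.+-monoʳ-< (+ suc i)
    (subst₂ ℤ._<_ (at-position A i<d) (at-position A (<-trans (n<1+n i) i<d)) (sd i i<d)))))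

module _ {r d : ℕ} where

  valid⇒inChamber : ∀ {n} (A : Vec (Vec ℕ d) n) → ValidSteps r A → A ∈ sequences n (bits d r) × InChamber A
  valid⇒inChamber []      _ = here refl , tt
  valid⇒inChamber (ε ∷ A) (valid , bit , weight , dec) with A∈ , inA ← valid⇒inChamber A valid =
    ∈-sequences⁺ (∈-bits⁺ ε bit weight) A∈ , inA , decreasing⇒strictlyDecreasing (ε ∷ A) dec

  inChamber⇒valid : ∀ {n} (A : Vec (Vec ℕ d) n) → A ∈ sequences n (bits d r) → InChamber A → ValidSteps r A
  inChamber⇒valid []      _  _          = tt
  inChamber⇒valid (ε ∷ A) A∈ (inA , sd) with ε∈ , A∈′ ← ∈-sequences⁻ (bits d r) A∈ with bit , weight ← ∈-bits⁻ d r ε∈ =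
    inChamber⇒valid A A∈′ inA , bit , weight , strictlyDecreasing⇒decreasing (ε ∷ A) sd

  position≡⇔total≡ : ∀ {n} (A B : Vec (Vec ℕ d) n) → (position A ≡ position B → ∀ c → total A c ≡ total B c) ×
    ((∀ c → total A c ≡ total B c) → position A ≡ position B)
  position≡⇔total≡ A B =
    (λ eq c → ℤ.+-injective (trans (sym (at-displacement A c)) (trans (cong (λ x → at 0ℤ x c) (⊕-cancelˡ (ρ d) eq)) (at-displacement B c)))) ,
    (λ eq → cong (ρ d ⊕_) (at-ext 0ℤ _ _ λ c _ → trans (at-displacement A c) (trans (cong +_ (eq c)) (sym (at-displacement B c)))))

-- The three counts

pairCount : (n r d : ℕ) → ℕ
pairCount n r d = length (filter (pairInChamber? d r) (cartesianProduct (sequences n (bits d r)) (sequences n (bits d r))))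

validPairs-hasCard : ∀ n r d → HasCard (ValidPair n r d) (pairCount n r d)
validPairs-hasCard n r d = hasCard-map id (hasCard-filter (pairInChamber? d r) (Unique.cartesianProduct⁺ u u))
  (λ {(A , B)} (AB∈ , inA , inB , eq) → let (A∈ , B∈) = ∈-cartesianProduct⁻ L L AB∈ in
    inChamber⇒valid A A∈ inA , inChamber⇒valid B B∈ inB , proj₁ (position≡⇔total≡ {r} A B) eq)
  (λ _ _ → id)
  (λ {(A , B)} (validA , validB , eq) → let (A∈ , inA) = valid⇒inChamber A validA ; (B∈ , inB) = valid⇒inChamber B validB in
    (A , B) , (∈-cartesianProduct⁺ A∈ B∈ , inA , inB , proj₂ (position≡⇔total≡ {r} A B) eq) , refl)
  where
  L = sequences n (bits d r)
  u = sequences-unique n (bits-unique d r)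

pairCount-signed : ∀ n r d → + pairCount n r d ≡ ∑Sym d (λ π → sgn π ℤ.* + walkCount n r d π)
pairCount-signed n r d = trans (sym (reflection d r n)) (sym (signedWalkCount n r d))

≗-refl : ∀ {l n} → l ≗⟨ n ⟩ l
≗-refl i _ k = refl

module _ {n r d : ℕ} {D : Set} {Q : D → Set}
  (make  : (l m : ℕ → ℕ → ℕ) → D)
  (rows₁ rows₂ : D → ℕ → ℕ → ℕ)
  (make-Q     : ∀ {l m} → RowChainPair n r d l m → Q (make l m))
  (rows-chain : ∀ {x} → Q x → RowChainPair n r d (rows₁ x) (rows₂ x))
  (rows-make  : ∀ {l m} → RowChainPair n r d l m → rows₁ (make l m) ≗⟨ n ⟩ l × rows₂ (make l m) ≗⟨ n ⟩ m)
  (make-rows  : ∀ {x} → Q x → ∀ {l m} → RowChainPair n r d l m → l ≗⟨ n ⟩ rows₁ x → m ≗⟨ n ⟩ rows₂ x → make l m ≡ x) where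

  -- Injectivity returns through `stepsOf` to vectors, where agreement of chains becomes an
  -- equation. For surjectivity the rows of `x` are turned into steps and back, which restores them
  -- only up to `_≗⟨_⟩_`; this is why `make-rows` accepts any chains that agree with them.
  chains-hasCard : ∀ {N} → HasCard (ValidPair n r d) N → HasCard Q N
  chains-hasCard card = hasCard-map (λ (A , B) → make (rowsOf A) (rowsOf B)) card
    (λ {(A , B)} valid → make-Q (validPair⇒chains {A = A} {B} valid))
    (λ {(A , B)} {(A′ , B′)} valid valid′ eq → cong₂ _,_
      (trans (sym (recover₁ A B valid)) (trans (cong (stepsOf n d ∘ rows₁) eq) (recover₁ A′ B′ valid′)))
      (trans (sym (recover₂ A B valid)) (trans (cong (stepsOf n d ∘ rows₂) eq) (recover₂ A′ B′ valid′))))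
    (λ {x} q → let chains@(L , M , _) = rows-chain q ; valid = chains⇒validPair chains in
      (stepsOf n d (rows₁ x) , stepsOf n d (rows₂ x)) , valid ,
      make-rows q (validPair⇒chains {A = stepsOf n d (rows₁ x)} {stepsOf n d (rows₂ x)} valid) (rowsOf-stepsOf L) (rowsOf-stepsOf M))
    where
    recover₁ : ∀ A B → ValidPair n r d (A , B) → stepsOf n d (rows₁ (make (rowsOf A) (rowsOf B))) ≡ A
    recover₁ A B valid = trans (stepsOf-cong n d (proj₁ (rows-make (validPair⇒chains {A = A} {B} valid)))) (stepsOf-rowsOf A (proj₁ valid))
    recover₂ : ∀ A B → ValidPair n r d (A , B) → stepsOf n d (rows₂ (make (rowsOf A) (rowsOf B))) ≡ B
    recover₂ A B valid = trans (stepsOf-cong n d (proj₂ (rows-make (validPair⇒chains {A = A} {B} valid)))) (stepsOf-rowsOf B (proj₁ (proj₂ valid)))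

graphs-hasCard : ∀ n r d {N} → HasCard (ValidPair n r d) N → HasCard (Ĝ n r d) N
graphs-hasCard n r d = chains-hasCard {Q = Ĝ n r d}
  (λ l m → fromMultiplicity n (Retract.matrix n l m))
  (λ G i → grow (multiplicity G) i n) (λ G → grow (multiplicity G) n)
  chains⇒Ĝ (λ {G} → Ĝ⇒chains G) chains-graph-chains (λ {G} _ → graph-chains-graph G)

module _ (n r d : ℕ) .{{_ : NonZero r}} where

  shape-tableauOf : ∀ {l} → RowChain n r d l → shape (tableauOf n r l) ≡ List.applyUpTo (l n) (conj n (l n) 0)
  shape-tableauOf {l} L = trans (List.map-applyUpTo _ length (conj n (l n) 0)) (applyUpTo-cong (conj n (l n) 0) λ k _ →
    trans (length-row (wordOf n r l) k (n * r)) (trans (cong (occ (wordOf n r l) k) (*-comm n r)) (occ-wordOf L n ≤-refl k)))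

  -- A shape lists only the nonempty rows; read with default 0 it gives every row length, because
  -- the rows past the end of the list are empty.
  same-shape : ∀ {P Q} → RestrictedSYT n r d P → RestrictedSYT n r d Q → shape P ≡ shape Q →
    ∀ k → rowsOfTableau r P n k ≡ rowsOfTableau r Q n k
  same-shape {P} {Q} SP SQ eq k = trans (sym (value SP k)) (trans (cong (λ xs → entry xs k) eq) (value SQ k))
    where
    entry : List ℕ → ℕ → ℕ
    entry List.[]       k       = 0
    entry (x List.∷ xs) zero    = x
    entry (x List.∷ xs) (suc k) = entry xs k
    entry-applyUpTo : ∀ f R k → (∀ k → R ≤ k → f k ≡ 0) → entry (List.applyUpTo f R) k ≡ f k
    entry-applyUpTo f zero    k       h = sym (h k z≤n)
    entry-applyUpTo f (suc R) zero    h = refl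
    entry-applyUpTo f (suc R) (suc k) h = entry-applyUpTo (f ∘ suc) R k λ k R≤k → h (suc k) (s≤s R≤k)
    value : ∀ {T} → RestrictedSYT n r d T → ∀ k → entry (shape T) k ≡ rowsOfTableau r T n k
    value {T} S k = trans (cong (λ T → entry (shape T) k) (sym (tableauOf-rowsOfTableau S ≗-refl)))
      (trans (cong (λ xs → entry xs k) (shape-tableauOf L)) (entry-applyUpTo (rowsOfTableau r T n) _ k λ k R≤k →
        n≤0⇒n≡0 (≮⇒≥ λ 0<l → ≤⇒≯ R≤k (nonempty 0<l))))
      where
      L = restricted⇒rowChain S
      nonempty : ∀ {k} → 0 < rowsOfTableau r T n k → k < conj n (rowsOfTableau r T n) 0
      nonempty {k} 0<l = <conj⁺ n (RowChain.decreasing L n ≤-refl)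
        (≰⇒> λ n≤k → <⇒≢ 0<l (sym (RowChain.height L n ≤-refl k n≤k))) 0<l

  tableaux-hasCard : ∀ {N} → HasCard (ValidPair n r d) N → HasCard (TableauPair n r d) N
  tableaux-hasCard = chains-hasCard (λ l m → tableauOf n r l , tableauOf n r m)
    (rowsOfTableau r ∘ proj₁) (rowsOfTableau r ∘ proj₂)
    (λ {l} {m} (L , M , l≡m) →
      trans (shape-tableauOf L) (trans (trans (cong (List.applyUpTo (l n)) (conj-cong n (λ k _ → l≡m k) 0))
        (applyUpTo-cong (conj n (m n) 0) λ k _ → l≡m k)) (sym (shape-tableauOf M))) ,
      rowChain⇒restricted L , rowChain⇒restricted M)
    (λ (eq , SP , SQ) → restricted⇒rowChain SP , restricted⇒rowChain SQ , same-shape SP SQ eq)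
    (λ (L , M , _) → rowsOfTableau-tableauOf L , rowsOfTableau-tableauOf M)
    (λ (_ , SP , SQ) _ l≗ m≗ → cong₂ _,_ (tableauOf-rowsOfTableau SP l≗) (tableauOf-rowsOfTableau SQ m≗))

theorem4 : (n r d : ℕ) → .{{NonZero n}} → .{{NonZero r}} →
    Σ[ ĝ ∈ ℕ ]
    HasCard (Ĝ n r d) ĝ ×
    HasCard (TableauPair n r d) ĝ ×
    (Σ[ ŵ ∈ (Permutation′ d → ℕ) ]
    ((π : Permutation′ d) → HasCard (Ŵ′ n r T⟨ π ⟩) (ŵ π)) ×
    + ĝ ≡ ∑Sym d (λ π → sgn π ℤ.* + ŵ π))
theorem4 n r d = pairCount n r d ,
  graphs-hasCard n r d (validPairs-hasCard n r d) ,
  tableaux-hasCard n r d (validPairs-hasCard n r d) ,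
  walkCount n r d , walks-hasCard n r d , pairCount-signed n r d
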